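{- (i) For all integers $n,m\geq 2$, $t(nm)\geq n\,t(m)+t(n)$. (ii) For all primes $p,q\geq 3$, $t(pq)\geq pq-5$, and moreover $t(pq)\geq pq-3$ if $q-1$ divides $p-1$.
   Context: For a positive integer $n$ let $S(\mathbb{Z}_n)$ be the set of bijections $\mathbb{Z}_n\to\mathbb{Z}_n$. For $\pi\in S(\mathbb{Z}_n)$, $\mathrm{cyc}(\pi)$ is the number of cycles (including fixed points) of $\pi$ and $t(\pi)=n-\mathrm{cyc}(\pi)$. Let $[\pi]=\{x\mapsto \pi(x+b): b\in\mathbb{Z}_n\}$, $t([\pi])=\min_{\sigma\in[\pi]}t(\sigma)$, and $t(n)=\max_{\pi\in S(\mathbb{Z}_n)}t([\pi])$. -}

module Defs where

open import Data.Fin.Base using (Fin; zero; suc; toℕ; fromℕ<; punchIn)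
open import Data.Fin.Permutation using (Permutation′; _⟨$⟩ʳ_; _∘ₚ_; _≈_; permutation; insert; remove; insert-remove; insert-punchIn) renaming (id to idₚ)
open import Data.Fin.Properties using (_≟_; any?; pigeonhole; toℕ<n; toℕ-fromℕ<; toℕ-injective)
open import Data.List.Base using (List; []; _∷_; map; length; allFin; deduplicate; cartesianProductWith)
open import Data.List.Extrema.Nat using (min; max)
open import Data.List.Membership.Propositional using (_∈_)
open import Data.List.Membership.Propositional.Properties using (∈-cartesianProductWith⁺; ∈-allFin)
open import Data.List.Relation.Unary.Any using (here)
open import Data.Nat.Base using (ℕ; zero; suc; _+_; _∸_; _<_)
open import Data.Nat.DivMod using (_%_; _mod_; m%n<n; m%n%n≡m%n; [m+n]%n≡m%n; m<n⇒m%n≡m; %-distribˡ-+)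
open import Data.Nat.GeneralisedArithmetic using (fold; fold-+)
open import Data.Nat.Induction using (<-rec)
open import Data.Nat.Properties using (+-assoc; m∸n+n≡m; m+[n∸m]≡n; <⇒≤; ≤-trans; ≤-pred; ≮⇒≥; +-monoʳ-<; n<1+n; _<?_)
open import Data.Product.Base using (∃; _×_; _,_)
open import Relation.Binary.Definitions using (Decidable)
open import Relation.Binary.PropositionalEquality using (_≡_; refl; sym; trans; cong; subst; module ≡-Reasoning)
open import Relation.Nullary.Decidable using (yes; no; map′)

-- ℤ_n is represented by Fin n, with the following addition.

infixl 6 _⊕_
infix 8 ⊖_

_⊕_ : ∀ {n} → Fin n → Fin n → Fin n
_⊕_ {suc n} x y = (toℕ x + toℕ y) mod suc n

⊖_ : ∀ {n} → Fin n → Fin n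
⊖_ {suc n} x = (suc n ∸ toℕ x) mod suc n

toℕ-⊕ : ∀ {n} (x y : Fin (suc n)) → toℕ (x ⊕ y) ≡ (toℕ x + toℕ y) % suc n
toℕ-⊕ {n} x y = toℕ-fromℕ< (m%n<n (toℕ x + toℕ y) (suc n))

toℕ-⊖ : ∀ {n} (x : Fin (suc n)) → toℕ (⊖ x) ≡ (suc n ∸ toℕ x) % suc n
toℕ-⊖ {n} x = toℕ-fromℕ< (m%n<n (suc n ∸ toℕ x) (suc n))

private
  [m%d+k%d]%d : ∀ m k n → (m % suc n + k % suc n) % suc n ≡ (m + k) % suc n
  [m%d+k%d]%d m k n = sym (%-distribˡ-+ m k (suc n))

  [m%d+k]%d : ∀ m k n → (m % suc n + k) % suc n ≡ (m + k) % suc n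
  [m%d+k]%d m k n = begin
    (m % suc n + k) % suc n                   ≡⟨ %-distribˡ-+ (m % suc n) k (suc n) ⟩
    (m % suc n % suc n + k % suc n) % suc n   ≡⟨ cong (λ z → (z + k % suc n) % suc n) (m%n%n≡m%n m (suc n)) ⟩
    (m % suc n + k % suc n) % suc n           ≡⟨ [m%d+k%d]%d m k n ⟩
    (m + k) % suc n                           ∎
    where open ≡-Reasoning

  [k+m%d]%d : ∀ k m n → (k + m % suc n) % suc n ≡ (k + m) % suc n
  [k+m%d]%d k m n = begin
    (k + m % suc n) % suc n                   ≡⟨ %-distribˡ-+ k (m % suc n) (suc n) ⟩
    (k % suc n + m % suc n % suc n) % suc n   ≡⟨ cong (λ z → (k % suc n + z) % suc n) (m%n%n≡m%n m (suc n)) ⟩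
    (k % suc n + m % suc n) % suc n           ≡⟨ [m%d+k%d]%d k m n ⟩
    (k + m) % suc n                           ∎
    where open ≡-Reasoning

  cancel : ∀ n (x : Fin (suc n)) {a b} → a + b ≡ suc n →
           (toℕ x + a + b) % suc n ≡ toℕ x
  cancel n x {a} {b} a+b≡n = begin
    (toℕ x + a + b) % suc n     ≡⟨ cong (_% suc n) (+-assoc (toℕ x) a b) ⟩
    (toℕ x + (a + b)) % suc n   ≡⟨ cong (λ z → (toℕ x + z) % suc n) a+b≡n ⟩
    (toℕ x + suc n) % suc n     ≡⟨ [m+n]%n≡m%n (toℕ x) (suc n) ⟩
    toℕ x % suc n               ≡⟨ m<n⇒m%n≡m (toℕ<n x) ⟩
    toℕ x                       ∎
    where open ≡-Reasoning

⊕-⊖-cancel : ∀ {n} (b x : Fin n) → (x ⊕ b) ⊕ ⊖ b ≡ x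
⊕-⊖-cancel {suc n} b x = toℕ-injective (begin
  toℕ ((x ⊕ b) ⊕ ⊖ b)                                     ≡⟨ toℕ-⊕ (x ⊕ b) (⊖ b) ⟩
  (toℕ (x ⊕ b) + toℕ (⊖ b)) % suc n                       ≡⟨ cong (λ z → (z + toℕ (⊖ b)) % suc n) (toℕ-⊕ x b) ⟩
  ((toℕ x + toℕ b) % suc n + toℕ (⊖ b)) % suc n           ≡⟨ [m%d+k]%d (toℕ x + toℕ b) (toℕ (⊖ b)) n ⟩
  (toℕ x + toℕ b + toℕ (⊖ b)) % suc n                     ≡⟨ cong (λ z → (toℕ x + toℕ b + z) % suc n) (toℕ-⊖ b) ⟩
  (toℕ x + toℕ b + (suc n ∸ toℕ b) % suc n) % suc n       ≡⟨ [k+m%d]%d (toℕ x + toℕ b) (suc n ∸ toℕ b) n ⟩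
  (toℕ x + toℕ b + (suc n ∸ toℕ b)) % suc n               ≡⟨ cancel n x (m+[n∸m]≡n (<⇒≤ (toℕ<n b))) ⟩
  toℕ x                                                   ∎)
  where open ≡-Reasoning

⊖-⊕-cancel : ∀ {n} (b x : Fin n) → (x ⊕ ⊖ b) ⊕ b ≡ x
⊖-⊕-cancel {suc n} b x = toℕ-injective (begin
  toℕ ((x ⊕ ⊖ b) ⊕ b)                                     ≡⟨ toℕ-⊕ (x ⊕ ⊖ b) b ⟩
  (toℕ (x ⊕ ⊖ b) + toℕ b) % suc n                         ≡⟨ cong (λ z → (z + toℕ b) % suc n) (toℕ-⊕ x (⊖ b)) ⟩
  ((toℕ x + toℕ (⊖ b)) % suc n + toℕ b) % suc n           ≡⟨ cong (λ z → ((toℕ x + z) % suc n + toℕ b) % suc n) (toℕ-⊖ b) ⟩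
  ((toℕ x + (suc n ∸ toℕ b) % suc n) % suc n + toℕ b) % suc n
    ≡⟨ cong (λ z → (z + toℕ b) % suc n) ([k+m%d]%d (toℕ x) (suc n ∸ toℕ b) n) ⟩
  ((toℕ x + (suc n ∸ toℕ b)) % suc n + toℕ b) % suc n     ≡⟨ [m%d+k]%d (toℕ x + (suc n ∸ toℕ b)) (toℕ b) n ⟩
  (toℕ x + (suc n ∸ toℕ b) + toℕ b) % suc n               ≡⟨ cancel n x (m∸n+n≡m (<⇒≤ (toℕ<n b))) ⟩
  toℕ x                                                   ∎)
  where open ≡-Reasoning

translate : ∀ {n} → Fin n → Permutation′ n
translate b = permutation (_⊕ b) (_⊕ ⊖ b) (⊖-⊕-cancel b) (⊕-⊖-cancel b)

SameCycle : ∀ {n} → Permutation′ n → Fin n → Fin n → Set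
SameCycle π x y = ∃ λ k → fold x (π ⟨$⟩ʳ_) k ≡ y

private
  shorten : ∀ {n} (f : Fin n → Fin n) (x y : Fin n) k → fold x f k ≡ y →
            ∃ λ (i : Fin n) → fold x f (toℕ i) ≡ y
  shorten {n} f x y = <-rec _ step
    where
    P : ℕ → Set
    P k = fold x f k ≡ y → ∃ λ (i : Fin n) → fold x f (toℕ i) ≡ y

    step : ∀ k → (∀ {l} → l < k → P l) → P k
    step k rec eq with k <? n
    ... | yes k<n = fromℕ< k<n , trans (cong (fold x f) (toℕ-fromℕ< k<n)) eq
    ... | no  k≮n
      with i , j , i<j , fᵢ≡fⱼ ← pigeonhole (n<1+n n) (λ (l : Fin (suc n)) → fold x f (toℕ l))
      = rec {k ∸ toℕ j + toℕ i} smaller (begin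
          fold x f (k ∸ toℕ j + toℕ i)             ≡⟨ fold-+ x f (k ∸ toℕ j) ⟩
          fold (fold x f (toℕ i)) f (k ∸ toℕ j)    ≡⟨ cong (λ z → fold z f (k ∸ toℕ j)) fᵢ≡fⱼ ⟩
          fold (fold x f (toℕ j)) f (k ∸ toℕ j)    ≡⟨ fold-+ x f (k ∸ toℕ j) ⟨
          fold x f (k ∸ toℕ j + toℕ j)             ≡⟨ cong (fold x f) k∸j+j≡k ⟩
          fold x f k                               ≡⟨ eq ⟩
          y                                        ∎)
      where
      open ≡-Reasoning
      k∸j+j≡k : k ∸ toℕ j + toℕ j ≡ k
      k∸j+j≡k = m∸n+n≡m (≤-trans (≤-pred (toℕ<n j)) (≮⇒≥ k≮n))
      smaller : k ∸ toℕ j + toℕ i < k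
      smaller = subst (k ∸ toℕ j + toℕ i <_) k∸j+j≡k (+-monoʳ-< (k ∸ toℕ j) i<j)

sameCycle? : ∀ {n} (π : Permutation′ n) → Decidable (SameCycle π)
sameCycle? π x y =
  map′ (λ (i , eq) → toℕ i , eq)
       (λ (k , eq) → shorten (π ⟨$⟩ʳ_) x y k eq)
       (any? (λ i → fold x (π ⟨$⟩ʳ_) (toℕ i) ≟ y))

-- `deduplicate` keeps exactly one representative of each cycle.
cyc : ∀ {n} → Permutation′ n → ℕ
cyc {n} π = length (deduplicate (sameCycle? π) (allFin n))

tₚ : ∀ {n} → Permutation′ n → ℕ
tₚ {n} π = n ∸ cyc π

-- [π] = { x ↦ π (x + b) : b ∈ ℤ_n }; note that (ρ ∘ₚ π) x = π (ρ x).
class : ∀ {n} → Permutation′ n → List (Permutation′ n)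
class {n} π = map (λ b → translate b ∘ₚ π) (allFin n)

-- The default value tₚ π is harmless, being the term b = 0.
t[_] : ∀ {n} → Permutation′ n → ℕ
t[ π ] = min (tₚ π) (map tₚ (class π))

permutations : ∀ n → List (Permutation′ n)
permutations zero    = idₚ ∷ []
permutations (suc n) = cartesianProductWith (insert zero) (allFin (suc n)) (permutations n)

private
  insert-cong : ∀ {n} (j : Fin (suc n)) {π ρ : Permutation′ n} → π ≈ ρ →
                insert zero j π ≈ insert zero j ρ
  insert-cong j π≈ρ zero            = refl
  insert-cong j {π} {ρ} π≈ρ (suc k) =
    trans (insert-punchIn zero j π k)
      (trans (cong (punchIn j) (π≈ρ k)) (sym (insert-punchIn zero j ρ k)))

permutations-complete : ∀ {n} (π : Permutation′ n) → ∃ λ ρ → ρ ∈ permutations n × ρ ≈ π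
permutations-complete {zero}  π = idₚ , here refl , λ ()
permutations-complete {suc n} π
  with ρ , ρ∈ , ρ≈ ← permutations-complete (remove zero π)
  = insert zero (π ⟨$⟩ʳ zero) ρ
  , ∈-cartesianProductWith⁺ (insert zero) (∈-allFin (π ⟨$⟩ʳ zero)) ρ∈
  , λ i → trans (insert-cong (π ⟨$⟩ʳ zero) {ρ} {remove zero π} ρ≈ i) (insert-remove zero π i)

-- The default 0 is harmless: `permutations n` is nonempty. Only n ≥ 1 is meaningful.
t : ℕ → ℕ
t n = max 0 (map t[_] (permutations n))

{-# OPTIONS --safe #-}
module Submission where

-- The translates of π are x ↦ π (x + b), and an upper bound on their numbers of cycles is a lower
-- bound on t. Except when p = q they are skew products (i , j) ↦ (α_j i , β j) with fibre ℤ/n over the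
-- base ℤ/m, in coordinates on ℤ/nm in which a translation acts as (i , j) ↦ (i + s_j , j + b₀). The
-- cycles over a cycle of the base are those of its return map on one fibre.
--
-- (i) Take β and α extremal for m and n, with α_j = α for one j and the identity for the others.
--
-- (ii) Take j ↦ γ j in the base ℤ/p, with γ a primitive root: every translate has a fixed point and a
-- (p − 1)-cycle. In the fibre ℤ/q use powers of a primitive root g; if p ≥ q the exponents can be
-- chosen in {1, 2} with sum ≡ 3 mod q − 1, and this gives 5 cycles.
--
-- If q − 1 ∣ p − 1 and p ≠ q, let α_j i = g i + c_j. The return map of the long cycle is then a
-- translation, by an amount that depends on c through a character sum; combinations of
-- translates of a character γ ↦ g make it nonzero throughout, and the long cycle contributes a single
-- cycle. If p = q, multiplication by a primitive root modulo p² has 3 cycles, and so does each translate.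

open import Defs using (t)
open import Data.Nat.Primality using (Prime)
open import Data.Product.Base using (_×_)

-- In digit coordinates the shifts s_j contain the carries out of the base, which are hard to
-- control. So the counts should hold for all shifts. In (i) the shifts only move α within its
-- class. An affine fibre map keeps its multiplier under shifts, and a multiplier other than 1
-- forces a fixed point, so the multiplier alone bounds the number of cycles.
--
-- The constant 5 comes from parity. The fixed point of a translate of the base can be any residue,
-- and the fibre over it costs 2 cycles if the multiplier there is a primitive root. If all
-- exponents are odd, the exponent along the long cycle is a sum of p - 1 odd numbers, so it is even
-- and not prime to q - 1. If some exponent is even, some translate has a square over its fixed
-- point. Hence one of the two multipliers has to be allowed to be a square, which costs 3 cycles.
--
-- A return map that is a translation costs only 1, but then its amount matters, and carries would
-- spoil it. Chinese remainder coordinates have no carries: every s_j is the same. They exist only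
-- for p ≠ q, which is why p = q needs its own construction.

module Shifts where

  open import Defs using (_⊕_; ⊖_; toℕ-⊕; ⊕-⊖-cancel; ⊖-⊕-cancel; translate; SameCycle; sameCycle?; cyc; tₚ; class; t[_]; permutations; permutations-complete)
  open import Algebra.Bundles using (CommutativeMonoid)
  import Algebra.Properties.CommutativeMonoid.Sum as Sum
  open import Data.Fin.Base using (Fin; zero; suc; toℕ; fromℕ<; combine; remQuot)
  open import Data.Fin.Permutation using (Permutation′; permutation; _⟨$⟩ʳ_; _⟨$⟩ˡ_; _∘ₚ_; inverseˡ; inverseʳ) renaming (id to idₚ)
  open import Data.Fin.Properties using (_≟_; any?; pigeonhole; injective⇒≤; punchOut-injective; suc-injective; 0≢1+n; toℕ<n; toℕ-injective; toℕ-fromℕ<; toℕ-combine; combine-remQuot; remQuot-combine) renaming (<-cmp to Fin-<-cmp)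
  open import Data.Integer.Base hiding (NonZero; suc; _⊖_)
  open import Data.Integer.DivMod using (n%ℕd<d; a≡a%ℕn+[a/ℕn]*n)
  import Data.Integer.Divisibility.Signed as Signed
  open import Data.Integer.Properties hiding (_≟_)
  open import Data.Integer.Tactic.RingSolver using (solve-∀)
  open import Data.List.Base using (List; []; _∷_; _++_; map; length; lookup; allFin; deduplicate; concatMap)
  open import Data.List.Extrema.Nat using (argmax-sel; min≤xs; v≤min⁺; xs≤max)
  open import Data.List.Membership.Propositional using (_∈_; find; lose)
  open import Data.List.Membership.Propositional.Properties using (∈-allFin; ∈-lookup; ∈-map⁻; ∈-map⁺; ∈-∃++)
  open import Data.List.Properties using (length-map; length-++; length-tabulate)
  import Data.List.Relation.Unary.All as All
  open All using ([]; _∷_)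
  import Data.List.Relation.Unary.All.Properties as All
  open import Data.List.Relation.Unary.AllPairs using (AllPairs; []; _∷_)
  import Data.List.Relation.Unary.AllPairs.Properties as AllPairs
  import Data.List.Relation.Unary.Any as Any
  open Any using (Any; here; there)
  import Data.List.Relation.Unary.Any.Properties as Any
  open import Data.Nat.Base as ℕ using (ℕ; zero; suc; s≤s; NonZero)
  open import Data.Nat.Coprimality using (Coprime; coprime-Bézout; coprime-divisor; coprime-/gcd) renaming (sym to coprime-sym)
  import Data.Nat.Divisibility as ℕ
  import Data.Nat.DivMod as ℕ
  open import Data.Nat.GCD using (gcd; gcd[m,n]∣m; gcd[m,n]∣n; gcd[m,n]≢0; module Bézout)
  open import Data.Nat.GeneralisedArithmetic using (fold; fold-+)
  open import Data.Nat.Induction using (<-rec)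
  open import Data.Nat.Primality using (Prime; euclidsLemma; prime⇒nonZero; prime⇒nonTrivial; prime⇒irreducible)
  open import Data.Nat.Primality.Factorisation using (factorise)
  import Data.Nat.Properties as ℕ
  open import Data.Nat.Tactic.RingSolver using () renaming (solve-∀ to solve-∀-ℕ)
  open import Data.Product.Base using (∃; _×_; _,_; proj₁; proj₂; uncurry)
  open import Data.Sum.Base using (_⊎_; inj₁; inj₂; [_,_]′)
  open import Data.Vec.Base using (Vec; []; _∷_)
  open import Function.Base using (_∘_; id)
  open import Function.Bundles using (_↔_; mk↔ₛ′; Inverse)
  open import Function.Definitions using (Injective)
  open import Level using (0ℓ)
  open import Relation.Binary.Bundles using (Setoid)
  open import Relation.Binary.Core using (Rel)
  open import Relation.Binary.Definitions using (Decidable; tri<; tri≈; tri>)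
  open import Relation.Binary.PropositionalEquality hiding (J)
  import Relation.Binary.Reasoning.Setoid as SetoidReasoning
  open import Relation.Nullary using (¬_; ¬?; Dec; yes; no; contradiction)
  open import Relation.Nullary.Decidable using (map′; _×-dec_; decidable-stable)

  -- Counting cycles

  Reaches : ∀ {a} {A : Set a} → (A → A) → A → A → Set a
  Reaches f x y = ∃ λ k → fold x f k ≡ y

  -- Entries may share a cycle, since only upper bounds on the number of cycles are wanted. The type
  -- is arbitrary so that the notion applies to `Fin n × Fin m` and to return maps.
  Covers : ∀ {a} {A : Set a} → (A → A) → List A → Set a
  Covers f xs = ∀ y → Any (λ x → Reaches f x y) xs

  Reaches-trans : ∀ {a} {A : Set a} {f : A → A} {x y z} → Reaches f x y → Reaches f y z → Reaches f x z
  Reaches-trans {f = f} {x} (k , refl) (l , refl) = l ℕ.+ k , fold-+ x f l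

  fold-cong : ∀ {a} {A : Set a} {f g : A → A} → (∀ x → f x ≡ g x) → ∀ x k → fold x f k ≡ fold x g k
  fold-cong f≗g x zero = refl
  fold-cong {f = f} f≗g x (suc k) = trans (cong f (fold-cong f≗g x k)) (f≗g _)

  fold-shift : ∀ {a} {A : Set a} (f : A → A) x k → fold (f x) f k ≡ fold x f (suc k)
  fold-shift f x zero    = refl
  fold-shift f x (suc k) = cong f (fold-shift f x k)

  Covers-cong : ∀ {a} {A : Set a} {f g : A → A} {xs} → (∀ x → f x ≡ g x) → Covers f xs → Covers g xs
  Covers-cong f≗g f-covers y = Any.map (λ (k , eq) → k , trans (sym (fold-cong f≗g _ k)) eq) (f-covers y)

  allFin-covers : ∀ {n} (f : Fin n → Fin n) → Covers f (allFin n)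
  allFin-covers f y = Any.map (λ { refl → 0 , refl }) (∈-allFin y)

  fold-injective : ∀ {n} (π : Permutation′ n) k {x y} → fold x (π ⟨$⟩ʳ_) k ≡ fold y (π ⟨$⟩ʳ_) k → x ≡ y
  fold-injective π zero eq = eq
  fold-injective π (suc k) eq = fold-injective π k
    (trans (sym (inverseˡ π)) (trans (cong (Data.Fin.Permutation._⟨$⟩ˡ_ π) eq) (inverseˡ π)))

  fold-periodic : ∀ {a} {A : Set a} (f : A → A) x N → fold x f N ≡ x → ∀ k → fold x f (k ℕ.* N) ≡ x
  fold-periodic f x N eq zero = refl
  fold-periodic f x N eq (suc k) =
    trans (fold-+ x f N) (trans (cong (λ z → fold z f N) (fold-periodic f x N eq k)) eq)

  opaque
    -- The pigeonhole principle gives f^i x = f^j x with i < j, and injectivity cancels f^i. Writing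
    -- the period as `suc N` keeps it positive.
    returns : ∀ {n} (π : Permutation′ n) x → ∃ λ N → fold x (π ⟨$⟩ʳ_) (suc N) ≡ x
    returns {n} π x
      with i , j , i<j , eq ← pigeonhole (ℕ.n<1+n n) (λ (l : Fin (suc n)) → fold x (π ⟨$⟩ʳ_) (toℕ l))
      = toℕ j ℕ.∸ suc (toℕ i) , sym (fold-injective π (toℕ i) (begin
          fold x f (toℕ i)                       ≡⟨ eq ⟩
          fold x f (toℕ j)                       ≡⟨ cong (fold x f) (ℕ.m+[n∸m]≡n (i<j)) ⟨
          fold x f (suc (toℕ i) ℕ.+ d)             ≡⟨ cong (fold x f) (ℕ.+-suc (toℕ i) d) ⟨
          fold x f (toℕ i ℕ.+ suc d)               ≡⟨ fold-+ x f (toℕ i) ⟩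
          fold (fold x f (suc d)) f (toℕ i)      ∎))
      where
      open ≡-Reasoning
      f : Fin n → Fin n
      f = π ⟨$⟩ʳ_
      d : ℕ
      d = toℕ j ℕ.∸ suc (toℕ i)

  opaque
    -- After k steps, k · N further ones complete k periods of length N + 1.
    SameCycle-sym : ∀ {n} (π : Permutation′ n) {x y} → SameCycle π x y → SameCycle π y x
    SameCycle-sym {n} π {x} (k , refl) with N , eq ← returns π x = k ℕ.* N , (begin
      fold (fold x f k) f (k ℕ.* N)    ≡⟨ fold-+ x f (k ℕ.* N) ⟨
      fold x f (k ℕ.* N ℕ.+ k)           ≡⟨ cong (fold x f) (trans (ℕ.+-comm (k ℕ.* N) k) (sym (ℕ.*-suc k N))) ⟩
      fold x f (k ℕ.* suc N)           ≡⟨ fold-periodic f x (suc N) eq k ⟩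
      x                              ∎)
      where
      open ≡-Reasoning
      f : Fin n → Fin n
      f = π ⟨$⟩ʳ_

  deduplicate-distinct : ∀ {a r} {A : Set a} {R : Rel A r} (R? : Decidable R) xs →
                         AllPairs (λ x y → ¬ R x y) (deduplicate R? xs)
  deduplicate-distinct R? [] = []
  deduplicate-distinct R? (x ∷ xs) =
    All.all-filter (¬? ∘ R? x) (deduplicate R? xs) ∷ AllPairs.filter⁺ (¬? ∘ R? x) (deduplicate-distinct R? xs)

  AllPairs-lookup : ∀ {a r} {A : Set a} {R : Rel A r} {xs} → AllPairs R xs →
                    ∀ i j → i Data.Fin.Base.< j → R (lookup xs i) (lookup xs j)
  AllPairs-lookup (px ∷ _)  zero    (suc j) _         = All.lookup px (∈-lookup j)
  AllPairs-lookup (_ ∷ pxs) (suc i) (suc j) (s≤s i<j) = AllPairs-lookup pxs i j i<j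

  cycle-reps : ∀ {n} → Permutation′ n → List (Fin n)
  cycle-reps {n} π = deduplicate (sameCycle? π) (allFin n)

  opaque
    cycle-reps-cover : ∀ {n} (π : Permutation′ n) → Covers (π ⟨$⟩ʳ_) (cycle-reps π)
    cycle-reps-cover π y =
      Any.deduplicate⁺ (sameCycle? π) Reaches-trans (allFin-covers (π ⟨$⟩ʳ_) y)

  -- Send each representative to an entry that reaches it. Two representatives reached from the same
  -- entry would lie in one cycle, so this map is injective.
  cyc≤length-cover : ∀ {n} (π : Permutation′ n) {xs} → Covers (π ⟨$⟩ʳ_) xs → cyc π ℕ.≤ length xs
  cyc≤length-cover π {xs} covers = injective⇒≤ {f = index} index-injective
    where
    reps = cycle-reps π

    found : ∀ i → Any (λ x → SameCycle π x (lookup reps i)) xs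
    found i = covers (lookup reps i)

    index : Fin (length reps) → Fin (length xs)
    index i = Any.index (found i)

    same : ∀ i j → index i ≡ index j → SameCycle π (lookup reps i) (lookup reps j)
    same i j eq = Reaches-trans (SameCycle-sym π (Any.lookup-index (found i)))
      (subst (λ l → SameCycle π (lookup xs l) (lookup reps j)) (sym eq) (Any.lookup-index (found j)))

    distinct = deduplicate-distinct (sameCycle? π) (allFin _)

    index-injective : ∀ {i j} → index i ≡ index j → i ≡ j
    index-injective {i} {j} eq with Fin-<-cmp i j
    ... | tri≈ _ i≡j _ = i≡j
    ... | tri< i<j _ _ = contradiction (same i j eq) (AllPairs-lookup distinct i j i<j)
    ... | tri> _ _ j<i = contradiction (same j i (sym eq)) (AllPairs-lookup distinct j i j<i)

  cyc≤n : ∀ {n} (π : Permutation′ n) → cyc π ℕ.≤ n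
  cyc≤n {n} π = subst (cyc π ℕ.≤_) (length-tabulate id) (cyc≤length-cover π (allFin-covers (π ⟨$⟩ʳ_)))

  t[]≤tₚ : ∀ {n} (π : Permutation′ n) b → t[ π ] ℕ.≤ tₚ (translate b ∘ₚ π)
  t[]≤tₚ π b = All.lookup (min≤xs (tₚ π) (map tₚ (class π)))
    (∈-map⁺ tₚ (∈-map⁺ (λ b → translate b ∘ₚ π) (∈-allFin b)))

  t-attained : ∀ n → ∃ λ π → ∀ b → cyc (translate {n} b ∘ₚ π) ℕ.+ t n ℕ.≤ n
  -- The maximum is either the default 0 or an entry of the list. If it is 0, any permutation will
  -- do, because cyc ≤ n.
  t-attained n = [ trivial , attained ]′ (argmax-sel id 0 (map t[_] (permutations n)))
    where
    trivial : t n ≡ 0 → ∃ λ π → ∀ b → cyc (translate {n} b ∘ₚ π) ℕ.+ t n ℕ.≤ n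
    trivial t≡0 = idₚ , λ b →
      ℕ.≤-trans (ℕ.≤-reflexive (trans (cong (cyc (translate b ∘ₚ idₚ) ℕ.+_) t≡0) (ℕ.+-identityʳ _))) (cyc≤n (translate b ∘ₚ idₚ))

    attained : t n ∈ map t[_] (permutations n) → ∃ λ π → ∀ b → cyc (translate {n} b ∘ₚ π) ℕ.+ t n ℕ.≤ n
    attained t∈ = let π , _ , t≡ = ∈-map⁻ t[_] t∈ in π , λ b →
      let ρ = translate b ∘ₚ π in begin
      cyc ρ ℕ.+ t n          ≡⟨ cong (cyc ρ ℕ.+_) t≡ ⟩
      cyc ρ ℕ.+ t[ π ]       ≤⟨ ℕ.+-monoʳ-≤ (cyc ρ) (t[]≤tₚ π b) ⟩
      cyc ρ ℕ.+ (n ℕ.∸ cyc ρ)  ≡⟨ ℕ.m+[n∸m]≡n (cyc≤n ρ) ⟩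
      n                    ∎
      where open ℕ.≤-Reasoning

  ⊕-identityʳ : ∀ {n} (x : Fin (suc n)) → x ⊕ zero ≡ x
  ⊕-identityʳ {n} x = toℕ-injective (begin
    toℕ (x ⊕ zero)          ≡⟨ toℕ-⊕ x zero ⟩
    (toℕ x ℕ.+ 0) ℕ.% suc n     ≡⟨ cong (ℕ._% suc n) (ℕ.+-identityʳ (toℕ x)) ⟩
    toℕ x ℕ.% suc n           ≡⟨ ℕ.m<n⇒m%n≡m (toℕ<n x) ⟩
    toℕ x                   ∎)
    where open ≡-Reasoning

  ∈permutations⇒t[]≤t : ∀ {n} {π : Permutation′ n} → π ∈ permutations n → t[ π ] ℕ.≤ t n
  ∈permutations⇒t[]≤t {n} {π} π∈ = All.lookup (xs≤max 0 (map t[_] (permutations n))) (∈-map⁺ t[_] π∈)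

  ≤t[] : ∀ {n} (π : Permutation′ n) {k} → k ℕ.≤ tₚ π → (∀ b → k ℕ.≤ tₚ (translate b ∘ₚ π)) → k ℕ.≤ t[ π ]
  ≤t[] π {k} k≤tₚ k≤ = v≤min⁺ {xs = map tₚ (class π)} k≤tₚ (All.tabulate λ x∈ →
    let _ , σ∈ , x≡ = ∈-map⁻ tₚ x∈
        b , _ , σ≡ = ∈-map⁻ (λ b → translate b ∘ₚ π) σ∈
    in subst (k ℕ.≤_) (sym (trans x≡ (cong tₚ σ≡))) (k≤ b))

  ≤tₚ : ∀ {n} (π : Permutation′ n) {k xs} → Covers (π ⟨$⟩ʳ_) xs → length xs ℕ.+ k ℕ.≤ n → k ℕ.≤ tₚ π
  ≤tₚ {n} π {k} {xs} covers len = begin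
    k                      ≡⟨ ℕ.m+n∸m≡n (cyc π) k ⟨
    cyc π ℕ.+ k ℕ.∸ cyc π      ≤⟨ ℕ.∸-monoˡ-≤ (cyc π) (ℕ.+-monoˡ-≤ k (cyc≤length-cover π covers)) ⟩
    length xs ℕ.+ k ℕ.∸ cyc π  ≤⟨ ℕ.∸-monoˡ-≤ (cyc π) len ⟩
    n ℕ.∸ cyc π              ∎
    where open ℕ.≤-Reasoning

  t-lower-bound : ∀ {n} .{{_ : NonZero n}} (π : Permutation′ n) {k} →
                  (∀ b → ∃ λ xs → Covers (λ x → π ⟨$⟩ʳ (x ⊕ b)) xs × length xs ℕ.+ k ℕ.≤ n) → k ℕ.≤ t n
  t-lower-bound {n@(suc _)} π {k} covers =
    let ρ , ρ∈ , ρ≈π = permutations-complete π in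
    ℕ.≤-trans (≤t[] ρ
      -- The shift 0 takes care of the default value in the minimum.
      (let xs , cov , len = covers zero in
       ≤tₚ ρ (Covers-cong (λ x → trans (cong (π ⟨$⟩ʳ_) (⊕-identityʳ x)) (sym (ρ≈π x))) cov) len)
      (λ b → let xs , cov , len = covers b in
       ≤tₚ (translate b ∘ₚ ρ) (Covers-cong (λ x → sym (ρ≈π (x ⊕ b))) cov) len))
      (∈permutations⇒t[]≤t ρ∈)

  -- Congruences

  infix 4 _≈_mod_ _≈0?mod_ _≈?_mod_

  -- The quotient is kept as data: in `combine-⊕` it is the negative of the carry, and in the lifts
  -- to p² it is the coefficient of p.
  record _≈_mod_ (a b : ℤ) (n : ℕ) : Set where
    constructor congruent
    field
      quotient : ℤ
      equality : a ≡ b + quotient * + n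

  ≈-refl : ∀ {n a} → a ≈ a mod n
  ≈-refl {n} {a} = congruent 0ℤ (sym (+-identityʳ a))

  ≈-reflexive : ∀ {n a b} → a ≡ b → a ≈ b mod n
  ≈-reflexive refl = ≈-refl

  ≈-sym : ∀ {n a b} → a ≈ b mod n → b ≈ a mod n
  ≈-sym {n} {b = b} (congruent q refl) = congruent (- q) (lemma b q (+ n))
    where
    lemma : ∀ b q n → b ≡ (b + q * n) + - q * n
    lemma = solve-∀

  ≈-trans : ∀ {n a b c} → a ≈ b mod n → b ≈ c mod n → a ≈ c mod n
  ≈-trans {n} {c = c} (congruent q refl) (congruent r refl) = congruent (r + q) (lemma c q r (+ n))
    where
    lemma : ∀ c q r n → (c + r * n) + q * n ≡ c + (r + q) * n
    lemma = solve-∀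

  mod-setoid : ℕ → Setoid 0ℓ 0ℓ
  mod-setoid n = record
    { Carrier = ℤ
    ; _≈_ = λ a b → a ≈ b mod n
    ; isEquivalence = record { refl = ≈-refl ; sym = ≈-sym ; trans = ≈-trans }
    }

  module Mod-Reasoning (n : ℕ) = SetoidReasoning (mod-setoid n)

  +-≈ : ∀ {n a b c d} → a ≈ b mod n → c ≈ d mod n → a + c ≈ b + d mod n
  +-≈ {n} {b = b} {d = d} (congruent q refl) (congruent r refl) = congruent (q + r) (lemma b d q r (+ n))
    where
    lemma : ∀ b d q r n → (b + q * n) + (d + r * n) ≡ b + d + (q + r) * n
    lemma = solve-∀

  *-≈ : ∀ {n a b c d} → a ≈ b mod n → c ≈ d mod n → a * c ≈ b * d mod n
  *-≈ {n} {b = b} {d = d} (congruent q refl) (congruent r refl) =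
    congruent (b * r + q * d + q * r * + n) (lemma b d q r (+ n))
    where
    lemma : ∀ b d q r n → (b + q * n) * (d + r * n) ≡ b * d + (b * r + q * d + q * r * n) * n
    lemma = solve-∀

  +-≈ʳ : ∀ {n} a {b c} → b ≈ c mod n → a + b ≈ a + c mod n
  +-≈ʳ a = +-≈ (≈-refl {a = a})

  +-≈ˡ : ∀ {n} a {b c} → b ≈ c mod n → b + a ≈ c + a mod n
  +-≈ˡ a b≈c = +-≈ b≈c (≈-refl {a = a})

  *-≈ʳ : ∀ {n} a {b c} → b ≈ c mod n → a * b ≈ a * c mod n
  *-≈ʳ a = *-≈ (≈-refl {a = a})

  *-≈ˡ : ∀ {n} a {b c} → b ≈ c mod n → b * a ≈ c * a mod n
  *-≈ˡ a b≈c = *-≈ b≈c (≈-refl {a = a})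

  ^-≈ : ∀ {n a b} k → a ≈ b mod n → a ^ k ≈ b ^ k mod n
  ^-≈ ℕ.zero    a≈b = ≈-refl
  ^-≈ (ℕ.suc k) a≈b = *-≈ a≈b (^-≈ k a≈b)

  ≈⇒-≈0 : ∀ {n a b} → a ≈ b mod n → a - b ≈ 0ℤ mod n
  ≈⇒-≈0 {n} {b = b} (congruent q refl) = congruent q (lemma b q (+ n))
    where
    lemma : ∀ b q n → (b + q * n) - b ≡ 0ℤ + q * n
    lemma = solve-∀

  -≈0⇒≈ : ∀ {n} a b → a - b ≈ 0ℤ mod n → a ≈ b mod n
  -≈0⇒≈ {n} a b (congruent q eq) = congruent q (trans (lemma a b) (cong (λ z → b + z) (trans eq (+-identityˡ _))))
    where
    lemma : ∀ a b → a ≡ b + (a - b)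
    lemma = solve-∀

  +-cancelʳ-≈ : ∀ {n} c {a b} → a + c ≈ b + c mod n → a ≈ b mod n
  +-cancelʳ-≈ {n} c {a} {b} eq = -≈0⇒≈ a b (≈-trans (≈-reflexive (lemma a b c)) (≈⇒-≈0 eq))
    where
    lemma : ∀ a b c → a - b ≡ (a + c) - (b + c)
    lemma = solve-∀

  ≈0⇒∣ : ∀ {n a} → a ≈ 0ℤ mod n → n ℕ.∣ ∣ a ∣
  ≈0⇒∣ {n} (congruent q eq) = Signed.∣⇒∣ᵤ (Signed.divides q (trans eq (+-identityˡ (q * + n))))

  ∣⇒≈0 : ∀ {n a} → n ℕ.∣ ∣ a ∣ → a ≈ 0ℤ mod n
  ∣⇒≈0 {n} n∣a with Signed.divides q eq ← Signed.∣ᵤ⇒∣ {+ n} n∣a = congruent q (trans eq (sym (+-identityˡ (q * + n))))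

  _≈0?mod_ : ∀ a n → Dec (a ≈ 0ℤ mod n)
  a ≈0?mod n = map′ ∣⇒≈0 ≈0⇒∣ (n ℕ.∣? ∣ a ∣)

  _≈?_mod_ : ∀ a b n → Dec (a ≈ b mod n)
  a ≈? b mod n = map′ (-≈0⇒≈ a b) ≈⇒-≈0 ((a - b) ≈0?mod n)

  n≈0 : ∀ n → + n ≈ 0ℤ mod n
  n≈0 n = ∣⇒≈0 ℕ.∣-refl

  ≈-weaken : ∀ {m n a b} → m ℕ.∣ n → a ≈ b mod n → a ≈ b mod m
  ≈-weaken {m} {n} {a} {b} m∣n a≈b = -≈0⇒≈ a b (∣⇒≈0 (ℕ.∣-trans m∣n (≈0⇒∣ (≈⇒-≈0 a≈b))))

  ∣-<⇒≡0 : ∀ {m k} → m ℕ.∣ k → k ℕ.< m → k ≡ 0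
  ∣-<⇒≡0 {m} {ℕ.zero}  _   _   = refl
  ∣-<⇒≡0 {m} {ℕ.suc k} m∣k k<m = contradiction (ℕ.∣⇒≤ m∣k) (ℕ.<⇒≱ k<m)

  small-≈⇒≡ : ∀ {n i j} → i ℕ.< n → j ℕ.< n → + i ≈ + j mod n → i ≡ j
  small-≈⇒≡ {n} {i} {j} i<n j<n i≈j =
    +-injective (i-j≡0⇒i≡j (+ i) (+ j) (∣i∣≡0⇒i≡0 (∣-<⇒≡0 (≈0⇒∣ (≈⇒-≈0 i≈j)) d<n)))
    where
    d<n : ∣ + i - + j ∣ ℕ.< n
    d<n = ℕ.≤-<-trans (subst (λ z → ∣ z ∣ ℕ.≤ i ℕ.⊔ j) (sym (m-n≡m⊖n i j)) (∣m⊝n∣≤m⊔n i j)) (ℕ.⊔-lub i<n j<n)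

  ⟦_⟧ : ∀ {n} .{{_ : NonZero n}} → ℤ → Fin n
  ⟦_⟧ {n} z = fromℕ< (n%ℕd<d z n)

  rep : ∀ {n} → Fin n → ℤ
  rep x = + toℕ x

  rep-⟦⟧ : ∀ {n} .{{_ : NonZero n}} z → rep {n} ⟦ z ⟧ ≈ z mod n
  rep-⟦⟧ {n} z = ≈-sym (congruent (z /ℕ n) (trans (a≡a%ℕn+[a/ℕn]*n z n)
    (cong (λ r → + r + (z /ℕ n) * + n) (sym (toℕ-fromℕ< (n%ℕd<d z n))))))

  rep-injective : ∀ {n} {x y : Fin n} → rep x ≈ rep y mod n → x ≡ y
  rep-injective {x = x} {y} eq = toℕ-injective (small-≈⇒≡ (toℕ<n x) (toℕ<n y) eq)

  ⟦⟧-injective : ∀ {n} .{{_ : NonZero n}} {a b} → ⟦ a ⟧ ≡ ⟦_⟧ {n} b → a ≈ b mod n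
  ⟦⟧-injective {n} {a} {b} eq = ≈-trans (≈-sym (rep-⟦⟧ a)) (≈-trans (≈-reflexive (cong rep eq)) (rep-⟦⟧ b))

  rep-⊕ : ∀ {n} (x y : Fin n) → rep (x ⊕ y) ≈ rep x + rep y mod n
  rep-⊕ {n@(ℕ.suc _)} x y = rep-⟦⟧ (rep x + rep y)

  Bézout⇒unit : ∀ {m n} → Bézout.Identity 1 m n → ∃ λ m′ → m′ * + m ≈ 1ℤ mod n
  Bézout⇒unit {m} {n} (Bézout.+- x y eq) = + x , congruent (+ y) (begin
    + x * + m            ≡⟨ pos-* x m ⟨
    + (x ℕ.* m)          ≡⟨ cong +_ eq ⟨
    + (1 ℕ.+ y ℕ.* n)    ≡⟨ cong (λ z → 1ℤ + z) (pos-* y n) ⟩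
    1ℤ + + y * + n       ∎)
    where open ≡-Reasoning
  Bézout⇒unit {m} {n} (Bézout.-+ x y eq) = - + x , congruent (- + y) (begin
    - + x * + m               ≡⟨ lemma (+ x) (+ m) ⟩
    1ℤ - (1ℤ + + x * + m)     ≡⟨ cong (λ z → 1ℤ - (1ℤ + z)) (pos-* x m) ⟨
    1ℤ - + (1 ℕ.+ x ℕ.* m)    ≡⟨ cong (λ z → 1ℤ - + z) eq ⟩
    1ℤ - + (y ℕ.* n)          ≡⟨ cong (λ z → 1ℤ - z) (pos-* y n) ⟩
    1ℤ - + y * + n            ≡⟨ cong (λ z → 1ℤ + z) (neg-distribˡ-* (+ y) (+ n)) ⟩
    1ℤ + - + y * + n          ∎)
    where
    open ≡-Reasoning
    lemma : ∀ x a → - x * a ≡ 1ℤ - (1ℤ + x * a)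
    lemma = solve-∀

  opaque
    coprime⇒unit : ∀ {n} a → Coprime ∣ a ∣ n → ∃ λ a′ → a′ * a ≈ 1ℤ mod n
    coprime⇒unit (+ m)    coprime = Bézout⇒unit (coprime-Bézout coprime)
    coprime⇒unit -[1+ m ] coprime with a′ , eq ← Bézout⇒unit (coprime-Bézout coprime) =
      - a′ , ≈-trans (≈-reflexive (lemma a′ +[1+ m ])) eq
      where
      lemma : ∀ a′ a → - a′ * - a ≡ a′ * a
      lemma = solve-∀

  prime-coprime : ∀ {p m} → Prime p → ¬ p ℕ.∣ m → Coprime m p
  prime-coprime p-prime p∤m (d∣m , d∣p) with prime⇒irreducible p-prime d∣p
  ... | inj₁ d≡1  = d≡1
  ... | inj₂ refl = contradiction d∣m p∤m

  opaque
    prime⇒unit : ∀ {p} → Prime p → ∀ {a} → ¬ a ≈ 0ℤ mod p → ∃ λ a′ → a′ * a ≈ 1ℤ mod p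
    prime⇒unit p-prime {a} a≉0 = coprime⇒unit a (prime-coprime p-prime (λ p∣a → a≉0 (∣⇒≈0 p∣a)))

  *≈0⇒ : ∀ {p} → Prime p → ∀ a b → a * b ≈ 0ℤ mod p → a ≈ 0ℤ mod p ⊎ b ≈ 0ℤ mod p
  *≈0⇒ {p} p-prime a b ab≈0 with euclidsLemma ∣ a ∣ ∣ b ∣ p-prime (subst (p ℕ.∣_) (abs-* a b) (≈0⇒∣ ab≈0))
  ... | inj₁ p∣a = inj₁ (∣⇒≈0 p∣a)
  ... | inj₂ p∣b = inj₂ (∣⇒≈0 p∣b)

  unit-cancelˡ : ∀ {n} a a′ → a′ * a ≈ 1ℤ mod n → ∀ {x y} → a * x ≈ a * y mod n → x ≈ y mod n
  unit-cancelˡ {n} a a′ unit {x} {y} eq = begin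
    x                ≡⟨ *-identityˡ x ⟨
    1ℤ * x           ≈⟨ *-≈ˡ x unit ⟨
    a′ * a * x       ≡⟨ *-assoc a′ a x ⟩
    a′ * (a * x)     ≈⟨ *-≈ʳ a′ eq ⟩
    a′ * (a * y)     ≡⟨ *-assoc a′ a y ⟨
    a′ * a * y       ≈⟨ *-≈ˡ y unit ⟩
    1ℤ * y           ≡⟨ *-identityˡ y ⟩
    y                ∎
    where open Mod-Reasoning n

  -- Polynomials and their roots modulo a prime

  eval : ∀ {d} → Vec ℤ d → ℤ → ℤ
  eval []       x = 0ℤ
  eval (c ∷ cs) x = c + x * eval cs x

  leading : ∀ {d} → Vec ℤ (ℕ.suc d) → ℤ
  leading (c ∷ [])          = c
  leading (_ ∷ cs@(_ ∷ _)) = leading cs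

  -- Synthetic division by X − r.
  quotient-at : ∀ {d} → ℤ → Vec ℤ (ℕ.suc d) → Vec ℤ d
  quotient-at r (_ ∷ [])          = []
  quotient-at r (_ ∷ cs@(_ ∷ _)) = eval cs r ∷ quotient-at r cs

  eval-quotient-at : ∀ {d} r (cs : Vec ℤ (ℕ.suc d)) x →
                     eval cs x - eval cs r ≡ (x - r) * eval (quotient-at r cs) x
  eval-quotient-at r (c ∷ []) x = lemma c x r
    where
    lemma : ∀ c x r → (c + x * 0ℤ) - (c + r * 0ℤ) ≡ (x - r) * 0ℤ
    lemma = solve-∀
  eval-quotient-at r (c ∷ cs@(_ ∷ _)) x = begin
    (c + x * eval cs x) - (c + r * eval cs r)
      ≡⟨ lemma₁ c x r (eval cs x) (eval cs r) ⟩
    (x - r) * eval cs r + x * (eval cs x - eval cs r)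
      ≡⟨ cong (λ z → (x - r) * eval cs r + x * z) (eval-quotient-at r cs x) ⟩
    (x - r) * eval cs r + x * ((x - r) * eval (quotient-at r cs) x)
      ≡⟨ lemma₂ x r (eval cs r) (eval (quotient-at r cs) x) ⟩
    (x - r) * (eval cs r + x * eval (quotient-at r cs) x) ∎
    where
    open ≡-Reasoning
    lemma₁ : ∀ c x r a b → (c + x * a) - (c + r * b) ≡ (x - r) * b + x * (a - b)
    lemma₁ = solve-∀
    lemma₂ : ∀ x r b q → (x - r) * b + x * ((x - r) * q) ≡ (x - r) * (b + x * q)
    lemma₂ = solve-∀

  leading-quotient-at : ∀ {d} r (cs : Vec ℤ (ℕ.suc (ℕ.suc d))) → leading (quotient-at r cs) ≡ leading cs
  leading-quotient-at r (c ∷ c′ ∷ []) = trans (cong (λ z → c′ + z) (*-zeroʳ r)) (+-identityʳ c′)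
  leading-quotient-at r (c ∷ cs@(_ ∷ _ ∷ _)) = leading-quotient-at r cs

  -- Lagrange's bound. Dividing by X - r for a root r lowers the degree and keeps the leading
  -- coefficient; as p is prime, the remaining roots, being distinct from r, are roots of the
  -- quotient.
  too-many-roots : ∀ {p} → Prime p → ∀ d (cs : Vec ℤ (ℕ.suc d)) → ¬ leading cs ≈ 0ℤ mod p →
                   (root : Fin (ℕ.suc d) → ℤ) → (∀ {i j} → root i ≈ root j mod p → i ≡ j) →
                   ¬ (∀ i → eval cs (root i) ≈ 0ℤ mod p)
  too-many-roots p-prime ℕ.zero (c ∷ []) c≉0 root _ roots =
    c≉0 (≈-trans (≈-reflexive (sym (trans (cong (λ z → c + z) (*-zeroʳ (root zero))) (+-identityʳ c)))) (roots zero))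
  too-many-roots {p} p-prime (ℕ.suc d) cs lead≉0 root distinct roots =
    too-many-roots p-prime d (quotient-at r cs)
      (λ eq → lead≉0 (≈-trans (≈-reflexive (sym (leading-quotient-at r cs))) eq))
      (root ∘ suc) (λ eq → suc-injective (distinct eq)) quotient-roots
    where
    r = root zero
    quotient-roots : ∀ i → eval (quotient-at r cs) (root (suc i)) ≈ 0ℤ mod p
    quotient-roots i with *≈0⇒ p-prime (root (suc i) - r) (eval (quotient-at r cs) (root (suc i)))
        (≈-trans (≈-reflexive (sym (eval-quotient-at r cs (root (suc i)))))
          (≈⇒-≈0 (≈-trans (roots (suc i)) (≈-sym (roots zero)))))
    ... | inj₂ q≈0 = q≈0
    ... | inj₁ x≈r = contradiction (sym (distinct (-≈0⇒≈ (root (suc i)) r x≈r))) 0≢1+n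

  monomial : ∀ d → Vec ℤ (ℕ.suc d)
  monomial ℕ.zero    = 1ℤ ∷ []
  monomial (ℕ.suc d) = 0ℤ ∷ monomial d

  eval-monomial : ∀ d x → eval (monomial d) x ≡ x ^ d
  eval-monomial ℕ.zero    x = cong (λ z → 1ℤ + z) (*-zeroʳ x)
  eval-monomial (ℕ.suc d) x = trans (+-identityˡ _) (cong (x *_) (eval-monomial d x))

  leading-monomial : ∀ d → leading (monomial d) ≡ 1ℤ
  leading-monomial ℕ.zero            = refl
  leading-monomial (ℕ.suc ℕ.zero)    = refl
  leading-monomial (ℕ.suc (ℕ.suc d)) = leading-monomial (ℕ.suc d)

  1≉0 : ∀ {n} → 1 ℕ.< n → ¬ 1ℤ ≈ 0ℤ mod n
  1≉0 1<n eq = contradiction (small-≈⇒≡ 1<n (ℕ.<⇒≤ 1<n) eq) λ ()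

  prime>1 : ∀ {p} → Prime p → 1 ℕ.< p
  prime>1 {p} p-prime = ℕ.nonTrivial⇒n>1 p {{prime⇒nonTrivial p-prime}}

  too-many-roots-of-unity : ∀ {p} → Prime p → ∀ d .{{_ : NonZero d}} (root : Fin (ℕ.suc d) → ℤ) →
                            (∀ {i j} → root i ≈ root j mod p → i ≡ j) → ¬ (∀ i → root i ^ d ≈ 1ℤ mod p)
  too-many-roots-of-unity p-prime (ℕ.suc d) root distinct roots =
    too-many-roots p-prime (ℕ.suc d) (-1ℤ ∷ monomial d) lead≉0 root distinct
      (λ i → ≈-trans (≈-reflexive (trans (cong (λ z → -1ℤ + root i * z) (eval-monomial d (root i))) (+-comm -1ℤ (root i ^ ℕ.suc d)))) (≈⇒-≈0 (roots i)))
    where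
    leading-eq : ∀ d → leading (-1ℤ ∷ monomial d) ≡ 1ℤ
    leading-eq ℕ.zero    = refl
    leading-eq (ℕ.suc d) = leading-monomial (ℕ.suc d)
    lead≉0 : ¬ leading (-1ℤ ∷ monomial d) ≈ 0ℤ mod _
    lead≉0 eq = 1≉0 (prime>1 p-prime) (≈-trans (≈-reflexive (sym (leading-eq d))) eq)

  -- Orders and primitive roots

  ^-distribʳ-* : ∀ a b k → (a * b) ^ k ≡ a ^ k * b ^ k
  ^-distribʳ-* a b ℕ.zero    = refl
  ^-distribʳ-* a b (ℕ.suc k) = trans (cong ((a * b) *_) (^-distribʳ-* a b k)) (lemma a b (a ^ k) (b ^ k))
    where
    lemma : ∀ a b c d → a * b * (c * d) ≡ a * c * (b * d)
    lemma = solve-∀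

  -- Minimality is expressed by divisibility. The value d = 0 is possible, for an element none of
  -- whose positive powers is 1.
  record IsOrder (n : ℕ) (x : ℤ) (d : ℕ) : Set where
    constructor is-order
    field
      power≈1 : x ^ d ≈ 1ℤ mod n
      least   : ∀ k → x ^ k ≈ 1ℤ mod n → d ℕ.∣ k

  open IsOrder public

  ^-≈1-* : ∀ {n x} d → x ^ d ≈ 1ℤ mod n → ∀ k → x ^ (d ℕ.* k) ≈ 1ℤ mod n
  ^-≈1-* {n} {x} d eq k = begin
    x ^ (d ℕ.* k)  ≡⟨ ^-*-assoc x d k ⟨
    (x ^ d) ^ k    ≈⟨ ^-≈ k eq ⟩
    1ℤ ^ k         ≡⟨ ^-zeroˡ k ⟩
    1ℤ             ∎
    where open Mod-Reasoning n

  ^-≈1-∣ : ∀ {n x d} → x ^ d ≈ 1ℤ mod n → ∀ {k} → d ℕ.∣ k → x ^ k ≈ 1ℤ mod n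
  ^-≈1-∣ {n} {x} {d} eq {k} (ℕ.divides q refl) =
    ≈-trans (≈-reflexive (cong (x ^_) (ℕ.*-comm q d))) (^-≈1-* d eq q)

  ^-mod-order : ∀ {n x d} → x ^ d ≈ 1ℤ mod n → ∀ r q → x ^ (r ℕ.+ q ℕ.* d) ≈ x ^ r mod n
  ^-mod-order {n} {x} {d} eq r q = begin
    x ^ (r ℕ.+ q ℕ.* d)    ≡⟨ ^-distribˡ-+-* x r (q ℕ.* d) ⟩
    x ^ r * x ^ (q ℕ.* d)  ≈⟨ *-≈ʳ (x ^ r) (^-≈1-∣ eq (ℕ.divides q refl)) ⟩
    x ^ r * 1ℤ             ≡⟨ *-identityʳ (x ^ r) ⟩
    x ^ r                  ∎
    where open Mod-Reasoning n

  ^-% : ∀ {n x d} .{{_ : NonZero d}} → x ^ d ≈ 1ℤ mod n → ∀ k → x ^ (k ℕ.% d) ≈ x ^ k mod n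
  ^-% {n} {x} {d} eq k = ≈-sym (≈-trans (≈-reflexive (cong (x ^_) (ℕ.m≡m%n+[m/n]*n k d))) (^-mod-order eq (k ℕ.% d) (k ℕ./ d)))

  unit-^ : ∀ {n} x x′ → x′ * x ≈ 1ℤ mod n → ∀ k → x′ ^ k * x ^ k ≈ 1ℤ mod n
  unit-^ {n} x x′ unit k =
    ≈-trans (≈-reflexive (sym (^-distribʳ-* x′ x k))) (≈-trans (^-≈ k unit) (≈-reflexive (^-zeroˡ k)))

  unit-^-cancel : ∀ {n} x x′ → x′ * x ≈ 1ℤ mod n → ∀ i k → x ^ (i ℕ.+ k) ≈ x ^ i mod n → x ^ k ≈ 1ℤ mod n
  unit-^-cancel {n} x x′ unit i k eq = unit-cancelˡ (x ^ i) (x′ ^ i) (unit-^ x x′ unit i) (begin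
    x ^ i * x ^ k    ≡⟨ ^-distribˡ-+-* x i k ⟨
    x ^ (i ℕ.+ k)    ≈⟨ eq ⟩
    x ^ i            ≡⟨ *-identityʳ (x ^ i) ⟨
    x ^ i * 1ℤ       ∎)
    where open Mod-Reasoning n

  least-exponent : ∀ {n x} K → x ^ ℕ.suc K ≈ 1ℤ mod n → ∃ λ d → IsOrder n x (ℕ.suc d)
  least-exponent {n} {x} = <-rec _ step
    where
    step : ∀ K → (∀ {L} → L ℕ.< K → x ^ ℕ.suc L ≈ 1ℤ mod n → ∃ λ d → IsOrder n x (ℕ.suc d)) →
           x ^ ℕ.suc K ≈ 1ℤ mod n → ∃ λ d → IsOrder n x (ℕ.suc d)
    step K rec eq with any? {n = K} (λ i → (x ^ ℕ.suc (toℕ i)) ≈? 1ℤ mod n)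
    ... | yes (i , eq′) = rec (toℕ<n i) eq′
    -- The remainder of k modulo K + 1 is again an exponent with power 1, and no positive one lies
    -- below K + 1.
    ... | no  none      = K , is-order eq (λ k xᵏ≈1 → ℕ.m%n≡0⇒n∣m k (ℕ.suc K) (remainder k xᵏ≈1))
      where
      remainder : ∀ k → x ^ k ≈ 1ℤ mod n → k ℕ.% ℕ.suc K ≡ 0
      remainder k xᵏ≈1 with k ℕ.% ℕ.suc K in r≡ | ℕ.m%n<n k (ℕ.suc K)
      ... | ℕ.zero  | _           = refl
      ... | ℕ.suc r | ℕ.s≤s r<K = contradiction (fromℕ< r<K , (begin
          x ^ ℕ.suc (toℕ (fromℕ< r<K))  ≡⟨ cong (λ z → x ^ ℕ.suc z) (toℕ-fromℕ< r<K) ⟩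
          x ^ ℕ.suc r                   ≡⟨ cong (x ^_) r≡ ⟨
          x ^ (k ℕ.% ℕ.suc K)           ≈⟨ ^-% eq k ⟩
          x ^ k                         ≈⟨ xᵏ≈1 ⟩
          1ℤ                            ∎)) none
        where open Mod-Reasoning n

  opaque
    order-exists : ∀ {n} .{{_ : NonZero n}} x x′ → x′ * x ≈ 1ℤ mod n → ∃ λ d → IsOrder n x (ℕ.suc d)
    order-exists {n} x x′ unit
      with i , j , i<j , eq ← pigeonhole (ℕ.n<1+n n) (λ (l : Fin (ℕ.suc n)) → ⟦_⟧ {n} (x ^ toℕ l))
      = least-exponent (toℕ j ℕ.∸ ℕ.suc (toℕ i)) (unit-^-cancel x x′ unit (toℕ i) _ (begin
          x ^ (toℕ i ℕ.+ ℕ.suc (toℕ j ℕ.∸ ℕ.suc (toℕ i)))  ≡⟨ cong (x ^_) (trans (ℕ.+-suc (toℕ i) _) (ℕ.m+[n∸m]≡n i<j)) ⟩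
          x ^ toℕ j                                          ≈⟨ ⟦⟧-injective eq ⟨
          x ^ toℕ i                                          ∎))
      where open Mod-Reasoning n

  order-^ : ∀ {n x} m k .{{_ : NonZero k}} → IsOrder n x (m ℕ.* k) → IsOrder n (x ^ k) m
  order-^ {n} {x} m k (is-order x^mk≈1 x-least) = is-order
    (≈-trans (≈-reflexive (trans (^-*-assoc x k m) (cong (x ^_) (ℕ.*-comm k m)))) x^mk≈1)
    (λ j eq → ℕ.*-cancelʳ-∣ k (subst (m ℕ.* k ℕ.∣_) (ℕ.*-comm k j)
      (x-least (k ℕ.* j) (≈-trans (≈-reflexive (sym (^-*-assoc x k j))) eq))))

  coprime-∣⇒*∣ : ∀ {a b k} → Coprime a b → a ℕ.∣ k → b ℕ.∣ k → a ℕ.* b ℕ.∣ k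
  coprime-∣⇒*∣ {a} {b} cop (ℕ.divides q refl) b∣k
    with ℕ.divides r refl ← coprime-divisor (coprime-sym cop) (subst (b ℕ.∣_) (ℕ.*-comm q a) b∣k) =
    ℕ.divides r (trans (ℕ.*-assoc r b a) (cong (r ℕ.*_) (ℕ.*-comm b a)))

  -- Raising (x y)^k = 1 to the power b removes y and gives a ∣ b k, hence a ∣ k; symmetrically b ∣
  -- k.
  order-* : ∀ {n x y a b} → Coprime a b → IsOrder n x a → IsOrder n y b → IsOrder n (x * y) (a ℕ.* b)
  order-* {n} {x} {y} {a} {b} cop (is-order xᵃ≈1 x-least) (is-order yᵇ≈1 y-least) = is-order
    (begin
      (x * y) ^ (a ℕ.* b)          ≡⟨ ^-distribʳ-* x y (a ℕ.* b) ⟩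
      x ^ (a ℕ.* b) * y ^ (a ℕ.* b) ≈⟨ *-≈ (^-≈1-* a xᵃ≈1 b) (^-≈1-∣ yᵇ≈1 (ℕ.divides a refl)) ⟩
      1ℤ                           ∎)
    (λ k eq → coprime-∣⇒*∣ cop
      (coprime-divisor cop (x-least (b ℕ.* k) (begin
        x ^ (b ℕ.* k)                  ≡⟨ *-identityʳ (x ^ (b ℕ.* k)) ⟨
        x ^ (b ℕ.* k) * 1ℤ             ≈⟨ *-≈ʳ (x ^ (b ℕ.* k)) (^-≈1-* b yᵇ≈1 k) ⟨
        x ^ (b ℕ.* k) * y ^ (b ℕ.* k)  ≡⟨ ^-distribʳ-* x y (b ℕ.* k) ⟨
        (x * y) ^ (b ℕ.* k)            ≈⟨ ^-≈1-∣ eq (ℕ.divides b refl) ⟩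
        1ℤ                             ∎)))
      (coprime-divisor (coprime-sym cop) (y-least (a ℕ.* k) (begin
        y ^ (a ℕ.* k)                  ≡⟨ *-identityˡ (y ^ (a ℕ.* k)) ⟨
        1ℤ * y ^ (a ℕ.* k)             ≈⟨ *-≈ˡ (y ^ (a ℕ.* k)) (^-≈1-* a xᵃ≈1 k) ⟨
        x ^ (a ℕ.* k) * y ^ (a ℕ.* k)  ≡⟨ ^-distribʳ-* x y (a ℕ.* k) ⟨
        (x * y) ^ (a ℕ.* k)            ≈⟨ ^-≈1-∣ eq (ℕ.divides a refl) ⟩
        1ℤ                             ∎))))
    where open Mod-Reasoning n

  opaque
    prime-divisor : ∀ n .{{_ : NonZero n}} → n ≢ 1 → ∃ λ r → Prime r × r ℕ.∣ n
    prime-divisor n n≢1 with factorise n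
    ... | record { factors = [] ; isFactorisation = eq } = contradiction eq n≢1
    ... | record { factors = r ∷ rs ; isFactorisation = eq ; factorsPrime = r-prime ∷ _ } =
      r , r-prime , subst (r ℕ.∣_) (sym eq) (ℕ.m∣m*n _)

    prime-part : ∀ {r} → Prime r → ∀ n → .{{_ : NonZero n}} → ∃ λ a → ∃ λ m → n ≡ r ℕ.^ a ℕ.* m × ¬ r ℕ.∣ m
    prime-part {r} r-prime = <-rec _ step
      where
      step : ∀ n → (∀ {m} → m ℕ.< n → .{{_ : NonZero m}} → ∃ λ a → ∃ λ m′ → m ≡ r ℕ.^ a ℕ.* m′ × ¬ r ℕ.∣ m′) →
             .{{_ : NonZero n}} → ∃ λ a → ∃ λ m → n ≡ r ℕ.^ a ℕ.* m × ¬ r ℕ.∣ m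
      step n rec with r ℕ.∣? n
      ... | no r∤n = 0 , n , sym (ℕ.+-identityʳ n) , r∤n
      ... | yes (ℕ.divides ℕ.zero refl) = contradiction refl (ℕ.≢-nonZero⁻¹ 0)
      ... | yes (ℕ.divides m@(ℕ.suc _) refl)
        with a , m′ , eq , r∤m′ ← rec (ℕ.m<m*n m r (prime>1 r-prime)) =
        ℕ.suc a , m′ , trans (cong (ℕ._* r) eq) (trans (ℕ.*-comm (r ℕ.^ a ℕ.* m′) r) (sym (ℕ.*-assoc r (r ℕ.^ a) m′))) , r∤m′

  coprime-prime-power : ∀ {r m} → Prime r → ¬ r ℕ.∣ m → ∀ k → Coprime (r ℕ.^ k) m
  coprime-prime-power r-prime r∤m ℕ.zero    (d∣1 , _) = ℕ.∣1⇒≡1 d∣1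
  coprime-prime-power r-prime r∤m (ℕ.suc k) (d∣r^k , d∣m) =
    coprime-prime-power r-prime r∤m k
      (coprime-divisor (prime-coprime r-prime (λ r∣d → r∤m (ℕ.∣-trans r∣d d∣m))) d∣r^k , d∣m)

  opaque
    gcd-split : ∀ e d → .{{_ : NonZero e}} → ∃ λ G → ∃ λ e₁ → ∃ λ d₁ →
                NonZero G × e ≡ e₁ ℕ.* G × d ≡ d₁ ℕ.* G × Coprime e₁ d₁
    gcd-split e d = gcd e d , e ℕ./ gcd e d , d ℕ./ gcd e d , G≢0 ,
      sym (ℕ.m/n*n≡m (gcd[m,n]∣m e d)) , sym (ℕ.m/n*n≡m (gcd[m,n]∣n e d)) , coprime-/gcd e d
      where
      instance
        G≢0 : NonZero (gcd e d)
        G≢0 = ℕ.≢-nonZero (gcd[m,n]≢0 e d (inj₁ (ℕ.≢-nonZero⁻¹ e)))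

    -- Divide both numbers by G = gcd(e, d). A prime r dividing e / G does not divide d / G, so the
    -- power r^a in G is the whole r-part of d, while e contains at least one more factor r.
    excess-prime : ∀ d e → .{{_ : NonZero e}} → ¬ e ℕ.∣ d →
                   ∃ λ r → ∃ λ a → ∃ λ D → ∃ λ E →
                     Prime r × d ≡ D ℕ.* r ℕ.^ a × e ≡ r ℕ.^ ℕ.suc a ℕ.* E × ¬ r ℕ.∣ D
    excess-prime d e e∤d
      with G , e₁ , d₁ , G≢0 , e≡ , d≡ , e₁⊥d₁ ← gcd-split e d
      with r , r-prime , r∣e₁@(ℕ.divides e₂ e₁≡) ← prime-divisor e₁
             {{ℕ.≢-nonZero (λ e₁≡0 → ℕ.≢-nonZero⁻¹ e (trans e≡ (cong (ℕ._* G) e₁≡0)))}}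
             (λ e₁≡1 → e∤d (ℕ.divides d₁ (trans d≡ (cong (d₁ ℕ.*_)
               (sym (trans e≡ (trans (cong (ℕ._* G) e₁≡1) (ℕ.+-identityʳ G))))))))
      with a , G′ , G≡ , r∤G′ ← prime-part r-prime G {{G≢0}} =
        r , a , G′ ℕ.* d₁ , G′ ℕ.* e₂ , r-prime ,
        trans d≡ (trans (cong (d₁ ℕ.*_) G≡) (lemma₁ d₁ (r ℕ.^ a) G′)) ,
        trans e≡ (trans (cong₂ ℕ._*_ e₁≡ G≡) (lemma₂ e₂ r (r ℕ.^ a) G′)) ,
        λ r∣D → [ r∤G′ , (λ r∣d₁ → ℕ.<⇒≢ (prime>1 r-prime) (sym (e₁⊥d₁ (r∣e₁ , r∣d₁)))) ]′
          (euclidsLemma G′ d₁ r-prime r∣D)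
        where
        lemma₁ : ∀ d ra G → d ℕ.* (ra ℕ.* G) ≡ G ℕ.* d ℕ.* ra
        lemma₁ = solve-∀-ℕ
        lemma₂ : ∀ e r ra G → e ℕ.* r ℕ.* (ra ℕ.* G) ≡ r ℕ.* ra ℕ.* (G ℕ.* e)
        lemma₂ = solve-∀-ℕ

  opaque
    -- With the data of `excess-prime`, x ^ E has order r^(a+1) and h ^ (r^a) has order D, which is
    -- prime to r. Their product has order r^(a+1) D = r d.
    larger-order : ∀ {n h x d e} → NonZero d → NonZero e → IsOrder n h d → IsOrder n x e → ¬ e ℕ.∣ d →
                   ∃ λ z → ∃ λ d′ → IsOrder n z d′ × d ℕ.< d′
    larger-order {n} {h} {x} {d} {e} d≢0 e≢0 h-order x-order e∤d
      with r , a , D , E , r-prime , d≡ , e≡ , r∤D ← excess-prime d e {{e≢0}} e∤d =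
      x ^ E * h ^ (r ℕ.^ a) , r ℕ.^ ℕ.suc a ℕ.* D ,
      order-* {x = x ^ E} {h ^ (r ℕ.^ a)} {r ℕ.^ ℕ.suc a} {D} (coprime-prime-power r-prime r∤D (ℕ.suc a))
        (order-^ (r ℕ.^ ℕ.suc a) E {{E≢0 r a E e≡}} (subst (IsOrder n x) e≡ x-order))
        (order-^ D (r ℕ.^ a) {{ℕ.m^n≢0 r a {{prime⇒nonZero r-prime}}}} (subst (IsOrder n h) d≡ h-order)) ,
      subst (d ℕ.<_) (trans (cong (ℕ._* r) d≡) (lemma D r (r ℕ.^ a))) (ℕ.m<m*n d r {{d≢0}} (prime>1 r-prime))
      where
      lemma : ∀ D r ra → D ℕ.* ra ℕ.* r ≡ r ℕ.* ra ℕ.* D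
      lemma = solve-∀-ℕ
      E≢0 : ∀ r a E → e ≡ r ℕ.^ ℕ.suc a ℕ.* E → NonZero E
      E≢0 r a E e≡ = ℕ.≢-nonZero λ { refl → ℕ.≢-nonZero⁻¹ e {{e≢0}} (trans e≡ (ℕ.*-zeroʳ (r ℕ.^ ℕ.suc a))) }

  -- For n prime, γ a primitive root, d = n - 1 and u ≠ 0 this is a bijection: a centre, then a
  -- geometric progression around it. It serves to bound orders, to find logarithms, and to split a
  -- sum over ℤ/p into the contributions of a fixed point and of a long cycle.
  enumerate : ∀ {n} .{{_ : NonZero n}} → ℤ → ℤ → ℤ → ∀ {d} → Fin (ℕ.suc d) → Fin n
  enumerate a u γ zero    = ⟦ a ⟧
  enumerate a u γ (suc k) = ⟦ a + γ ^ toℕ k * u ⟧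

  order⇒unit : ∀ {n x d} → IsOrder n x (ℕ.suc d) → x ^ d * x ≈ 1ℤ mod n
  order⇒unit {x = x} {d} (is-order eq _) = ≈-trans (≈-reflexive (*-comm (x ^ d) x)) eq

  powers-distinct-< : ∀ {n x d} → IsOrder n x d → ∀ {i j} → i ℕ.< j → j ℕ.< d → ¬ x ^ j ≈ x ^ i mod n
  powers-distinct-< {n} {x} {d@(ℕ.suc d′)} order {i} {j} i<j j<d eq =
    ℕ.<⇒≱ j<d (ℕ.≤-trans (ℕ.∣⇒≤ {{ℕ.>-nonZero (ℕ.m<n⇒0<n∸m i<j)}} (least order (j ℕ.∸ i)
      (unit-^-cancel x (x ^ d′) (order⇒unit order) i (j ℕ.∸ i)
        (≈-trans (≈-reflexive (cong (x ^_) (ℕ.m+[n∸m]≡n (ℕ.<⇒≤ i<j)))) eq)))) (ℕ.m∸n≤m j i))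

  powers-distinct : ∀ {n x d} → IsOrder n x d → ∀ {i j} → i ℕ.< d → j ℕ.< d → x ^ i ≈ x ^ j mod n → i ≡ j
  powers-distinct order {i} {j} i<d j<d eq with ℕ.<-cmp i j
  ... | tri< i<j _ _ = contradiction (≈-sym eq) (powers-distinct-< order i<j j<d)
  ... | tri≈ _ i≡j _ = i≡j
  ... | tri> _ _ j<i = contradiction eq (powers-distinct-< order j<i i<d)

  ^≉0 : ∀ {p} → Prime p → ∀ {x} → ¬ x ≈ 0ℤ mod p → ∀ k → ¬ x ^ k ≈ 0ℤ mod p
  ^≉0 p-prime x≉0 ℕ.zero    eq = 1≉0 (prime>1 p-prime) eq
  ^≉0 p-prime {x} x≉0 (ℕ.suc k) eq with *≈0⇒ p-prime x (x ^ k) eq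
  ... | inj₁ x≈0  = x≉0 x≈0
  ... | inj₂ xᵏ≈0 = ^≉0 p-prime x≉0 k xᵏ≈0

  *≉0 : ∀ {p} → Prime p → ∀ a b → ¬ a ≈ 0ℤ mod p → ¬ b ≈ 0ℤ mod p → ¬ a * b ≈ 0ℤ mod p
  *≉0 p-prime a b a≉0 b≉0 eq with *≈0⇒ p-prime a b eq
  ... | inj₁ a≈0 = a≉0 a≈0
  ... | inj₂ b≈0 = b≉0 b≈0

  order⇒≉0 : ∀ {p} → Prime p → ∀ {x d} → IsOrder p x (ℕ.suc d) → ¬ x ≈ 0ℤ mod p
  order⇒≉0 p-prime {x} {d} (is-order eq _) x≈0 = 1≉0 (prime>1 p-prime) (≈-trans (≈-sym eq) (*-≈ˡ (x ^ d) x≈0))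

  +-cancelˡ-≈ : ∀ {n} c {a b} → c + a ≈ c + b mod n → a ≈ b mod n
  +-cancelˡ-≈ c {a} {b} eq = +-cancelʳ-≈ c (≈-trans (≈-reflexive (+-comm a c)) (≈-trans eq (≈-reflexive (+-comm c b))))

  enumerate-injective : ∀ {p} .{{_ : NonZero p}} → Prime p → ∀ a u {γ d} → ¬ u ≈ 0ℤ mod p → IsOrder p γ d →
                        Injective _≡_ _≡_ (enumerate {p} a u γ {d})
  enumerate-injective {p} p-prime a u {γ} {ℕ.suc d} u≉0 γ-order = injective
    where
    shifted≉a : ∀ k → ¬ a + γ ^ k * u ≈ a mod p
    shifted≉a k eq = *≉0 p-prime (γ ^ k) u (^≉0 p-prime (order⇒≉0 p-prime γ-order) k) u≉0
      (+-cancelˡ-≈ a (≈-trans eq (≈-reflexive (sym (+-identityʳ a)))))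

    injective : Injective _≡_ _≡_ (enumerate {p} a u γ {ℕ.suc d})
    injective {zero}  {zero}  eq = refl
    injective {zero}  {suc j} eq = contradiction (⟦⟧-injective (sym eq)) (shifted≉a (toℕ j))
    injective {suc i} {zero}  eq = contradiction (⟦⟧-injective eq) (shifted≉a (toℕ i))
    injective {suc i} {suc j} eq with u′ , unit ← prime⇒unit p-prime u≉0 = cong suc (toℕ-injective
      (powers-distinct γ-order (toℕ<n i) (toℕ<n j) (unit-cancelˡ u u′ unit
        (≈-trans (≈-reflexive (*-comm u (γ ^ toℕ i)))
          (≈-trans (+-cancelˡ-≈ a (⟦⟧-injective eq)) (≈-reflexive (*-comm (γ ^ toℕ j) u)))))))
  enumerate-injective p-prime a u {d = ℕ.zero} _ _ {zero} {zero} _ = refl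

  order<p : ∀ {p} → Prime p → ∀ {x d} → IsOrder p x (ℕ.suc d) → ℕ.suc d ℕ.< p
  order<p {p} p-prime x-order = injective⇒≤
    (enumerate-injective {{prime⇒nonZero p-prime}} p-prime 0ℤ 1ℤ (1≉0 (prime>1 p-prime)) x-order)

  all-roots⇒order≥ : ∀ {N} → Prime (ℕ.suc N) → ∀ d .{{_ : NonZero d}} →
                     (∀ (x : Fin (ℕ.suc N)) → ¬ rep x ≈ 0ℤ mod ℕ.suc N → rep x ^ d ≈ 1ℤ mod ℕ.suc N) → N ℕ.≤ d
  all-roots⇒order≥ {N} p-prime d roots = ℕ.≮⇒≥ λ d<N →
    let small : ∀ (i : Fin (ℕ.suc d)) → ℕ.suc (toℕ i) ℕ.< ℕ.suc N
        small i = ℕ.s≤s (ℕ.≤-trans (toℕ<n i) d<N)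
    in too-many-roots-of-unity p-prime d (λ i → + ℕ.suc (toℕ i))
      (λ {i} {j} eq → toℕ-injective (ℕ.suc-injective (small-≈⇒≡ (small i) (small j) eq)))
      (λ i → subst (λ z → (+ z) ^ d ≈ 1ℤ mod ℕ.suc N) (toℕ-fromℕ< (small i)) (roots (fromℕ< (small i)) λ eq →
        contradiction (small-≈⇒≡ (small i) ℕ.z<s (subst (λ z → + z ≈ 0ℤ mod ℕ.suc N) (toℕ-fromℕ< (small i)) eq)) λ ()))

  opaque
    -- If the order d of h is below p - 1, then X^d - 1 cannot vanish at all of 1, ..., p - 1. An x
    -- where it does not vanish has an order that does not divide d, and `larger-order` applies.
    full-or-larger-order : ∀ {N} → Prime (ℕ.suc N) → ∀ {h d} → IsOrder (ℕ.suc N) h (ℕ.suc d) →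
                           N ℕ.≤ ℕ.suc d ⊎ ∃ λ z → ∃ λ d′ → IsOrder (ℕ.suc N) z d′ × ℕ.suc d ℕ.< d′
    full-or-larger-order {N} p-prime {h} {d} h-order =
      decide (any? (λ x → ¬? (rep x ≈0?mod ℕ.suc N) ×-dec ¬? ((rep x ^ ℕ.suc d) ≈? 1ℤ mod ℕ.suc N)))
      where
      decide : Dec (∃ λ (x : Fin (ℕ.suc N)) → ¬ rep x ≈ 0ℤ mod ℕ.suc N × ¬ rep x ^ ℕ.suc d ≈ 1ℤ mod ℕ.suc N) →
               N ℕ.≤ ℕ.suc d ⊎ ∃ λ z → ∃ λ d′ → IsOrder (ℕ.suc N) z d′ × ℕ.suc d ℕ.< d′
      decide (no none) = inj₁ (all-roots⇒order≥ p-prime (ℕ.suc d) λ x x≉0 →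
        decidable-stable ((rep x ^ ℕ.suc d) ≈? 1ℤ mod ℕ.suc N) λ x^d≉1 → none (x , x≉0 , x^d≉1))
      decide (yes (x , x≉0 , x^d≉1)) =
        let x′ , unit = prime⇒unit p-prime x≉0
            e , x-order = order-exists (rep x) x′ unit
        in inj₂ (larger-order {d = ℕ.suc d} {ℕ.suc e} _ _ h-order x-order (λ e∣d → x^d≉1 (^-≈1-∣ {x = rep x} (power≈1 x-order) e∣d)))

    primitive-root : ∀ {N} → Prime (ℕ.suc N) → ∃ λ g → IsOrder (ℕ.suc N) g N
    -- The order grows in every round and never exceeds N, so N rounds suffice, starting from the
    -- element 1 of order 1.
    primitive-root {N} p-prime = search N 0 {1ℤ} (ℕ.m≤m+n N 1) (is-order ≈-refl λ k _ → ℕ.1∣ k)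
      where
      search : ∀ fuel d {h} → N ℕ.≤ fuel ℕ.+ ℕ.suc d → IsOrder (ℕ.suc N) h (ℕ.suc d) → ∃ λ g → IsOrder (ℕ.suc N) g N
      search fuel d {h} bound h-order with full-or-larger-order p-prime h-order
      ... | inj₁ N≤d = h , subst (IsOrder (ℕ.suc N) h) (ℕ.≤-antisym (ℕ.s≤s⁻¹ (order<p p-prime h-order)) N≤d) h-order
      search ℕ.zero d bound h-order | inj₂ (z , ℕ.suc d′ , z-order , d<d′) =
        contradiction bound (ℕ.<⇒≱ (ℕ.≤-trans d<d′ (ℕ.s≤s⁻¹ (order<p p-prime z-order))))
      search (ℕ.suc fuel) d bound h-order | inj₂ (z , ℕ.suc d′ , z-order , d<d′) =
        search fuel d′ (ℕ.≤-trans bound (ℕ.≤-trans (ℕ.≤-reflexive (sym (ℕ.+-suc fuel (ℕ.suc d)))) (ℕ.+-monoʳ-≤ fuel d<d′))) z-order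

  -- Skew products

  module _ {a b} {I : Set a} {J : Set b} where

    skew : (J → J) → (J → I → I) → I × J → I × J
    skew B A (i , j) = A j i , B j

    skew-lift : ∀ {B A} → (∀ j i′ → ∃ λ i → A j i ≡ i′) → ∀ k {j j′} → fold j B k ≡ j′ →
                ∀ i′ → ∃ λ i → fold (i , j) (skew B A) k ≡ (i′ , j′)
    skew-lift surj ℕ.zero    refl i′ = i′ , refl
    skew-lift {B} {A} surj (ℕ.suc k) {j} refl i″ with i′ , eq′ ← surj (fold j B k) i″
      with i , eq ← skew-lift {B} {A} surj k refl i′ =
      i , trans (cong (skew B A) eq) (cong (_, fold j B (ℕ.suc k)) eq′)

    skew-return : ∀ {B A j L R} → (∀ i → fold (i , j) (skew B A) L ≡ (R i , j)) →
                  ∀ l i → fold (i , j) (skew B A) (l ℕ.* L) ≡ (fold i R l , j)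
    skew-return return ℕ.zero    i = refl
    skew-return {B} {A} {j} {L} {R} return (ℕ.suc l) i =
      trans (fold-+ (i , j) (skew B A) L)
        (trans (cong (λ z → fold z (skew B A) L) (skew-return {B} {A} return l i)) (return (fold i R l)))

    -- A point over j′ is pulled back, by surjectivity of the fibre maps, to a point over j that
    -- leads to it; the latter is reached by iterating R. Here L may be any return time, even 0.
    skew-covers : ∀ {B A j L R is} → (∀ j i′ → ∃ λ i → A j i ≡ i′) →
                  (∀ i → fold (i , j) (skew B A) L ≡ (R i , j)) → Covers R is →
                  ∀ {j′} → Reaches B j j′ → ∀ i′ → Any (λ z → Reaches (skew B A) z (i′ , j′)) (map (_, j) is)
    skew-covers {B} {A} {j} {L} surj return R-covers (k , eq) i′
      with i , lift ← skew-lift {B} {A} surj k eq i′ =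
      Any.map⁺ (Any.map (λ { (l , refl) → Reaches-trans (l ℕ.* L , skew-return {B} {A} return l _) (k , lift) }) (R-covers i))

  Covers-transfer : ∀ {a b} {X : Set a} {Y : Set b} (φ : X → Y) → (∀ y → ∃ λ x → φ x ≡ y) →
                    ∀ {f g} → (∀ x → f (φ x) ≡ φ (g x)) → ∀ {xs} → Covers g xs → Covers f (map φ xs)
  Covers-transfer φ surj {f} {g} comm covers y with x , refl ← surj y =
    Any.map⁺ (Any.map (λ { (k , refl) → k , fold-comm k _ }) (covers x))
    where
    fold-comm : ∀ k x → fold (φ x) f k ≡ φ (fold x g k)
    fold-comm ℕ.zero    x = refl
    fold-comm (ℕ.suc k) x = trans (cong f (fold-comm k x)) (comm _)

  skewₚ : ∀ {N n m} → (Fin n × Fin m) ↔ Fin N → Permutation′ m → (Fin m → Permutation′ n) → Permutation′ N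
  skewₚ {N} {n} {m} φ β α = permutation
    (λ x → to (forward (from x))) (λ x → to (backward (from x)))
    (λ x → trans (cong (to ∘ forward) (strictlyInverseʳ (backward (from x)))) (trans (cong to (forward-backward (from x))) (strictlyInverseˡ x)))
    (λ x → trans (cong (to ∘ backward) (strictlyInverseʳ (forward (from x)))) (trans (cong to (backward-forward (from x))) (strictlyInverseˡ x)))
    where
    open Inverse φ using (to; from; strictlyInverseˡ; strictlyInverseʳ)
    forward : Fin n × Fin m → Fin n × Fin m
    forward = skew (β ⟨$⟩ʳ_) (λ j → α j ⟨$⟩ʳ_)
    backward : Fin n × Fin m → Fin n × Fin m
    backward (i , j) = α (β ⟨$⟩ˡ j) ⟨$⟩ˡ i , β ⟨$⟩ˡ j
    forward-backward : ∀ z → forward (backward z) ≡ z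
    forward-backward (i , j) = cong₂ _,_ (inverseʳ (α (β ⟨$⟩ˡ j))) (inverseʳ β)
    backward-forward : ∀ z → backward (forward z) ≡ z
    backward-forward (i , j) = cong₂ _,_
      (trans (cong (λ k → α k ⟨$⟩ˡ (α j ⟨$⟩ʳ i)) (inverseˡ β)) (inverseˡ (α j))) (inverseˡ β)

  skew-bound : ∀ {N n m} .{{_ : NonZero N}} (φ : (Fin n × Fin m) ↔ Fin N) (b₀ : Fin N → Fin m) (s : Fin N → Fin m → Fin n) →
               (∀ b i j → Inverse.to φ (i , j) ⊕ b ≡ Inverse.to φ (i ⊕ s b j , j ⊕ b₀ b)) →
               (β : Permutation′ m) (α : Fin m → Permutation′ n) → ∀ {k} →
               (∀ b → ∃ λ xs → length xs ℕ.+ k ℕ.≤ N ×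
                 Covers (skew (λ j → β ⟨$⟩ʳ (j ⊕ b₀ b)) (λ j i → α (j ⊕ b₀ b) ⟨$⟩ʳ (i ⊕ s b j))) xs) →
               k ℕ.≤ t N
  skew-bound φ b₀ s shift β α {k} covers = t-lower-bound (skewₚ φ β α) λ b →
    let xs , len , cov = covers b
    in map to xs
     , Covers-transfer to (λ y → from y , strictlyInverseˡ y)
         (λ (i , j) → trans (cong (skewₚ φ β α ⟨$⟩ʳ_) (shift b i j))
           (cong (to ∘ skew (β ⟨$⟩ʳ_) (λ j → α j ⟨$⟩ʳ_)) (strictlyInverseʳ _))) cov
     , subst (λ l → l ℕ.+ k ℕ.≤ _) (sym (length-map to xs)) len
    where open Inverse φ using (to; from; strictlyInverseˡ; strictlyInverseʳ)

  ⊕-surjective : ∀ {n} (π : Permutation′ n) s y → ∃ λ x → π ⟨$⟩ʳ (x ⊕ s) ≡ y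
  ⊕-surjective π s y = (π ⟨$⟩ˡ y) ⊕ ⊖ s , trans (cong (π ⟨$⟩ʳ_) (⊖-⊕-cancel s (π ⟨$⟩ˡ y))) (inverseʳ π)

  -- Coordinates on ℤ/nm: digits and Chinese remainders

  scale-≈ : ∀ {n a b} m → a ≈ b mod n → + m * a ≈ + m * b mod (n ℕ.* m)
  scale-≈ {n} {b = b} m (congruent q refl) =
    congruent q (trans (lemma (+ m) b q (+ n)) (cong (λ z → + m * b + q * z) (sym (pos-* n m))))
    where
    lemma : ∀ m b q n → m * (b + q * n) ≡ m * b + q * (n * m)
    lemma = solve-∀

  rep-combine : ∀ {n m} (i : Fin n) (j : Fin m) → rep (combine i j) ≡ + m * rep i + rep j
  rep-combine {n} {m} i j = trans (cong +_ (toℕ-combine i j)) (cong (λ z → z + rep j) (pos-* m (toℕ i)))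

  -- The low digits add with a carry, which is the quotient of rep-⊕.
  combine-⊕ : ∀ {n m} .{{_ : NonZero n}} (i b₁ : Fin n) (j b₀ : Fin m) →
              combine i j ⊕ combine b₁ b₀ ≡ combine (i ⊕ ⟦ rep b₁ - _≈_mod_.quotient (rep-⊕ j b₀) ⟧) (j ⊕ b₀)
  combine-⊕ {n} {m} i b₁ j b₀ with rep-⊕ j b₀
  ... | congruent q j⊕b₀≡ = rep-injective (begin
    rep (combine i j ⊕ combine b₁ b₀)
      ≈⟨ rep-⊕ (combine i j) (combine b₁ b₀) ⟩
    rep (combine i j) + rep (combine b₁ b₀)
      ≡⟨ cong₂ _+_ (rep-combine i j) (rep-combine b₁ b₀) ⟩
    (+ m * rep i + rep j) + (+ m * rep b₁ + rep b₀)
      ≡⟨ lemma (+ m) (rep i) (rep j) (rep b₁) (rep b₀) q ⟩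
    + m * (rep i + (rep b₁ - q)) + (rep j + rep b₀ + q * + m)
      ≡⟨ cong (λ z → + m * (rep i + (rep b₁ - q)) + z) j⊕b₀≡ ⟨
    + m * (rep i + (rep b₁ - q)) + rep (j ⊕ b₀)
      ≈⟨ +-≈ˡ (rep (j ⊕ b₀)) (scale-≈ m (≈-trans (rep-⊕ i ⟦ rep b₁ - q ⟧) (+-≈ʳ (rep i) (rep-⟦⟧ (rep b₁ - q))))) ⟨
    + m * rep (i ⊕ ⟦ rep b₁ - q ⟧) + rep (j ⊕ b₀)
      ≡⟨ rep-combine (i ⊕ ⟦ rep b₁ - q ⟧) (j ⊕ b₀) ⟨
    rep (combine (i ⊕ ⟦ rep b₁ - q ⟧) (j ⊕ b₀)) ∎)
    where
    open Mod-Reasoning (n ℕ.* m)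
    lemma : ∀ m i j b₁ b₀ q → (m * i + j) + (m * b₁ + b₀) ≡ m * (i + (b₁ - q)) + (j + b₀ + q * m)
    lemma = solve-∀

  digits : ∀ {n m} → (Fin n × Fin m) ↔ Fin (n ℕ.* m)
  digits {n} {m} = mk↔ₛ′ (uncurry combine) (remQuot {n} m) (combine-remQuot {n} m) (uncurry remQuot-combine)

  -- The shift that really occurs over j is the high digit of b plus the carry from j ⊕ b₀. Asking
  -- for covers under every function s avoids any analysis of carries.
  digits-bound : ∀ {n m} .{{_ : NonZero n}} .{{_ : NonZero m}} (β : Permutation′ m) (α : Fin m → Permutation′ n) → ∀ {k} →
                 (∀ b₀ (s : Fin m → Fin n) → ∃ λ xs → length xs ℕ.+ k ℕ.≤ n ℕ.* m ×
                   Covers (skew (λ j → β ⟨$⟩ʳ (j ⊕ b₀)) (λ j i → α (j ⊕ b₀) ⟨$⟩ʳ (i ⊕ s j))) xs) →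
                 k ℕ.≤ t (n ℕ.* m)
  digits-bound {n} {m} β α covers = skew-bound {{ℕ.m*n≢0 n m}} digits low high shift β α (λ b → covers (low b) (high b))
    where
    low : Fin (n ℕ.* m) → Fin m
    low b = proj₂ (remQuot {n} m b)
    high : Fin (n ℕ.* m) → Fin m → Fin n
    high b j = ⟦ rep (proj₁ (remQuot {n} m b)) - _≈_mod_.quotient (rep-⊕ j (low b)) ⟧
    shift : ∀ b i j → combine i j ⊕ b ≡ combine (i ⊕ high b j) (j ⊕ low b)
    shift b i j = trans (cong (combine i j ⊕_) (sym (combine-remQuot {n} m b))) (combine-⊕ i (proj₁ (remQuot {n} m b)) j (low b))

  divides-product : ∀ {n m z} → Coprime n m → z ≈ 0ℤ mod n → z ≈ 0ℤ mod m → z ≈ 0ℤ mod (n ℕ.* m)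
  divides-product n⊥m n∣z m∣z = ∣⇒≈0 (coprime-∣⇒*∣ n⊥m (≈0⇒∣ n∣z) (≈0⇒∣ m∣z))

  ≈-product : ∀ {n m} → Coprime n m → ∀ {a b} → a ≈ b mod n → a ≈ b mod m → a ≈ b mod (n ℕ.* m)
  ≈-product n⊥m {a} {b} eq₁ eq₂ = -≈0⇒≈ a b (divides-product n⊥m (≈⇒-≈0 eq₁) (≈⇒-≈0 eq₂))

  opaque
    crt-solution : ∀ {n m} → Coprime n m → ∀ a b → ∃ λ z → z ≈ a mod n × z ≈ b mod m
    crt-solution {n} {m} n⊥m a b
      with m′ , m′m≈1 ← coprime⇒unit (+ m) (coprime-sym n⊥m)
      with n′ , n′n≈1 ← coprime⇒unit (+ n) n⊥m =
      a * (m′ * + m) + b * (n′ * + n) ,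
      collapse a b m′m≈1 (multiple n′ n) ,
      ≈-trans (≈-reflexive (+-comm (a * (m′ * + m)) (b * (n′ * + n)))) (collapse b a n′n≈1 (multiple m′ m))
      where
      multiple : ∀ q n → q * + n ≈ 0ℤ mod n
      multiple q n = congruent q (sym (+-identityˡ (q * + n)))
      collapse : ∀ {n} a b {u w} → u ≈ 1ℤ mod n → w ≈ 0ℤ mod n → a * u + b * w ≈ a mod n
      collapse a b u≈1 w≈0 = ≈-trans (+-≈ (*-≈ʳ a u≈1) (*-≈ʳ b w≈0)) (≈-reflexive (lemma a b))
        where
        lemma : ∀ a b → a * 1ℤ + b * 0ℤ ≡ a
        lemma = solve-∀

  crt : ∀ {n m} .{{_ : NonZero n}} .{{_ : NonZero m}} .{{_ : NonZero (n ℕ.* m)}} → Coprime n m →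
        (Fin n × Fin m) ↔ Fin (n ℕ.* m)
  crt {n} {m} n⊥m = mk↔ₛ′ (λ (i , j) → ⟦ solution i j ⟧) (λ x → ⟦ rep x ⟧ , ⟦ rep x ⟧)
    (λ x → rep-injective (≈-trans (rep-⟦⟧ _) (≈-product n⊥m
      (≈-trans (proj₁ (proj₂ (crt-solution n⊥m (rep ⟦ rep x ⟧) (rep ⟦ rep x ⟧)))) (rep-⟦⟧ (rep x)))
      (≈-trans (proj₂ (proj₂ (crt-solution n⊥m (rep ⟦ rep x ⟧) (rep ⟦ rep x ⟧)))) (rep-⟦⟧ (rep x))))))
    (λ (i , j) → cong₂ _,_
      (rep-injective (≈-trans (rep-⟦⟧ _) (≈-trans (≈-weaken (ℕ.m∣m*n m) (rep-⟦⟧ _)) (proj₁ (proj₂ (crt-solution n⊥m (rep i) (rep j)))))))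
      (rep-injective (≈-trans (rep-⟦⟧ _) (≈-trans (≈-weaken (ℕ.n∣m*n n) (rep-⟦⟧ _)) (proj₂ (proj₂ (crt-solution n⊥m (rep i) (rep j))))))))
    where
    solution : Fin n → Fin m → ℤ
    solution i j = proj₁ (crt-solution n⊥m (rep i) (rep j))

  -- In contrast to `digits-bound`, the fibre shift b₁ is the same over all j. The computation of
  -- `gΘ≈` depends on this: a constant shift is cancelled by a geometric sum.
  crt-bound : ∀ {n m} .{{_ : NonZero n}} .{{_ : NonZero m}} → Coprime n m →
              (β : Permutation′ m) (α : Fin m → Permutation′ n) → ∀ {k} →
              (∀ b₀ b₁ → ∃ λ xs → length xs ℕ.+ k ℕ.≤ n ℕ.* m ×
                Covers (skew (λ j → β ⟨$⟩ʳ (j ⊕ b₀)) (λ j i → α (j ⊕ b₀) ⟨$⟩ʳ (i ⊕ b₁))) xs) →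
              k ℕ.≤ t (n ℕ.* m)
  crt-bound {n} {m} n⊥m β α covers =
    skew-bound φ (λ b → ⟦ rep b ⟧) (λ b _ → ⟦ rep b ⟧) shift β α (λ b → covers ⟦ rep b ⟧ ⟦ rep b ⟧)
    where
    instance
      nm≢0 : NonZero (n ℕ.* m)
      nm≢0 = ℕ.m*n≢0 n m
    φ : (Fin n × Fin m) ↔ Fin (n ℕ.* m)
    φ = crt n⊥m
    shift : ∀ b i j → Inverse.to φ (i , j) ⊕ b ≡ Inverse.to φ (i ⊕ ⟦ rep b ⟧ , j ⊕ ⟦ rep b ⟧)
    shift b i j =
      let z , z≈i , z≈j = crt-solution n⊥m (rep i) (rep j)
          w , w≈i , w≈j = crt-solution n⊥m (rep (i ⊕ ⟦ rep b ⟧)) (rep (j ⊕ ⟦ rep b ⟧))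
      in rep-injective (≈-trans (rep-⊕ ⟦ z ⟧ b) (≈-trans (+-≈ˡ (rep b) (rep-⟦⟧ z))
        (≈-trans (≈-product n⊥m (component i z≈i w≈i) (component j z≈j w≈j)) (≈-sym (rep-⟦⟧ w)))))
      where
      component : ∀ {k} .{{_ : NonZero k}} (i : Fin k) {z w} → z ≈ rep i mod k → w ≈ rep (i ⊕ ⟦ rep b ⟧) mod k → z + rep b ≈ w mod k
      component i z≈i w≈i = ≈-trans (+-≈ˡ (rep b) z≈i)
        (≈-sym (≈-trans w≈i (≈-trans (rep-⊕ i ⟦ rep b ⟧) (+-≈ʳ (rep i) (rep-⟦⟧ (rep b))))))

  -- The product inequality

  ⊕-assoc : ∀ {n} (x y z : Fin n) → (x ⊕ y) ⊕ z ≡ x ⊕ (y ⊕ z)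
  ⊕-assoc x y z = rep-injective (≈-trans (rep-⊕ (x ⊕ y) z) (≈-trans (+-≈ˡ (rep z) (rep-⊕ x y))
    (≈-trans (≈-reflexive (+-assoc (rep x) (rep y) (rep z)))
      (≈-sym (≈-trans (rep-⊕ x (y ⊕ z)) (+-≈ʳ (rep x) (rep-⊕ y z)))))))

  -- Away from j* the fibre maps are translations, and so are their composites. The period known for
  -- j* need not be the shortest, so a walk of that length may meet j* early; hence the two
  -- outcomes.
  translates-until : ∀ {m n} (B : Fin m → Fin m) (A : Fin m → Fin (suc n) → Fin (suc n)) (j₁ j* : Fin m) →
    (∀ j → j ≢ j* → ∃ λ s → ∀ i → A j i ≡ i ⊕ s) → ∀ k →
    (∃ λ L → ∃ λ s → ∀ i → fold (i , j₁) (skew B A) L ≡ (i ⊕ s , j*)) ⊎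
    (∃ λ s → ∀ i → fold (i , j₁) (skew B A) k ≡ (i ⊕ s , fold j₁ B k))
  translates-until B A j₁ j* trans-off zero = inj₂ (zero , λ i → cong (_, j₁) (sym (⊕-identityʳ i)))
  translates-until B A j₁ j* trans-off (suc k) with translates-until B A j₁ j* trans-off k
  ... | inj₁ hit = inj₁ hit
  ... | inj₂ (s , eq) with fold j₁ B k ≟ j*
  ...   | yes at-j* = inj₁ (k , s , λ i → trans (eq i) (cong (i ⊕ s ,_) at-j*))
  ...   | no  j≢j* with s′ , A≡ ← trans-off (fold j₁ B k) j≢j* =
    inj₂ (s ⊕ s′ , λ i → trans (cong (skew B A) (eq i))
      (cong (_, fold j₁ B (suc k)) (trans (A≡ (i ⊕ s)) (⊕-assoc i s s′))))

  length-concatMap : ∀ {a b} {X : Set a} {Y : Set b} (f : X → List Y) {k} → (∀ x → length (f x) ≡ k) →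
                     ∀ xs → length (concatMap f xs) ≡ length xs ℕ.* k
  length-concatMap f len []       = refl
  length-concatMap f len (x ∷ xs) = trans (length-++ (f x)) (cong₂ ℕ._+_ (len x) (length-concatMap f len xs))

  -- The base β is twisted by α over the single residue 0. The cycle of β through 0 contributes at
  -- most cyc (translate s ∘ₚ α) cycles for some s, and every other cycle of β at most n.
  product-bound : ∀ {n m k l} .{{_ : NonZero n}} .{{_ : NonZero m}} →
                  (α : Permutation′ n) → (∀ b → cyc (translate b ∘ₚ α) ℕ.+ k ℕ.≤ n) →
                  (β : Permutation′ m) → (∀ b → cyc (translate b ∘ₚ β) ℕ.+ l ℕ.≤ m) → n ℕ.* l ℕ.+ k ℕ.≤ t (n ℕ.* m)
  product-bound {n@(suc _)} {m@(suc _)} {k} {l} α α-bound β β-bound = digits-bound {n} {m} β twist covers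
    where
    twist : Fin m → Permutation′ n
    twist zero    = α
    twist (suc _) = idₚ

    covers : ∀ b₀ (s : Fin m → Fin n) → ∃ λ xs → length xs ℕ.+ (n ℕ.* l ℕ.+ k) ℕ.≤ n ℕ.* m ×
               Covers (skew (λ j → β ⟨$⟩ʳ (j ⊕ b₀)) (λ j i → twist (j ⊕ b₀) ⟨$⟩ʳ (i ⊕ s j))) xs
    covers b₀ s =
      let ρ , ρ∈ , ρ~j* = find (cycle-reps-cover βb j*)
          rs , rs′ , reps≡ = ∈-∃++ ρ∈
      in build ρ ρ~j* rs rs′ reps≡ return
      where
      βb = translate b₀ ∘ₚ β
      B : Fin m → Fin m
      B = βb ⟨$⟩ʳ_
      A : Fin m → Fin n → Fin n
      A j i = twist (j ⊕ b₀) ⟨$⟩ʳ (i ⊕ s j)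
      -- The point j* is the one that b₀ moves to 0, where the twist sits. Starting just after it
      -- makes α the last map on the way round, so the return map is α preceded by a translation,
      -- and `α-bound` applies.
      j* j₁ : Fin m
      j* = zero ⊕ ⊖ b₀
      j₁ = B j*
      j*⊕b₀≡0 : j* ⊕ b₀ ≡ zero
      j*⊕b₀≡0 = ⊖-⊕-cancel b₀ zero

      A-surjective : ∀ j i′ → ∃ λ i → A j i ≡ i′
      A-surjective j = ⊕-surjective (twist (j ⊕ b₀)) (s j)

      A-off : ∀ j → j ≢ j* → ∃ λ s′ → ∀ i → A j i ≡ i ⊕ s′
      A-off j j≢j* with j ⊕ b₀ in eq
      ... | suc _ = s j , λ i → refl
      ... | zero  = contradiction (trans (sym (⊕-⊖-cancel b₀ j)) (cong (_⊕ ⊖ b₀) eq)) j≢j*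

      return : ∃ λ L → ∃ λ s′ → ∀ i → fold (i , j₁) (skew B A) L ≡ (α ⟨$⟩ʳ (i ⊕ s′) , j₁)
      return with N , back ← returns βb j* =
        [ (λ (L , s′ , eq) → close L s′ eq)
        , (λ (s′ , eq) → close N s′ (λ i → trans (eq i) (cong (i ⊕ s′ ,_) (trans (fold-shift B j* N) back))))
        ]′ (translates-until B A j₁ j* A-off N)
        where
        close : ∀ L s′ → (∀ i → fold (i , j₁) (skew B A) L ≡ (i ⊕ s′ , j*)) →
                ∃ λ L → ∃ λ s′ → ∀ i → fold (i , j₁) (skew B A) L ≡ (α ⟨$⟩ʳ (i ⊕ s′) , j₁)
        close L s′ eq = suc L , s′ ⊕ s j* , λ i → trans (cong (skew B A) (eq i)) (cong (_, j₁)
          (trans (cong (λ j → twist j ⟨$⟩ʳ ((i ⊕ s′) ⊕ s j*)) j*⊕b₀≡0) (cong (α ⟨$⟩ʳ_) (⊕-assoc i s′ (s j*)))))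

      build : ∀ ρ → SameCycle βb ρ j* → ∀ rs rs′ → cycle-reps βb ≡ rs ++ ρ ∷ rs′ →
              (∃ λ L → ∃ λ s′ → ∀ i → fold (i , j₁) (skew B A) L ≡ (α ⟨$⟩ʳ (i ⊕ s′) , j₁)) →
              ∃ λ xs → length xs ℕ.+ (n ℕ.* l ℕ.+ k) ℕ.≤ n ℕ.* m × Covers (skew B A) xs
      build ρ ρ~j* rs rs′ reps≡ (L , s′ , return) = special ++ generic , len , cov
        where
        αs = translate s′ ∘ₚ α
        fibre : Fin m → List (Fin n × Fin m)
        fibre r = map (_, r) (allFin n)
        special generic : List (Fin n × Fin m)
        special = map (_, j₁) (cycle-reps αs)
        generic = concatMap fibre (rs ++ rs′)

        over : ∀ i′ {j r} → Reaches B r j → r ∈ rs ++ ρ ∷ rs′ → Any (λ z → Reaches (skew B A) z (i′ , j)) (special ++ generic)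
        over i′ {j} {r} r~j r∈ = [ in-rs , (λ { (here r≡ρ) → at-ρ r≡ρ ; (there r∈rs′) → in-generic (Any.++⁺ʳ rs r∈rs′) }) ]′ (Any.++⁻ rs r∈)
          where
          in-generic : r ∈ rs ++ rs′ → Any (λ z → Reaches (skew B A) z (i′ , j)) (special ++ generic)
          -- Return time 0 with the identity as return map: all n points over r are listed.
          in-generic r∈ = Any.++⁺ʳ special (Any.concatMap⁺ fibre (lose r∈
            (skew-covers {B = B} {A} {L = 0} {R = id} A-surjective (λ i → refl) (allFin-covers id) r~j i′)))
          in-rs : r ∈ rs → Any (λ z → Reaches (skew B A) z (i′ , j)) (special ++ generic)
          in-rs r∈rs = in-generic (Any.++⁺ˡ r∈rs)
          at-ρ : r ≡ ρ → Any (λ z → Reaches (skew B A) z (i′ , j)) (special ++ generic)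
          at-ρ r≡ρ = Any.++⁺ˡ (skew-covers {B = B} {A} {L = L} A-surjective return (cycle-reps-cover αs)
            (Reaches-trans (SameCycle-sym βb (Reaches-trans ρ~j* (1 , refl))) (subst (λ z → Reaches B z j) r≡ρ r~j)) i′)

        cov : Covers (skew B A) (special ++ generic)
        cov (i′ , j) = let r , r∈ , r~j = find (cycle-reps-cover βb j) in over i′ r~j (subst (r ∈_) reps≡ r∈)

        c = length (rs ++ rs′)
        cycβ≡ : cyc βb ≡ suc c
        cycβ≡ = trans (cong length reps≡) (trans (length-++ rs) (trans (ℕ.+-suc (length rs) (length rs′)) (cong suc (sym (length-++ rs)))))

        len : length (special ++ generic) ℕ.+ (n ℕ.* l ℕ.+ k) ℕ.≤ n ℕ.* m
        len = begin
          length (special ++ generic) ℕ.+ (n ℕ.* l ℕ.+ k)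
            ≡⟨ cong (ℕ._+ (n ℕ.* l ℕ.+ k)) (trans (length-++ special) (cong₂ ℕ._+_ (length-map (_, j₁) (cycle-reps αs))
                 (length-concatMap fibre (λ r → trans (length-map (_, r) (allFin n)) (length-tabulate id)) (rs ++ rs′)))) ⟩
          cyc αs ℕ.+ c ℕ.* n ℕ.+ (n ℕ.* l ℕ.+ k)
            ≡⟨ lemma₁ (cyc αs) c n l k ⟩
          cyc αs ℕ.+ k ℕ.+ n ℕ.* (c ℕ.+ l)
            ≤⟨ ℕ.+-monoˡ-≤ (n ℕ.* (c ℕ.+ l)) (α-bound s′) ⟩
          n ℕ.+ n ℕ.* (c ℕ.+ l)
            ≡⟨ ℕ.*-suc n (c ℕ.+ l) ⟨
          n ℕ.* (suc c ℕ.+ l)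
            ≡⟨ cong (λ z → n ℕ.* (z ℕ.+ l)) cycβ≡ ⟨
          n ℕ.* (cyc βb ℕ.+ l)
            ≤⟨ ℕ.*-monoʳ-≤ n (β-bound b₀) ⟩
          n ℕ.* m ∎
          where
          open ℕ.≤-Reasoning
          lemma₁ : ∀ a c n T T′ → a ℕ.+ c ℕ.* n ℕ.+ (n ℕ.* T ℕ.+ T′) ≡ a ℕ.+ T′ ℕ.+ n ℕ.* (c ℕ.+ T)
          lemma₁ = solve-∀-ℕ

  t-product : ∀ n m .{{_ : NonZero n}} .{{_ : NonZero m}} → n ℕ.* t m ℕ.+ t n ℕ.≤ t (n ℕ.* m)
  t-product n m =
    let α , α-bound = t-attained n
        β , β-bound = t-attained m
    in product-bound α α-bound β β-bound

  -- Sums over ℤ/p and discrete logarithms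

  opaque
    injective⇒surjective : ∀ {n} (f : Fin n → Fin n) → Injective _≡_ _≡_ f → ∀ y → ∃ λ x → f x ≡ y
    injective⇒surjective {ℕ.suc n} f f-inj y with any? (λ x → f x ≟ y)
    ... | yes found = found
    ... | no  ¬found = contradiction
      (injective⇒≤ (λ {i} {j} eq → f-inj (punchOut-injective (y≢ i) (y≢ j) eq))) ℕ.1+n≰n
      where
      y≢ : ∀ i → y ≢ f i
      y≢ i y≡ = ¬found (i , sym y≡)

  injective⇒permutation : ∀ {n} (f : Fin n → Fin n) → Injective _≡_ _≡_ f → Permutation′ n
  injective⇒permutation f f-inj = permutation f (proj₁ ∘ surj) (proj₂ ∘ surj)
    (λ x → f-inj (proj₂ (surj (f x))))
    where
    surj : ∀ y → ∃ λ x → f x ≡ y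
    surj = injective⇒surjective f f-inj

  module _ {a ℓ} (M : CommutativeMonoid a ℓ) where
    open CommutativeMonoid M using (Carrier) renaming (_≈_ to _≋_; _∙_ to _⊹_)
    open Sum M

    -- Stated for a commutative monoid because it is applied both to exponents in ℕ and to character
    -- values in ℤ.
    sum-enumerate : ∀ {N} → Prime (ℕ.suc N) → ∀ a u {γ} → ¬ u ≈ 0ℤ mod ℕ.suc N → IsOrder (ℕ.suc N) γ N →
                    (F : Fin (ℕ.suc N) → Carrier) →
                    sum F ≋ (F ⟦ a ⟧ ⊹ sum {N} (λ k → F ⟦ a + γ ^ toℕ k * u ⟧))
    sum-enumerate p-prime a u u≉0 γ-order F =
      sum-permute F (injective⇒permutation _ (enumerate-injective p-prime a u u≉0 γ-order))

  opaque
    discrete-log : ∀ {N} → Prime (ℕ.suc N) → ∀ {γ} → IsOrder (ℕ.suc N) γ N →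
                   ∀ z → ¬ z ≈ 0ℤ mod ℕ.suc N → ∃ λ k → γ ^ k ≈ z mod ℕ.suc N
    discrete-log {N} p-prime {γ} γ-order z z≉0
      with injective⇒surjective _ (enumerate-injective p-prime 0ℤ 1ℤ (1≉0 (prime>1 p-prime)) γ-order) ⟦ z ⟧
    ... | zero  , eq = contradiction (≈-sym (⟦⟧-injective eq)) z≉0
    ... | suc k , eq = toℕ k , ≈-trans (≈-reflexive (lemma (γ ^ toℕ k))) (⟦⟧-injective eq)
      where
      lemma : ∀ x → x ≡ 0ℤ + x * 1ℤ
      lemma = solve-∀

  -- Affine maps

  Affine : ∀ {n} → (Fin n → Fin n) → ℤ → ℤ → Set
  Affine {n} P a c = ∀ x → rep (P x) ≈ a * rep x + c mod n

  -- The fixed point is c / (1 - a). The inverse of 1 - a is an argument, so that the lemma serves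
  -- modulo p² as well as modulo p.
  unit⇒fixed-point : ∀ {n} a c w → w * (1ℤ - a) ≈ 1ℤ mod n → a * (w * c) + c ≈ w * c mod n
  unit⇒fixed-point {n} a c w unit = ≈-sym (-≈0⇒≈ (w * c) (a * (w * c) + c) (begin
    w * c - (a * (w * c) + c)   ≡⟨ lemma w a c ⟩
    (w * (1ℤ - a) - 1ℤ) * c     ≈⟨ *-≈ˡ c (≈⇒-≈0 unit) ⟩
    0ℤ * c                      ≡⟨ *-zeroˡ c ⟩
    0ℤ                          ∎))
    where
    open Mod-Reasoning n
    lemma : ∀ w a c → w * c - (a * (w * c) + c) ≡ (w * (1ℤ - a) - 1ℤ) * c
    lemma = solve-∀

  opaque
    fixed-point : ∀ {p} → Prime p → ∀ a c → ¬ a ≈ 1ℤ mod p → ∃ λ f → a * f + c ≈ f mod p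
    fixed-point p-prime a c a≉1
      with w , unit ← prime⇒unit p-prime {1ℤ - a} (λ eq → a≉1 (≈-sym (-≈0⇒≈ 1ℤ a eq))) =
      w * c , unit⇒fixed-point a c w unit

  -- Relative to its fixed point f, an affine map is multiplication by a.
  affine-fold : ∀ {n} {P : Fin n → Fin n} {a c} f u → Affine P a c → a * f + c ≈ f mod n →
                ∀ {x} → rep x ≈ f + u mod n → ∀ k → rep (fold x P k) ≈ f + a ^ k * u mod n
  affine-fold {n} {P} {a} {c} f u affine fixed {x} x≈ ℕ.zero = ≈-trans x≈ (≈-reflexive (cong (λ z → f + z) (sym (*-identityˡ u))))
  affine-fold {n} {P} {a} {c} f u affine fixed {x} x≈ (ℕ.suc k) = begin
    rep (P (fold x P k))            ≈⟨ affine (fold x P k) ⟩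
    a * rep (fold x P k) + c        ≈⟨ +-≈ˡ c (*-≈ʳ a (affine-fold {P = P} f u affine fixed x≈ k)) ⟩
    a * (f + a ^ k * u) + c         ≡⟨ lemma a f (a ^ k) u c ⟩
    (a * f + c) + a * a ^ k * u     ≈⟨ +-≈ˡ (a * a ^ k * u) fixed ⟩
    f + a * a ^ k * u               ∎
    where
    open Mod-Reasoning n
    lemma : ∀ a f ak u c → a * (f + ak * u) + c ≡ (a * f + c) + a * ak * u
    lemma = solve-∀

  affine-reaches : ∀ {n} {P : Fin n → Fin n} {a c} f u → Affine P a c → a * f + c ≈ f mod n →
                   ∀ {x y} → rep x ≈ f + u mod n → ∀ k → a ^ k * u ≈ rep y - f mod n → Reaches P x y
  affine-reaches {n} {P} {a} {c} f u affine fixed {x} {y} x≈ k eq = k , rep-injective (begin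
    rep (fold x P k)   ≈⟨ affine-fold {P = P} f u affine fixed x≈ k ⟩
    f + a ^ k * u      ≈⟨ +-≈ʳ f eq ⟩
    f + (rep y - f)    ≡⟨ lemma f (rep y) ⟩
    rep y              ∎)
    where
    open Mod-Reasoning n
    lemma : ∀ f y → f + (y - f) ≡ y
    lemma = solve-∀

  order⇒≉1 : ∀ {n γ d} → 2 ℕ.≤ d → IsOrder n γ d → ¬ γ ≈ 1ℤ mod n
  order⇒≉1 {γ = γ} 2≤d γ-order γ≈1 =
    ℕ.<⇒≱ 2≤d (ℕ.∣⇒≤ (least γ-order 1 (≈-trans (≈-reflexive (*-identityʳ γ)) γ≈1)))

  affine-primitive-orbits : ∀ {N} → Prime (ℕ.suc N) → ∀ {γ} → IsOrder (ℕ.suc N) γ N →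
    ∀ {P : Fin (ℕ.suc N) → Fin (ℕ.suc N)} {c} f → Affine P γ c → γ * f + c ≈ f mod ℕ.suc N →
    ∀ y → y ≡ ⟦ f ⟧ ⊎ Reaches P ⟦ f + 1ℤ ⟧ y
  affine-primitive-orbits {N} p-prime {γ} γ-order {P} f affine fixed y with (rep y - f) ≈0?mod ℕ.suc N
  ... | yes y≈f = inj₁ (rep-injective (≈-trans (-≈0⇒≈ (rep y) f y≈f) (≈-sym (rep-⟦⟧ f))))
  ... | no  y≉f with k , eq ← discrete-log p-prime γ-order (rep y - f) y≉f =
    inj₂ (affine-reaches {P = P} f 1ℤ affine fixed (rep-⟦⟧ (f + 1ℤ)) k (≈-trans (≈-reflexive (*-identityʳ (γ ^ k))) eq))

  affine-primitive-cover : ∀ {N} → Prime (ℕ.suc N) → 2 ℕ.≤ N → ∀ {γ} → IsOrder (ℕ.suc N) γ N →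
    ∀ {P : Fin (ℕ.suc N) → Fin (ℕ.suc N)} {c} → Affine P γ c → ∃ λ xs → length xs ≡ 2 × Covers P xs
  affine-primitive-cover {N} p-prime 2≤N {γ} γ-order {P} {c} affine
    with f , fixed ← fixed-point p-prime γ c (order⇒≉1 2≤N γ-order) =
    ⟦ f ⟧ ∷ ⟦ f + 1ℤ ⟧ ∷ [] , refl , λ y →
      [ (λ { refl → here (0 , refl) }) , (λ reaches → there (here reaches)) ]′
        (affine-primitive-orbits p-prime γ-order {P} f affine fixed y)

  even-or-odd : ∀ k → ∃ λ l → k ≡ 2 ℕ.* l ⊎ k ≡ ℕ.suc (2 ℕ.* l)
  even-or-odd ℕ.zero = 0 , inj₁ refl
  even-or-odd (ℕ.suc k) with even-or-odd k
  ... | l , inj₁ refl = l , inj₂ refl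
  ... | l , inj₂ refl = ℕ.suc l , inj₁ (sym (cong ℕ.suc (ℕ.+-suc l (l ℕ.+ 0))))

  -- Relative to the fixed point, non-zero residues are powers of γ: even powers are reached from 1,
  -- odd powers from γ.
  affine-square-cover : ∀ {N} → Prime (ℕ.suc N) → 2 ℕ.≤ N → ∀ {γ} → IsOrder (ℕ.suc N) γ N →
    ∀ {P : Fin (ℕ.suc N) → Fin (ℕ.suc N)} {c} → Affine P (γ ^ 2) c → ∃ λ xs → length xs ≡ 3 × Covers P xs
  -- Modulo 3 the multiplier γ² is 1 and a fixed point may be missing, but there are only three
  -- residues.
  affine-square-cover {2} p-prime _ γ-order {P} affine = allFin 3 , refl , allFin-covers P
  affine-square-cover {0} p-prime () 
  affine-square-cover {1} p-prime (ℕ.s≤s ())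
  affine-square-cover {N@(ℕ.suc (ℕ.suc (ℕ.suc _)))} p-prime _ {γ} γ-order {P} {c} affine
    with f , fixed ← fixed-point p-prime (γ ^ 2) c (λ eq → ℕ.<⇒≱ (ℕ.s≤s (ℕ.s≤s (ℕ.s≤s ℕ.z≤n))) (ℕ.∣⇒≤ (least γ-order 2 eq))) =
    ⟦ f ⟧ ∷ ⟦ f + 1ℤ ⟧ ∷ ⟦ f + γ ⟧ ∷ [] , refl , covers
    where
    covers : Covers P (⟦ f ⟧ ∷ ⟦ f + 1ℤ ⟧ ∷ ⟦ f + γ ⟧ ∷ [])
    covers y with (rep y - f) ≈0?mod ℕ.suc N
    ... | yes y≈f = here (0 , rep-injective (≈-trans (rep-⟦⟧ f) (≈-sym (-≈0⇒≈ (rep y) f y≈f))))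
    ... | no  y≉f with k , eq ← discrete-log p-prime γ-order (rep y - f) y≉f with even-or-odd k
    ...   | l , inj₁ refl = there (here (affine-reaches {P = P} f 1ℤ affine fixed (rep-⟦⟧ (f + 1ℤ)) l
              (≈-trans (≈-reflexive (trans (*-identityʳ ((γ ^ 2) ^ l)) (^-*-assoc γ 2 l))) eq)))
    ...   | l , inj₂ refl = there (there (here (affine-reaches {P = P} f γ affine fixed (rep-⟦⟧ (f + γ)) l
              (≈-trans (≈-reflexive (trans (cong (_* γ) (^-*-assoc γ 2 l)) (*-comm (γ ^ (2 ℕ.* l)) γ))) eq))))

  translation-cover : ∀ {N} → Prime (ℕ.suc N) → ∀ {P : Fin (ℕ.suc N) → Fin (ℕ.suc N)} {T} →
                      ¬ T ≈ 0ℤ mod ℕ.suc N → (∀ x → rep (P x) ≈ rep x + T mod ℕ.suc N) → Covers P (zero ∷ [])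
  translation-cover {N} p-prime {P} {T} T≉0 shift y with T′ , unit ← prime⇒unit p-prime T≉0 =
    here (k , rep-injective (begin
      rep (fold zero P k)     ≈⟨ iterate k ⟩
      + k * T                 ≈⟨ *-≈ˡ T (rep-⟦⟧ (rep y * T′)) ⟩
      rep y * T′ * T          ≡⟨ *-assoc (rep y) T′ T ⟩
      rep y * (T′ * T)        ≈⟨ *-≈ʳ (rep y) unit ⟩
      rep y * 1ℤ              ≡⟨ *-identityʳ (rep y) ⟩
      rep y                   ∎))
    where
    open Mod-Reasoning (ℕ.suc N)
    k = toℕ (⟦_⟧ {ℕ.suc N} (rep y * T′))
    iterate : ∀ k → rep (fold zero P k) ≈ + k * T mod ℕ.suc N
    iterate ℕ.zero    = ≈-reflexive (sym (*-zeroˡ T))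
    iterate (ℕ.suc k) = ≈-trans (shift (fold zero P k)) (≈-trans (+-≈ˡ T (iterate k))
      (≈-reflexive (trans (lemma (+ k) T) (cong (_* T) (sym (pos-+ 1 k))))))
      where
      lemma : ∀ k T → k * T + T ≡ (1ℤ + k) * T
      lemma = solve-∀

  -- Affine skew products over a base with a fixed point and one long cycle

  module ∑ℕ = Sum ℕ.+-0-commutativeMonoid

  affineₚ : ∀ {n} .{{_ : NonZero n}} a a′ → a′ * a ≈ 1ℤ mod n → ℤ → Permutation′ n
  affineₚ {n} a a′ unit c = injective⇒permutation (λ x → ⟦ a * rep x + c ⟧) λ eq →
    rep-injective (unit-cancelˡ a a′ unit (+-cancelʳ-≈ c (⟦⟧-injective eq)))

  affineₚ-⊕ : ∀ {n} .{{_ : NonZero n}} a a′ (unit : a′ * a ≈ 1ℤ mod n) c s →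
              Affine (λ x → affineₚ a a′ unit c ⟨$⟩ʳ (x ⊕ s)) a (a * rep s + c)
  affineₚ-⊕ {n} a a′ unit c s x = begin
    rep ⟦ a * rep (x ⊕ s) + c ⟧   ≈⟨ rep-⟦⟧ (a * rep (x ⊕ s) + c) ⟩
    a * rep (x ⊕ s) + c           ≈⟨ +-≈ˡ c (*-≈ʳ a (rep-⊕ x s)) ⟩
    a * (rep x + rep s) + c       ≡⟨ lemma a (rep x) (rep s) c ⟩
    a * rep x + (a * rep s + c)   ∎
    where
    open Mod-Reasoning n
    lemma : ∀ a x s c → a * (x + s) + c ≡ a * x + (a * s + c)
    lemma = solve-∀

  -- Shifts change only the additive constants, which are therefore left unspecified; the
  -- multipliers multiply along the base orbit.
  skew-power : ∀ {n} {J : Set} (B : J → J) (A : J → Fin n → Fin n) g (e : J → ℕ) →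
               (∀ j → ∃ λ c → Affine (A j) (g ^ e j) c) → ∀ k j →
               ∃ λ R → ∃ λ c → (∀ i → fold (i , j) (skew B A) k ≡ (R i , fold j B k)) ×
                 Affine R (g ^ ∑ℕ.sum {k} (λ l → e (fold j B (toℕ l)))) c
  skew-power B A g e affine ℕ.zero j = id , 0ℤ , (λ _ → refl) ,
    λ x → ≈-reflexive (sym (trans (+-identityʳ (1ℤ * rep x)) (*-identityˡ (rep x))))
  skew-power {n} B A g e affine (ℕ.suc k) j
    with c , A-affine ← affine j | R′ , c′ , path , R′-affine ← skew-power B A g e affine k (B j) =
    R′ ∘ A j , g ^ D′ * c + c′ ,
    (λ i → trans (sym (fold-shift (skew B A) (i , j) k)) (trans (path (A j i)) (cong (R′ (A j i) ,_) (fold-shift B j k)))) ,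
    λ x → begin
      rep (R′ (A j x))                              ≈⟨ R′-affine (A j x) ⟩
      g ^ D′ * rep (A j x) + c′                     ≈⟨ +-≈ˡ c′ (*-≈ʳ (g ^ D′) (A-affine x)) ⟩
      g ^ D′ * (g ^ e j * rep x + c) + c′           ≡⟨ lemma (g ^ D′) (g ^ e j) (rep x) c c′ ⟩
      g ^ e j * g ^ D′ * rep x + (g ^ D′ * c + c′)  ≡⟨ cong (λ z → z * rep x + (g ^ D′ * c + c′)) (^-distribˡ-+-* g (e j) D′) ⟨
      g ^ (e j ℕ.+ D′) * rep x + (g ^ D′ * c + c′)  ≡⟨ cong (λ z → g ^ (e j ℕ.+ z) * rep x + (g ^ D′ * c + c′))
                                                         (∑ℕ.sum-cong-≗ {k} (λ l → cong e (fold-shift B j (toℕ l)))) ⟩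
      g ^ ∑ℕ.sum {ℕ.suc k} (λ l → e (fold j B (toℕ l))) * rep x + (g ^ D′ * c + c′) ∎
    where
    open Mod-Reasoning n
    D′ = ∑ℕ.sum {k} (λ l → e (fold (B j) B (toℕ l)))
    lemma : ∀ d a x c c′ → d * (a * x + c) + c′ ≡ a * d * x + (d * c + c′)
    lemma = solve-∀

  two-orbit-cover : ∀ {I J : Set} {B : J → J} {A : J → I → I} {f j₁ L R is is′} →
    (∀ j → j ≡ f ⊎ Reaches B j₁ j) → (∀ j i′ → ∃ λ i → A j i ≡ i′) → B f ≡ f → Covers (A f) is →
    (∀ i → fold (i , j₁) (skew B A) L ≡ (R i , j₁)) → Covers R is′ →
    Covers (skew B A) (map (_, f) is ++ map (_, j₁) is′)
  two-orbit-cover {B = B} {A} {f} {L = L} {is = is} orbits A-surj Bf≡f A-covers return R-covers (i′ , j) with orbits j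
  ... | inj₁ refl    = Any.++⁺ˡ (skew-covers {B = B} {A} {L = 1} A-surj (λ i → cong (A f i ,_) Bf≡f) A-covers (0 , refl) i′)
  ... | inj₂ reaches = Any.++⁺ʳ (map (_, f) is) (skew-covers {B = B} {A} {L = L} A-surj return R-covers reaches i′)

  length-two-orbit : ∀ {I J : Set} {f j₁ : J} (is is′ : List I) {k l} → length is ≡ k → length is′ ≡ l →
                     length (map (_, f) is ++ map (_, j₁) is′) ≡ k ℕ.+ l
  length-two-orbit {f = f} {j₁} is is′ len len′ =
    trans (length-++ (map (_, f) is)) (cong₂ ℕ._+_ (trans (length-map (_, f) is) len) (trans (length-map (_, j₁) is′) len′))

  -- The fibre map applied over j is the one indexed by j ⊕ b₀, so `f-shift` and `visits` record
  -- shifted positions. They have the form of `enumerate` with centre f + b₀ and u = 1; thus the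
  -- fixed point and the long cycle together use every index exactly once.
  record BaseDynamics {M : ℕ} (γ : ℤ) (B : Fin (ℕ.suc M) → Fin (ℕ.suc M)) (b₀ : Fin (ℕ.suc M)) : Set where
    field
      f      : ℤ
      fixed  : B ⟦ f ⟧ ≡ ⟦ f ⟧
      orbits : ∀ j → j ≡ ⟦ f ⟧ ⊎ Reaches B ⟦ f + 1ℤ ⟧ j
      closed : fold ⟦ f + 1ℤ ⟧ B M ≡ ⟦ f + 1ℤ ⟧
      f-shift : ⟦ f ⟧ ⊕ b₀ ≡ ⟦ f + rep b₀ ⟧
      visits : ∀ k → fold ⟦ f + 1ℤ ⟧ B k ⊕ b₀ ≡ ⟦ f + rep b₀ + γ ^ k * 1ℤ ⟧

  base-dynamics : ∀ {M} → Prime (ℕ.suc M) → 2 ℕ.≤ M → ∀ {γ} → IsOrder (ℕ.suc M) γ M →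
                  ∀ γ′ (unit : γ′ * γ ≈ 1ℤ mod ℕ.suc M) b₀ →
                  BaseDynamics γ (λ j → affineₚ γ γ′ unit 0ℤ ⟨$⟩ʳ (j ⊕ b₀)) b₀
  base-dynamics {M} p-prime 2≤M {γ} γ-order γ′ unit b₀
    with f , fixed ← fixed-point p-prime γ (γ * rep b₀ + 0ℤ) (order⇒≉1 2≤M γ-order) = record
    { f = f
    ; fixed = rep-injective (≈-trans (affine ⟦ f ⟧) (≈-trans (+-≈ˡ c (*-≈ʳ γ (rep-⟦⟧ f))) (≈-trans fixed (≈-sym (rep-⟦⟧ f)))))
    ; orbits = affine-primitive-orbits p-prime γ-order {B} f affine fixed
    ; closed = rep-injective (≈-trans (path M) (≈-trans (+-≈ʳ f (*-≈ˡ 1ℤ (power≈1 γ-order))) (≈-sym (rep-⟦⟧ (f + 1ℤ)))))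
    ; f-shift = rep-injective (≈-trans (rep-⊕ ⟦ f ⟧ b₀) (≈-trans (+-≈ˡ (rep b₀) (rep-⟦⟧ f)) (≈-sym (rep-⟦⟧ (f + rep b₀)))))
    ; visits = λ k → rep-injective (begin
        rep (fold ⟦ f + 1ℤ ⟧ B k ⊕ b₀)                  ≈⟨ rep-⊕ (fold ⟦ f + 1ℤ ⟧ B k) b₀ ⟩
        rep (fold ⟦ f + 1ℤ ⟧ B k) + rep b₀              ≈⟨ +-≈ˡ (rep b₀) (path k) ⟩
        f + γ ^ k * 1ℤ + rep b₀                         ≡⟨ lemma f (γ ^ k) (rep b₀) ⟩
        f + rep b₀ + γ ^ k * 1ℤ                         ≈⟨ rep-⟦⟧ (f + rep b₀ + γ ^ k * 1ℤ) ⟨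
        rep {ℕ.suc M} ⟦ f + rep b₀ + γ ^ k * 1ℤ ⟧       ∎)
    }
    where
    open Mod-Reasoning (ℕ.suc M)
    c = γ * rep b₀ + 0ℤ
    B : Fin (ℕ.suc M) → Fin (ℕ.suc M)
    B j = affineₚ γ γ′ unit 0ℤ ⟨$⟩ʳ (j ⊕ b₀)
    affine : Affine B γ c
    affine = affineₚ-⊕ γ γ′ unit 0ℤ b₀
    path : ∀ k → rep (fold ⟦ f + 1ℤ ⟧ B k) ≈ f + γ ^ k * 1ℤ mod ℕ.suc M
    path = affine-fold {P = B} f 1ℤ affine fixed (rep-⟦⟧ (f + 1ℤ))
    lemma : ∀ f x b → f + x * 1ℤ + b ≡ f + b + x * 1ℤ
    lemma = solve-∀

  Affine-cong : ∀ {n} {P : Fin n → Fin n} {a b c} → a ≈ b mod n → Affine P a c → Affine P b c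
  Affine-cong {c = c} a≈b affine x = ≈-trans (affine x) (+-≈ˡ c (*-≈ˡ (rep x) a≈b))

  -- The bound with five cycles

  exponents : ∀ {n} → ℕ → Fin n → ℕ
  exponents ℕ.zero    _       = 1
  exponents (ℕ.suc k) zero    = 2
  exponents (ℕ.suc k) (suc j) = exponents k j

  exponents-1-or-2 : ∀ {n} k (j : Fin n) → exponents k j ≡ 1 ⊎ exponents k j ≡ 2
  exponents-1-or-2 ℕ.zero    j       = inj₁ refl
  exponents-1-or-2 (ℕ.suc k) zero    = inj₂ refl
  exponents-1-or-2 (ℕ.suc k) (suc j) = exponents-1-or-2 k j

  sum-exponents : ∀ {n} k → k ℕ.≤ n → ∑ℕ.sum {n} (exponents k) ≡ k ℕ.+ n
  sum-exponents {ℕ.zero}  ℕ.zero    _           = refl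
  sum-exponents {ℕ.suc n} ℕ.zero    _           = cong ℕ.suc (sum-exponents {n} 0 ℕ.z≤n)
  sum-exponents {ℕ.suc n} (ℕ.suc k) (ℕ.s≤s k≤n) =
    cong ℕ.suc (trans (cong ℕ.suc (sum-exponents {n} k k≤n)) (sym (ℕ.+-suc k n)))

  -- Used with N = q - 1 and 3 + m = p: if k residues get exponent 2 and the others 1, the total k +
  -- p is 3 modulo q - 1. Since k can be as large as q - 1, the base must have enough residues,
  -- whence p ≥ q.
  exponent-count : ∀ N m .{{_ : NonZero N}} → ∃ λ k → k ℕ.≤ N × ∃ λ c → k ℕ.+ (3 ℕ.+ m) ≡ 3 ℕ.+ c ℕ.* N
  exponent-count N m = k , ℕ.m∸n≤m N (m ℕ.% N) , ℕ.suc (m ℕ./ N) , (begin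
    k ℕ.+ (3 ℕ.+ m)                        ≡⟨ cong (λ z → k ℕ.+ (3 ℕ.+ z)) (ℕ.m≡m%n+[m/n]*n m N) ⟩
    k ℕ.+ (3 ℕ.+ (r ℕ.+ (m ℕ./ N) ℕ.* N))  ≡⟨ lemma k r ((m ℕ./ N) ℕ.* N) ⟩
    3 ℕ.+ ((k ℕ.+ r) ℕ.+ (m ℕ./ N) ℕ.* N)  ≡⟨ cong (λ z → 3 ℕ.+ (z ℕ.+ (m ℕ./ N) ℕ.* N)) (ℕ.m∸n+n≡m (ℕ.<⇒≤ (ℕ.m%n<n m N))) ⟩
    3 ℕ.+ (N ℕ.+ (m ℕ./ N) ℕ.* N)          ∎)
    where
    open ≡-Reasoning
    r = m ℕ.% N
    k = N ℕ.∸ r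
    lemma : ∀ k r x → k ℕ.+ (3 ℕ.+ (r ℕ.+ x)) ≡ 3 ℕ.+ ((k ℕ.+ r) ℕ.+ x)
    lemma = solve-∀-ℕ

  -- The multipliers g ^ exponents k j have product g³. So if the fixed point of the base carries g, the
  -- return map of the long cycle has multiplier g², and vice versa: 2 + 3 cycles in either case.
  five-cycles : ∀ {M N} → Prime (ℕ.suc M) → Prime (ℕ.suc N) → 2 ℕ.≤ N → N ℕ.≤ M →
                ℕ.suc N ℕ.* ℕ.suc M ℕ.∸ 5 ℕ.≤ t (ℕ.suc N ℕ.* ℕ.suc M)
  five-cycles {1} {ℕ.suc _} _ _ 2≤N N≤1 = contradiction (ℕ.≤-trans 2≤N N≤1) λ { (ℕ.s≤s ()) }
  five-cycles {ℕ.suc (ℕ.suc M₀)} {ℕ.suc N₀} p-prime q-prime 2≤N N≤M =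
    let γ , γ-order = primitive-root p-prime
        g , g-order = primitive-root q-prime
        k , k≤N , c , k+p≡ = exponent-count N M₀
    in digits-bound {ℕ.suc N} {ℕ.suc M} (affineₚ γ (γ ^ ℕ.suc M₀) (order⇒unit γ-order) 0ℤ)
         (λ j → fibre g g-order (exponents k j))
         λ b₀ s → cover γ γ-order g g-order k c (trans (sum-exponents k (ℕ.≤-trans k≤N (ℕ.≤-trans N≤M (ℕ.n≤1+n _)))) k+p≡) b₀ s
    where
    M N : ℕ
    M = ℕ.suc (ℕ.suc M₀)
    N = ℕ.suc N₀
    2≤M : 2 ℕ.≤ M
    2≤M = ℕ.≤-trans 2≤N N≤M

    fibre : ∀ g → IsOrder (ℕ.suc N) g N → ℕ → Permutation′ (ℕ.suc N)
    fibre g g-order e = affineₚ (g ^ e) ((g ^ N₀) ^ e) (unit-^ g (g ^ N₀) (order⇒unit g-order) e) 0ℤ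

    -- Both primes are at least 3, so subtracting 5 is not truncated.
    9≤ : 9 ℕ.≤ ℕ.suc N ℕ.* ℕ.suc M
    9≤ = ℕ.*-mono-≤ (ℕ.s≤s 2≤N) (ℕ.s≤s 2≤M)

    cover : ∀ γ (γ-order : IsOrder (ℕ.suc M) γ M) g (g-order : IsOrder (ℕ.suc N) g N) k c →
            ∑ℕ.sum {ℕ.suc M} (exponents k) ≡ 3 ℕ.+ c ℕ.* N →
            ∀ b₀ (s : Fin (ℕ.suc M) → Fin (ℕ.suc N)) →
            ∃ λ xs → length xs ℕ.+ (ℕ.suc N ℕ.* ℕ.suc M ℕ.∸ 5) ℕ.≤ ℕ.suc N ℕ.* ℕ.suc M ×
              Covers (skew (λ j → affineₚ γ (γ ^ ℕ.suc M₀) (order⇒unit γ-order) 0ℤ ⟨$⟩ʳ (j ⊕ b₀))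
                           (λ j i → fibre g g-order (exponents k (j ⊕ b₀)) ⟨$⟩ʳ (i ⊕ s j))) xs
    cover γ γ-order g g-order k c total b₀ s = finish
      (exponents-1-or-2 k at-f) (skew-power B A g e′ A-affine M ⟦ f + 1ℤ ⟧)
      where
      B : Fin (ℕ.suc M) → Fin (ℕ.suc M)
      B j = affineₚ γ (γ ^ ℕ.suc M₀) (order⇒unit γ-order) 0ℤ ⟨$⟩ʳ (j ⊕ b₀)
      A : Fin (ℕ.suc M) → Fin (ℕ.suc N) → Fin (ℕ.suc N)
      A j i = fibre g g-order (exponents k (j ⊕ b₀)) ⟨$⟩ʳ (i ⊕ s j)
      open BaseDynamics (base-dynamics p-prime 2≤M γ-order (γ ^ ℕ.suc M₀) (order⇒unit γ-order) b₀)
      f̂ : ℤ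
      f̂ = f + rep b₀
      at-f : Fin (ℕ.suc M)
      at-f = ⟦ f̂ ⟧
      e′ : Fin (ℕ.suc M) → ℕ
      e′ j = exponents k (j ⊕ b₀)
      A-affine : ∀ j → ∃ λ c → Affine (A j) (g ^ e′ j) c
      A-affine j = g ^ e′ j * rep (s j) + 0ℤ ,
        affineₚ-⊕ (g ^ e′ j) ((g ^ N₀) ^ e′ j) (unit-^ g (g ^ N₀) (order⇒unit g-order) (e′ j)) 0ℤ (s j)
      A-surjective : ∀ j i′ → ∃ λ i → A j i ≡ i′
      A-surjective j = ⊕-surjective (fibre g g-order (e′ j)) (s j)
      D : ℕ
      D = ∑ℕ.sum {M} (λ l → e′ (fold ⟦ f + 1ℤ ⟧ B (toℕ l)))

      -- The total is the same for every b₀; the translate only decides which residue is split off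
      -- as the fixed point.
      exponents-sum : exponents k at-f ℕ.+ D ≡ 3 ℕ.+ c ℕ.* N
      exponents-sum = begin
        exponents k at-f ℕ.+ D
          ≡⟨ cong (exponents k at-f ℕ.+_) (∑ℕ.sum-cong-≗ {M} (λ l → cong (exponents k) (visits (toℕ l)))) ⟩
        exponents k at-f ℕ.+ ∑ℕ.sum {M} (λ l → exponents {ℕ.suc M} k ⟦ f̂ + γ ^ toℕ l * 1ℤ ⟧)
          ≡⟨ sum-enumerate ℕ.+-0-commutativeMonoid p-prime f̂ 1ℤ (1≉0 (prime>1 p-prime)) γ-order (exponents k) ⟨
        ∑ℕ.sum {ℕ.suc M} (exponents k)
          ≡⟨ total ⟩
        3 ℕ.+ c ℕ.* N ∎
        where open ≡-Reasoning

      power-D : ∀ a b → exponents k at-f ≡ a → a ℕ.+ b ≡ 3 → g ^ D ≈ g ^ b mod ℕ.suc N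
      power-D a b e≡a a+b≡3 = unit-cancelˡ (g ^ a) ((g ^ N₀) ^ a) (unit-^ g (g ^ N₀) (order⇒unit g-order) a) (begin
        g ^ a * g ^ D          ≡⟨ ^-distribˡ-+-* g a D ⟨
        g ^ (a ℕ.+ D)          ≡⟨ cong (g ^_) (trans (cong (ℕ._+ D) (sym e≡a)) exponents-sum) ⟩
        g ^ (3 ℕ.+ c ℕ.* N)    ≈⟨ ^-mod-order {x = g} {N} (power≈1 g-order) 3 c ⟩
        g ^ 3                  ≡⟨ cong (g ^_) a+b≡3 ⟨
        g ^ (a ℕ.+ b)          ≡⟨ ^-distribˡ-+-* g a b ⟩
        g ^ a * g ^ b          ∎)
        where open Mod-Reasoning (ℕ.suc N)

      A-f-affine : ∀ {a} → exponents k at-f ≡ a → ∃ λ c → Affine (A ⟦ f ⟧) (g ^ a) c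
      A-f-affine e≡a = subst (λ e → ∃ λ c → Affine (A ⟦ f ⟧) (g ^ e) c) (trans (cong (exponents k) f-shift) e≡a) (A-affine ⟦ f ⟧)

      ^1 : g ^ 1 ≈ g mod ℕ.suc N
      ^1 = ≈-reflexive (*-identityʳ g)

      Result : Set
      Result = ∃ λ xs → length xs ℕ.+ (ℕ.suc N ℕ.* ℕ.suc M ℕ.∸ 5) ℕ.≤ ℕ.suc N ℕ.* ℕ.suc M × Covers (skew B A) xs

      assemble : ∀ {R a b} → (∀ i → fold (i , ⟦ f + 1ℤ ⟧) (skew B A) M ≡ (R i , fold ⟦ f + 1ℤ ⟧ B M)) → a ℕ.+ b ≡ 5 →
                 (∃ λ is → length is ≡ a × Covers (A ⟦ f ⟧) is) → (∃ λ is → length is ≡ b × Covers R is) → Result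
      assemble path a+b≡5 (is , len , cov) (is′ , len′ , cov′) =
        map (_, ⟦ f ⟧) is ++ map (_, ⟦ f + 1ℤ ⟧) is′ ,
        ℕ.≤-reflexive (trans (cong (ℕ._+ (ℕ.suc N ℕ.* ℕ.suc M ℕ.∸ 5)) (trans (length-two-orbit is is′ len len′) a+b≡5))
          (ℕ.m+[n∸m]≡n (ℕ.≤-trans (ℕ.m≤m+n 5 4) 9≤))) ,
        two-orbit-cover {B = B} {A} {L = M} orbits A-surjective fixed cov (λ i → trans (path i) (cong (_ ,_) closed)) cov′

      finish : exponents k at-f ≡ 1 ⊎ exponents k at-f ≡ 2 →
               (∃ λ R → ∃ λ c → (∀ i → fold (i , ⟦ f + 1ℤ ⟧) (skew B A) M ≡ (R i , fold ⟦ f + 1ℤ ⟧ B M)) × Affine R (g ^ D) c) →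
               Result
      finish (inj₁ e≡1) (R , _ , path , R-affine) = assemble path refl
        (affine-primitive-cover q-prime 2≤N g-order {A ⟦ f ⟧} (Affine-cong {P = A ⟦ f ⟧} ^1 (proj₂ (A-f-affine e≡1))))
        (affine-square-cover q-prime 2≤N g-order {R} (Affine-cong {P = R} (power-D 1 2 e≡1 refl) R-affine))
      finish (inj₂ e≡2) (R , _ , path , R-affine) = assemble path refl
        (affine-square-cover q-prime 2≤N g-order {A ⟦ f ⟧} (proj₂ (A-f-affine e≡2)))
        (affine-primitive-cover q-prime 2≤N g-order {R} (Affine-cong {P = R} (≈-trans (power-D 2 1 e≡2 refl) ^1) R-affine))

  -- Geometric sums and return maps with constant multiplier

  module ∑ℤ = Sum +-0-commutativeMonoid

  sum-≈ : ∀ {n} k {F G : Fin k → ℤ} → (∀ l → F l ≈ G l mod n) → ∑ℤ.sum F ≈ ∑ℤ.sum G mod n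
  sum-≈ ℕ.zero    eq = ≈-refl
  sum-≈ (ℕ.suc k) eq = +-≈ (eq zero) (sum-≈ k (eq ∘ suc))

  *-distribˡ-sum : ∀ c k (F : Fin k → ℤ) → c * ∑ℤ.sum F ≡ ∑ℤ.sum (λ l → c * F l)
  *-distribˡ-sum c ℕ.zero    F = *-zeroʳ c
  *-distribˡ-sum c (ℕ.suc k) F = trans (*-distribˡ-+ c (F zero) (∑ℤ.sum (F ∘ suc))) (cong (λ z → c * F zero + z) (*-distribˡ-sum c k (F ∘ suc)))

  sum-1 : ∀ k → ∑ℤ.sum {k} (λ _ → 1ℤ) ≡ + k
  sum-1 ℕ.zero    = refl
  sum-1 (ℕ.suc k) = cong (λ z → 1ℤ + z) (sum-1 k)

  geometric-sum : ∀ x k → (x - 1ℤ) * ∑ℤ.sum {k} (λ l → x ^ toℕ l) ≡ x ^ k - 1ℤ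
  geometric-sum x ℕ.zero    = *-zeroʳ (x - 1ℤ)
  geometric-sum x (ℕ.suc k) = begin
    (x - 1ℤ) * (1ℤ + ∑ℤ.sum {k} (λ l → x * x ^ toℕ l))    ≡⟨ cong (λ z → (x - 1ℤ) * (1ℤ + z)) (*-distribˡ-sum x k (λ l → x ^ toℕ l)) ⟨
    (x - 1ℤ) * (1ℤ + x * S)                                ≡⟨ lemma₁ x S ⟩
    x - 1ℤ + x * ((x - 1ℤ) * S)                            ≡⟨ cong (λ z → x - 1ℤ + x * z) (geometric-sum x k) ⟩
    x - 1ℤ + x * (x ^ k - 1ℤ)                              ≡⟨ lemma₂ x (x ^ k) ⟩
    x * x ^ k - 1ℤ                                         ∎
    where
    open ≡-Reasoning
    S = ∑ℤ.sum {k} (λ l → x ^ toℕ l)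
    lemma₁ : ∀ x S → (x - 1ℤ) * (1ℤ + x * S) ≡ x - 1ℤ + x * ((x - 1ℤ) * S)
    lemma₁ = solve-∀
    lemma₂ : ∀ x y → x - 1ℤ + x * (y - 1ℤ) ≡ x * y - 1ℤ
    lemma₂ = solve-∀

  geometric-sum≈0 : ∀ {q} → Prime q → ∀ x k → ¬ x ≈ 1ℤ mod q → x ^ k ≈ 1ℤ mod q → ∑ℤ.sum {k} (λ l → x ^ toℕ l) ≈ 0ℤ mod q
  geometric-sum≈0 q-prime x k x≉1 xᵏ≈1
    with *≈0⇒ q-prime (x - 1ℤ) (∑ℤ.sum {k} (λ l → x ^ toℕ l)) (≈-trans (≈-reflexive (geometric-sum x k)) (≈⇒-≈0 xᵏ≈1))
  ... | inj₁ x-1≈0 = contradiction (-≈0⇒≈ x 1ℤ x-1≈0) x≉1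
  ... | inj₂ S≈0   = S≈0

  -- Pulling out a factor g at every step writes the composite as g^k times a translation, so only a
  -- translation is left when g^k = 1. The constant met at step l enters with weight g^-(l+1).
  skew-translation : ∀ {n} {J : Set} (B : J → J) (A : J → Fin n → Fin n) g g′ → g′ * g ≈ 1ℤ mod n → (c : J → ℤ) →
    (∀ j → Affine (A j) g (c j)) → ∀ k j →
    ∃ λ (R : Fin n → Fin n) → (∀ i → fold (i , j) (skew B A) k ≡ (R i , fold j B k)) ×
      (∀ x → rep (R x) ≈ g ^ k * (rep x + ∑ℤ.sum {k} (λ l → g′ * g′ ^ toℕ l * c (fold j B (toℕ l)))) mod n)
  skew-translation B A g g′ unit c affine ℕ.zero j = id , (λ _ → refl) ,
    λ x → ≈-reflexive (sym (trans (*-identityˡ (rep x + 0ℤ)) (+-identityʳ (rep x))))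
  skew-translation {n} B A g g′ unit c affine (ℕ.suc k) j
    with R′ , path , R′-eq ← skew-translation B A g g′ unit c affine k (B j) =
    R′ ∘ A j ,
    (λ i → trans (sym (fold-shift (skew B A) (i , j) k)) (trans (path (A j i)) (cong (R′ (A j i) ,_) (fold-shift B j k)))) ,
    λ x → begin
      rep (R′ (A j x))                                        ≈⟨ R′-eq (A j x) ⟩
      g ^ k * (rep (A j x) + S′)                              ≈⟨ *-≈ʳ (g ^ k) (+-≈ˡ S′ (affine j x)) ⟩
      g ^ k * (g * rep x + c j + S′)                          ≡⟨ lemma₁ (g ^ k) (g * rep x) (c j) S′ ⟩
      g ^ k * (g * rep x + 1ℤ * (c j + S′))                   ≈⟨ *-≈ʳ (g ^ k) (+-≈ʳ (g * rep x) (*-≈ˡ (c j + S′) unit)) ⟨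
      g ^ k * (g * rep x + g′ * g * (c j + S′))               ≡⟨ lemma₂ (g ^ k) g g′ (rep x) (c j) S′ ⟩
      g * g ^ k * (rep x + (g′ * 1ℤ * c j + g′ * S′))         ≡⟨ cong (λ z → g * g ^ k * (rep x + (g′ * 1ℤ * c j + z))) tail-eq ⟩
      g * g ^ k * (rep x + (g′ * 1ℤ * c j + ∑ℤ.sum {k} (λ l → g′ * g′ ^ ℕ.suc (toℕ l) * c (fold j B (ℕ.suc (toℕ l)))))) ∎
    where
    open Mod-Reasoning n
    S′ = ∑ℤ.sum {k} (λ l → g′ * g′ ^ toℕ l * c (fold (B j) B (toℕ l)))
    lemma₁ : ∀ d x y z → d * (x + y + z) ≡ d * (x + 1ℤ * (y + z))
    lemma₁ = solve-∀
    lemma₂ : ∀ d g g′ x c S → d * (g * x + g′ * g * (c + S)) ≡ g * d * (x + (g′ * 1ℤ * c + g′ * S))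
    lemma₂ = solve-∀
    lemma₃ : ∀ a b c → a * (a * b * c) ≡ a * (a * b) * c
    lemma₃ = solve-∀
    tail-eq : g′ * S′ ≡ ∑ℤ.sum {k} (λ l → g′ * g′ ^ ℕ.suc (toℕ l) * c (fold j B (ℕ.suc (toℕ l))))
    tail-eq = trans (*-distribˡ-sum g′ k _) (∑ℤ.sum-cong-≗ {k} λ l →
      trans (lemma₃ g′ (g′ ^ toℕ l) (c (fold (B j) B (toℕ l)))) (cong (λ z → g′ * g′ ^ ℕ.suc (toℕ l) * c z) (fold-shift B j (toℕ l))))

  inverse-order : ∀ {n γ d} → IsOrder n γ (ℕ.suc d) → IsOrder n (γ ^ d) (ℕ.suc d)
  inverse-order {n} {γ} {d} γ-order = is-order
    (≈-trans (≈-reflexive (^-*-assoc γ d (ℕ.suc d))) (^-≈1-∣ {x = γ} (power≈1 γ-order) (ℕ.n∣m*n d)))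
    (λ k γ′ᵏ≈1 → least γ-order k (begin
      γ ^ k                 ≡⟨ *-identityˡ (γ ^ k) ⟨
      1ℤ * γ ^ k            ≈⟨ *-≈ˡ (γ ^ k) γ′ᵏ≈1 ⟨
      (γ ^ d) ^ k * γ ^ k   ≈⟨ unit-^ γ (γ ^ d) (order⇒unit γ-order) k ⟩
      1ℤ                    ∎))
    where open Mod-Reasoning n

  -- The power γ^k determines k modulo p - 1, hence modulo q - 1. This is what makes the character γ
  -- ↦ g well defined.
  power-transfer : ∀ {p q γ g M N} → IsOrder p γ (ℕ.suc M) → IsOrder q g (ℕ.suc N) → ℕ.suc N ℕ.∣ ℕ.suc M →
                   ∀ k l → γ ^ k ≈ γ ^ l mod p → g ^ k ≈ g ^ l mod q
  power-transfer {p} {q} {γ} {g} {M} {N} γ-order g-order N∣M k l eq =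
    [ (λ k≤l → ≈-sym (go k l k≤l (≈-sym eq))) , (λ l≤k → go l k l≤k eq) ]′ (ℕ.≤-total k l)
    where
    go : ∀ k l → k ℕ.≤ l → γ ^ l ≈ γ ^ k mod p → g ^ l ≈ g ^ k mod q
    go k l k≤l eq = begin
      g ^ l                    ≡⟨ cong (g ^_) (ℕ.m+[n∸m]≡n k≤l) ⟨
      g ^ (k ℕ.+ (l ℕ.∸ k))    ≡⟨ ^-distribˡ-+-* g k (l ℕ.∸ k) ⟩
      g ^ k * g ^ (l ℕ.∸ k)    ≈⟨ *-≈ʳ (g ^ k) (^-≈1-∣ {x = g} (power≈1 g-order) (ℕ.∣-trans N∣M (least γ-order (l ℕ.∸ k)
                                    (unit-^-cancel γ (γ ^ M) (order⇒unit γ-order) k (l ℕ.∸ k)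
                                      (≈-trans (≈-reflexive (cong (γ ^_) (ℕ.m+[n∸m]≡n k≤l))) eq))))) ⟩
      g ^ k * 1ℤ               ≡⟨ *-identityʳ (g ^ k) ⟩
      g ^ k                    ∎
      where open Mod-Reasoning q

  -- Distinct primes p and q with q − 1 ∣ p − 1

  record RootPair (M N : ℕ) : Set where
    field
      p-prime : Prime (2 ℕ.+ M)
      q-prime : Prime (2 ℕ.+ N)
      γ g     : ℤ
      γ-order : IsOrder (2 ℕ.+ M) γ (1 ℕ.+ M)
      g-order : IsOrder (2 ℕ.+ N) g (1 ℕ.+ N)
      1≤N     : 1 ℕ.≤ N
      N∣M     : 1 ℕ.+ N ℕ.∣ 1 ℕ.+ M

  module Character {M N : ℕ} (roots : RootPair M N) where
    open RootPair roots public

    p q : ℕ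
    p = 2 ℕ.+ M
    q = 2 ℕ.+ N

    γ′ g′ : ℤ
    γ′ = γ ^ M
    g′ = g ^ N

    γ′γ≈1 : γ′ * γ ≈ 1ℤ mod p
    γ′γ≈1 = order⇒unit γ-order

    g′g≈1 : g′ * g ≈ 1ℤ mod q
    g′g≈1 = order⇒unit g-order

    -- The character F_p^× → F_q^× sending γ to g, extended by 0.
    χ-dec : (x : Fin p) → Dec (rep x ≈ 0ℤ mod p) → ℤ
    χ-dec x (yes _)   = 0ℤ
    χ-dec x (no  x≉0) = g ^ proj₁ (discrete-log p-prime γ-order (rep x) x≉0)

    χ : Fin p → ℤ
    χ x = χ-dec x (rep x ≈0?mod p)

    χ-zero : ∀ x → rep x ≈ 0ℤ mod p → χ x ≡ 0ℤ
    χ-zero x x≈0 with rep x ≈0?mod p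
    ... | yes _   = refl
    ... | no  x≉0 = contradiction x≈0 x≉0

    χ-power : ∀ x l → rep x ≈ γ ^ l mod p → χ x ≈ g ^ l mod q
    χ-power x l x≈γˡ with rep x ≈0?mod p
    ... | yes x≈0 = contradiction (≈-trans (≈-sym x≈γˡ) x≈0) (^≉0 p-prime (order⇒≉0 p-prime γ-order) l)
    ... | no  x≉0 = let k , γᵏ≈x = discrete-log p-prime γ-order (rep x) x≉0 in
      power-transfer γ-order g-order N∣M k l (≈-trans γᵏ≈x x≈γˡ)

    χ-* : ∀ x y l → rep y ≈ γ ^ l * rep x mod p → χ y ≈ g ^ l * χ x mod q
    χ-* x y l y≈ = decide (rep x ≈0?mod p)
      where
      decide : Dec (rep x ≈ 0ℤ mod p) → χ y ≈ g ^ l * χ x mod q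
      decide (yes x≈0) = ≈-reflexive (trans
        (χ-zero y (≈-trans y≈ (≈-trans (*-≈ʳ (γ ^ l) x≈0) (≈-reflexive (*-zeroʳ (γ ^ l))))))
        (sym (trans (cong (g ^ l *_) (χ-zero x x≈0)) (*-zeroʳ (g ^ l)))))
      decide (no x≉0) =
        let k , γᵏ≈x = discrete-log p-prime γ-order (rep x) x≉0 in begin
        χ y            ≈⟨ χ-power y (l ℕ.+ k) (≈-trans y≈ (≈-trans (*-≈ʳ (γ ^ l) (≈-sym γᵏ≈x)) (≈-reflexive (sym (^-distribˡ-+-* γ l k))))) ⟩
        g ^ (l ℕ.+ k)  ≡⟨ ^-distribˡ-+-* g l k ⟩
        g ^ l * g ^ k  ≈⟨ *-≈ʳ (g ^ l) (χ-power x k (≈-sym γᵏ≈x)) ⟨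
        g ^ l * χ x    ∎
        where open Mod-Reasoning q

    χ-one : χ ⟦ 1ℤ ⟧ ≈ 1ℤ mod q
    χ-one = χ-power ⟦ 1ℤ ⟧ 0 (rep-⟦⟧ 1ℤ)

    -- The character is non-trivial: g ≠ 1 because q ≥ 3. So the geometric sum of its values
    -- vanishes.
    sum-χ : ∑ℤ.sum χ ≈ 0ℤ mod q
    sum-χ = begin
      ∑ℤ.sum χ
        ≡⟨ sum-enumerate +-0-commutativeMonoid p-prime 0ℤ 1ℤ (1≉0 (prime>1 p-prime)) γ-order χ ⟩
      χ ⟦ 0ℤ ⟧ + ∑ℤ.sum {1 ℕ.+ M} (λ l → χ ⟦ 0ℤ + γ ^ toℕ l * 1ℤ ⟧)
        ≈⟨ +-≈ (≈-reflexive (χ-zero ⟦ 0ℤ ⟧ (rep-⟦⟧ 0ℤ))) (sum-≈ (1 ℕ.+ M) λ l →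
             χ-power ⟦ 0ℤ + γ ^ toℕ l * 1ℤ ⟧ (toℕ l) (≈-trans (rep-⟦⟧ (0ℤ + γ ^ toℕ l * 1ℤ)) (≈-reflexive (lemma (γ ^ toℕ l))))) ⟩
      0ℤ + ∑ℤ.sum {1 ℕ.+ M} (λ l → g ^ toℕ l)
        ≈⟨ +-≈ʳ 0ℤ (geometric-sum≈0 q-prime g (1 ℕ.+ M) (order⇒≉1 (ℕ.s≤s 1≤N) g-order) (^-≈1-∣ {x = g} (power≈1 g-order) N∣M)) ⟩
      0ℤ ∎
      where
      open Mod-Reasoning q
      lemma : ∀ x → 0ℤ + x * 1ℤ ≡ x
      lemma = solve-∀

    -- A Jacobi sum: by twist, the term for l is g⁻ˡ χ(w + γˡ).
    J : ℤ → ℤ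
    J w = ∑ℤ.sum {1 ℕ.+ M} (λ l → χ ⟦ 1ℤ + γ′ ^ toℕ l * w ⟧)

    J-zero : ∀ w → w ≈ 0ℤ mod p → J w ≈ + (1 ℕ.+ M) mod q
    J-zero w w≈0 = ≈-trans (sum-≈ (1 ℕ.+ M) λ l →
        χ-power ⟦ 1ℤ + γ′ ^ toℕ l * w ⟧ 0 (≈-trans (rep-⟦⟧ (1ℤ + γ′ ^ toℕ l * w)) (≈-trans (+-≈ʳ 1ℤ (*-≈ʳ (γ′ ^ toℕ l) w≈0)) (≈-reflexive (lemma (γ′ ^ toℕ l))))))
      (≈-reflexive (sum-1 (1 ℕ.+ M)))
      where
      lemma : ∀ x → 1ℤ + x * 0ℤ ≡ 1ℤ
      lemma = solve-∀

    -- The points 1 + γ⁻ˡ w run through all residues except 1, so J w is the full sum 0 of χ minus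
    -- χ(1) = 1.
    J-nonzero : ∀ w → ¬ w ≈ 0ℤ mod p → J w ≈ -1ℤ mod q
    J-nonzero w w≉0 = +-cancelˡ-≈ 1ℤ (begin
      1ℤ + J w          ≈⟨ +-≈ˡ (J w) χ-one ⟨
      χ ⟦ 1ℤ ⟧ + J w    ≡⟨ sum-enumerate +-0-commutativeMonoid p-prime 1ℤ w w≉0 (inverse-order γ-order) χ ⟨
      ∑ℤ.sum χ          ≈⟨ sum-χ ⟩
      0ℤ                ∎)
      where open Mod-Reasoning q

    -- The factor g⁻ˡ is χ(γ⁻ˡ), which multiplicativity brings inside χ.
    twist : ∀ w x l → rep x ≈ w + γ ^ l mod p → g′ ^ l * χ x ≈ χ ⟦ 1ℤ + γ′ ^ l * w ⟧ mod q
    twist w x l x≈ = begin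
      g′ ^ l * χ x               ≈⟨ *-≈ʳ (g′ ^ l) (χ-* y x l x≈γˡy) ⟩
      g′ ^ l * (g ^ l * χ y)     ≡⟨ *-assoc (g′ ^ l) (g ^ l) (χ y) ⟨
      g′ ^ l * g ^ l * χ y       ≈⟨ *-≈ˡ (χ y) (unit-^ g g′ g′g≈1 l) ⟩
      1ℤ * χ y                   ≡⟨ *-identityˡ (χ y) ⟩
      χ y                        ∎
      where
      open Mod-Reasoning q
      y : Fin p
      y = ⟦ 1ℤ + γ′ ^ l * w ⟧
      lemma : ∀ a b w → a * (1ℤ + b * w) ≡ b * a * w + a
      lemma = solve-∀
      x≈γˡy : rep x ≈ γ ^ l * rep y mod p
      x≈γˡy = ≈-sym (≈-trans (*-≈ʳ (γ ^ l) (rep-⟦⟧ (1ℤ + γ′ ^ l * w)))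
        (≈-trans (≈-reflexive (lemma (γ ^ l) (γ′ ^ l) w))
          (≈-trans (+-≈ˡ (γ ^ l) (≈-trans (*-≈ˡ w (unit-^ γ γ′ γ′γ≈1 l)) (≈-reflexive (*-identityˡ w)))) (≈-sym x≈))))

    -1≉0 : ¬ -1ℤ ≈ 0ℤ mod q
    -1≉0 eq = 1≉0 (prime>1 q-prime) (∣⇒≈0 (≈0⇒∣ eq))

    -2≉0 : ¬ - + 2 ≈ 0ℤ mod q
    -2≉0 eq = ℕ.<⇒≱ (ℕ.s≤s (ℕ.s≤s 1≤N)) (ℕ.∣⇒≤ (≈0⇒∣ eq))

    -- J is p - 1 at 0 and -1 elsewhere, so ε = 0 works unless q ∣ p - 1. In that case J vanishes at
    -- 0 only; adding its translate by 1 gives -1 at 0 and at 1 and -2 elsewhere, which is non-zero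
    -- because q ≥ 3.
    nonvanishing : ∃ λ ε → ∀ w → ¬ J w + ε * J (w - 1ℤ) ≈ 0ℤ mod q
    nonvanishing = choose (+ (1 ℕ.+ M) ≈0?mod q)
      where
      choose : Dec (+ (1 ℕ.+ M) ≈ 0ℤ mod q) → ∃ λ ε → ∀ w → ¬ J w + ε * J (w - 1ℤ) ≈ 0ℤ mod q
      choose (no M≉0) = 0ℤ , λ w eq → J≉0 w (≈-trans (≈-reflexive (sym (lemma (J w) (J (w - 1ℤ))))) eq) (w ≈0?mod p)
        where
        lemma : ∀ x y → x + 0ℤ * y ≡ x
        lemma = solve-∀
        J≉0 : ∀ w → J w ≈ 0ℤ mod q → ¬ Dec (w ≈ 0ℤ mod p)
        J≉0 w eq (yes w≈0) = M≉0 (≈-trans (≈-sym (J-zero w w≈0)) eq)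
        J≉0 w eq (no  w≉0) = -1≉0 (≈-trans (≈-sym (J-nonzero w w≉0)) eq)
      choose (yes M≈0) = 1ℤ , λ w eq → both w (≈-trans (≈-reflexive (cong (λ z → J w + z) (sym (*-identityˡ (J (w - 1ℤ)))))) eq)
          (w ≈0?mod p) ((w - 1ℤ) ≈0?mod p)
        where
        both : ∀ w → J w + J (w - 1ℤ) ≈ 0ℤ mod q → Dec (w ≈ 0ℤ mod p) → ¬ Dec (w - 1ℤ ≈ 0ℤ mod p)
        both w eq (yes w≈0) (yes w≈1) = 1≉0 (prime>1 p-prime) (≈-trans (≈-sym (-≈0⇒≈ w 1ℤ w≈1)) w≈0)
        both w eq (yes w≈0) (no  w≉1) = -1≉0 (≈-trans (≈-sym (+-≈ (≈-trans (J-zero w w≈0) M≈0) (J-nonzero (w - 1ℤ) w≉1))) eq)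
        both w eq (no  w≉0) (yes w≈1) = -1≉0 (≈-trans (≈-sym (+-≈ (J-nonzero w w≉0) (≈-trans (J-zero (w - 1ℤ) w≈1) M≈0))) eq)
        both w eq (no  w≉0) (no  w≉1) = -2≉0 (≈-trans (≈-sym (+-≈ (J-nonzero w w≉0) (J-nonzero (w - 1ℤ) w≉1))) eq)

    -- By nonvanishing, this choice of c makes the return map of the long cycle a nonzero translation for
    -- every shift; the summand ε is needed only when q ∣ p − 1.
    three-cycles-coprime : 1 ℕ.≤ M → Coprime q p → q ℕ.* p ℕ.∸ 3 ℕ.≤ t (q ℕ.* p)
    three-cycles-coprime 1≤M q⊥p = crt-bound q⊥p β α cover
      where
      ε : ℤ
      ε = proj₁ nonvanishing

      c : Fin p → ℤ
      c z = χ z + ε * χ ⟦ rep z - 1ℤ ⟧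

      β : Permutation′ p
      β = affineₚ γ γ′ γ′γ≈1 0ℤ

      α : Fin p → Permutation′ q
      α j = affineₚ g g′ g′g≈1 (c j)

      9≤ : 9 ℕ.≤ q ℕ.* p
      9≤ = ℕ.*-mono-≤ (ℕ.s≤s (ℕ.s≤s 1≤N)) (ℕ.s≤s (ℕ.s≤s 1≤M))

      cover : ∀ b₀ b₁ → ∃ λ xs → length xs ℕ.+ (q ℕ.* p ℕ.∸ 3) ℕ.≤ q ℕ.* p ×
                Covers (skew (λ j → β ⟨$⟩ʳ (j ⊕ b₀)) (λ j i → α (j ⊕ b₀) ⟨$⟩ʳ (i ⊕ b₁))) xs
      cover b₀ b₁ = finish
        (affine-primitive-cover q-prime (ℕ.s≤s 1≤N) g-order {A ⟦ f ⟧} (A-affine ⟦ f ⟧))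
        (skew-translation B A g g′ g′g≈1 const A-affine (1 ℕ.+ M) ⟦ f + 1ℤ ⟧)
        where
        B : Fin p → Fin p
        B j = β ⟨$⟩ʳ (j ⊕ b₀)
        A : Fin p → Fin q → Fin q
        A j i = α (j ⊕ b₀) ⟨$⟩ʳ (i ⊕ b₁)
        open BaseDynamics (base-dynamics p-prime (ℕ.s≤s 1≤M) γ-order γ′ γ′γ≈1 b₀)
        const : Fin p → ℤ
        const j = g * rep b₁ + c (j ⊕ b₀)
        A-affine : ∀ j → Affine (A j) g (const j)
        A-affine j = affineₚ-⊕ g g′ g′g≈1 (c (j ⊕ b₀)) b₁
        A-surjective : ∀ j i′ → ∃ λ i → A j i ≡ i′
        A-surjective j = ⊕-surjective (α (j ⊕ b₀)) b₁
        f̂ : ℤ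
        f̂ = f + rep b₀
        z : Fin (1 ℕ.+ M) → Fin p
        z l = fold ⟦ f + 1ℤ ⟧ B (toℕ l) ⊕ b₀
        z≈ : ∀ l → rep (z l) ≈ f̂ + γ ^ toℕ l mod p
        z≈ l = ≈-trans (≈-reflexive (cong rep (visits (toℕ l))))
          (≈-trans (rep-⟦⟧ (f̂ + γ ^ toℕ l * 1ℤ)) (≈-reflexive (cong (λ y → f̂ + y) (*-identityʳ (γ ^ toℕ l)))))

        Θ : ℤ
        Θ = ∑ℤ.sum {1 ℕ.+ M} (λ l → g′ * g′ ^ toℕ l * const (fold ⟦ f + 1ℤ ⟧ B (toℕ l)))

        -- The weights in Θ are g^-(l+1); the factor g reduces them to g⁻ˡ, as `twist` needs.
        term : ∀ l → g * (g′ * g′ ^ toℕ l * (g * rep b₁ + c (z l))) ≈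
                     g * rep b₁ * g′ ^ toℕ l + (χ ⟦ 1ℤ + γ′ ^ toℕ l * f̂ ⟧ + ε * χ ⟦ 1ℤ + γ′ ^ toℕ l * (f̂ - 1ℤ) ⟧) mod q
        term l = begin
          g * (g′ * g′ ^ toℕ l * (g * rep b₁ + c (z l)))
            ≡⟨ lemma₁ g g′ (g′ ^ toℕ l) (g * rep b₁ + c (z l)) ⟩
          g′ * g * (g′ ^ toℕ l * (g * rep b₁ + c (z l)))
            ≈⟨ *-≈ˡ (g′ ^ toℕ l * (g * rep b₁ + c (z l))) g′g≈1 ⟩
          1ℤ * (g′ ^ toℕ l * (g * rep b₁ + c (z l)))
            ≡⟨ lemma₂ (g′ ^ toℕ l) (g * rep b₁) (χ (z l)) ε (χ ⟦ rep (z l) - 1ℤ ⟧) ⟩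
          g * rep b₁ * g′ ^ toℕ l + (g′ ^ toℕ l * χ (z l) + ε * (g′ ^ toℕ l * χ ⟦ rep (z l) - 1ℤ ⟧))
            ≈⟨ +-≈ʳ (g * rep b₁ * g′ ^ toℕ l) (+-≈ (twist f̂ (z l) (toℕ l) (z≈ l))
                 (*-≈ʳ ε (twist (f̂ - 1ℤ) ⟦ rep (z l) - 1ℤ ⟧ (toℕ l) (≈-trans (rep-⟦⟧ (rep (z l) - 1ℤ))
                   (≈-trans (+-≈ˡ -1ℤ (z≈ l)) (≈-reflexive (lemma₃ f̂ (γ ^ toℕ l)))))))) ⟩
          g * rep b₁ * g′ ^ toℕ l + (χ ⟦ 1ℤ + γ′ ^ toℕ l * f̂ ⟧ + ε * χ ⟦ 1ℤ + γ′ ^ toℕ l * (f̂ - 1ℤ) ⟧) ∎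
          where
          open Mod-Reasoning q
          lemma₁ : ∀ g g′ x y → g * (g′ * x * y) ≡ g′ * g * (x * y)
          lemma₁ = solve-∀
          lemma₂ : ∀ x y a ε b → 1ℤ * (x * (y + (a + ε * b))) ≡ y * x + (x * a + ε * (x * b))
          lemma₂ = solve-∀
          lemma₃ : ∀ f x → f + x + -1ℤ ≡ f - 1ℤ + x
          lemma₃ = solve-∀

        gΘ≈ : g * Θ ≈ J f̂ + ε * J (f̂ - 1ℤ) mod q
        gΘ≈ = begin
          g * Θ
            ≡⟨ *-distribˡ-sum g (1 ℕ.+ M) (λ l → g′ * g′ ^ toℕ l * const (fold ⟦ f + 1ℤ ⟧ B (toℕ l))) ⟩
          ∑ℤ.sum (λ l → g * (g′ * g′ ^ toℕ l * (g * rep b₁ + c (z l))))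
            ≈⟨ sum-≈ (1 ℕ.+ M) term ⟩
          ∑ℤ.sum (λ l → g * rep b₁ * v l + (u l + ε * u′ l))
            ≡⟨ ∑ℤ.∑-distrib-+ (λ l → g * rep b₁ * v l) (λ l → u l + ε * u′ l) ⟩
          ∑ℤ.sum (λ l → g * rep b₁ * v l) + ∑ℤ.sum (λ l → u l + ε * u′ l)
            ≡⟨ cong₂ _+_ (sym (*-distribˡ-sum (g * rep b₁) (1 ℕ.+ M) v))
                 (trans (∑ℤ.∑-distrib-+ u (λ l → ε * u′ l)) (cong (λ y → J f̂ + y) (sym (*-distribˡ-sum ε (1 ℕ.+ M) u′)))) ⟩
          -- The shift b₁ meets the sum of the powers of g⁻¹ over p - 1 terms, which vanishes since
          -- q - 1 ∣ p - 1.
          g * rep b₁ * ∑ℤ.sum v + (J f̂ + ε * J (f̂ - 1ℤ))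
            ≈⟨ +-≈ˡ (J f̂ + ε * J (f̂ - 1ℤ)) (*-≈ʳ (g * rep b₁) (geometric-sum≈0 q-prime g′ (1 ℕ.+ M)
                 (order⇒≉1 (ℕ.s≤s 1≤N) (inverse-order g-order)) (^-≈1-∣ {x = g′} (power≈1 (inverse-order g-order)) N∣M))) ⟩
          g * rep b₁ * 0ℤ + (J f̂ + ε * J (f̂ - 1ℤ))
            ≡⟨ trans (cong (λ y → y + (J f̂ + ε * J (f̂ - 1ℤ))) (*-zeroʳ (g * rep b₁))) (+-identityˡ (J f̂ + ε * J (f̂ - 1ℤ))) ⟩
          J f̂ + ε * J (f̂ - 1ℤ) ∎
          where
          open Mod-Reasoning q
          u u′ v : Fin (1 ℕ.+ M) → ℤ
          u l  = χ ⟦ 1ℤ + γ′ ^ toℕ l * f̂ ⟧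
          u′ l = χ ⟦ 1ℤ + γ′ ^ toℕ l * (f̂ - 1ℤ) ⟧
          v l  = g′ ^ toℕ l

        Θ≉0 : ¬ Θ ≈ 0ℤ mod q
        Θ≉0 Θ≈0 = proj₂ nonvanishing f̂ (≈-trans (≈-sym gΘ≈) (≈-trans (*-≈ʳ g Θ≈0) (≈-reflexive (*-zeroʳ g))))

        finish : (∃ λ is → length is ≡ 2 × Covers (A ⟦ f ⟧) is) →
                 (∃ λ (R : Fin q → Fin q) → (∀ i → fold (i , ⟦ f + 1ℤ ⟧) (skew B A) (1 ℕ.+ M) ≡ (R i , fold ⟦ f + 1ℤ ⟧ B (1 ℕ.+ M))) ×
                   (∀ x → rep (R x) ≈ g ^ (1 ℕ.+ M) * (rep x + Θ) mod q)) →
                 ∃ λ xs → length xs ℕ.+ (q ℕ.* p ℕ.∸ 3) ℕ.≤ q ℕ.* p × Covers (skew B A) xs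
        finish (is , len , cov) (R , path , R-eq) =
          map (_, ⟦ f ⟧) is ++ map (_, ⟦ f + 1ℤ ⟧) (zero ∷ []) ,
          ℕ.≤-reflexive (trans (cong (ℕ._+ (q ℕ.* p ℕ.∸ 3)) (length-two-orbit is (zero ∷ []) len refl))
            (ℕ.m+[n∸m]≡n (ℕ.≤-trans (ℕ.m≤m+n 3 6) 9≤))) ,
          two-orbit-cover {B = B} {A} {L = 1 ℕ.+ M} orbits A-surjective fixed cov (λ i → trans (path i) (cong (R i ,_) closed))
            (translation-cover q-prime {R} Θ≉0 λ x → ≈-trans (R-eq x)
              (≈-trans (*-≈ˡ (rep x + Θ) (^-≈1-∣ {x = g} (power≈1 g-order) N∣M)) (≈-reflexive (*-identityˡ (rep x + Θ)))))

  -- The case p = q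

  coprime-square : ∀ {p m} → Prime p → ¬ p ℕ.∣ m → Coprime m (p ℕ.* p)
  coprime-square p-prime p∤m (d∣m , d∣p²) =
    d⊥p (ℕ.∣-refl , coprime-divisor d⊥p d∣p²)
    where
    d⊥p : Coprime _ _
    d⊥p = prime-coprime p-prime (λ p∣d → p∤m (ℕ.∣-trans p∣d d∣m))

  ≉0⇒unit-p² : ∀ {p} → Prime p → ∀ a → ¬ a ≈ 0ℤ mod p → ∃ λ a′ → a′ * a ≈ 1ℤ mod (p ℕ.* p)
  ≉0⇒unit-p² p-prime a a≉0 = coprime⇒unit a (coprime-square p-prime (λ p∣a → a≉0 (∣⇒≈0 p∣a)))

  -- The binomial expansion, cut off by z² = 0. It is applied with z = p, to change the primitive
  -- root, and with z = T p, to raise 1 + T p to a power.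
  first-order : ∀ {n z} → z * z ≈ 0ℤ mod n → ∀ x k → (x + z) ^ ℕ.suc k ≈ x ^ ℕ.suc k + + ℕ.suc k * x ^ k * z mod n
  first-order {n} {z} z²≈0 x ℕ.zero = ≈-reflexive (lemma x z)
    where
    lemma : ∀ x z → (x + z) * 1ℤ ≡ x * 1ℤ + 1ℤ * 1ℤ * z
    lemma = solve-∀
  first-order {n} {z} z²≈0 x (ℕ.suc k) = begin
    (x + z) * (x + z) ^ ℕ.suc k
      ≈⟨ *-≈ʳ (x + z) (first-order z²≈0 x k) ⟩
    (x + z) * (x * x ^ k + K * x ^ k * z)
      ≡⟨ lemma x z (x ^ k) K ⟩
    (x * (x * x ^ k) + (1ℤ + K) * (x * x ^ k) * z) + K * x ^ k * (z * z)
      ≈⟨ +-≈ʳ (x * (x * x ^ k) + (1ℤ + K) * (x * x ^ k) * z) (*-≈ʳ (K * x ^ k) z²≈0) ⟩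
    (x * (x * x ^ k) + (1ℤ + K) * (x * x ^ k) * z) + K * x ^ k * 0ℤ
      ≡⟨ trans (cong (λ y → (x * (x * x ^ k) + (1ℤ + K) * (x * x ^ k) * z) + y) (*-zeroʳ (K * x ^ k))) (+-identityʳ _) ⟩
    x * (x * x ^ k) + (1ℤ + K) * (x * x ^ k) * z ∎
    where
    open Mod-Reasoning n
    K = + ℕ.suc k
    lemma : ∀ x z y K → (x + z) * (x * y + K * y * z) ≡ (x * (x * y) + (1ℤ + K) * (x * y) * z) + K * y * (z * z)
    lemma = solve-∀

  p²≈0 : ∀ p → + p * + p ≈ 0ℤ mod (p ℕ.* p)
  p²≈0 p = ≈-trans (≈-reflexive (sym (pos-* p p))) (n≈0 (p ℕ.* p))

  scale-≈ʳ : ∀ {n a b} m → a ≈ b mod n → a * + m ≈ b * + m mod (n ℕ.* m)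
  scale-≈ʳ {a = a} {b} m a≈b = ≈-trans (≈-reflexive (*-comm a (+ m))) (≈-trans (scale-≈ m a≈b) (≈-reflexive (*-comm (+ m) b)))

  order-cong : ∀ {n a b d} → a ≈ b mod n → IsOrder n a d → IsOrder n b d
  order-cong {d = d} a≈b a-order = is-order
    (≈-trans (^-≈ d (≈-sym a≈b)) (power≈1 a-order))
    (λ k bᵏ≈1 → least a-order k (≈-trans (^-≈ k a≈b) bᵏ≈1))

  opaque
    -- T is the Fermat quotient; T ≢ 0 is what lets g remain a primitive root modulo p². If γ has T
    -- ≡ 0, then γ + p works: its quotient is (p - 1) γ^(p-2) modulo p, which is not 0.
    primitive-root-p² : ∀ {N} → Prime (2 ℕ.+ N) → ∃ λ g → ∃ λ T → IsOrder (2 ℕ.+ N) g (1 ℕ.+ N) ×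
      ¬ T ≈ 0ℤ mod 2 ℕ.+ N × g ^ (1 ℕ.+ N) ≈ 1ℤ + T * + (2 ℕ.+ N) mod ((2 ℕ.+ N) ℕ.* (2 ℕ.+ N))
    primitive-root-p² {N} p-prime = lift (primitive-root p-prime)
      where
      p : ℕ
      p = 2 ℕ.+ N
      Goal : Set
      Goal = ∃ λ g → ∃ λ T → IsOrder p g (1 ℕ.+ N) × ¬ T ≈ 0ℤ mod p × g ^ (1 ℕ.+ N) ≈ 1ℤ + T * + p mod (p ℕ.* p)
      lift : (∃ λ γ → IsOrder p γ (1 ℕ.+ N)) → Goal
      lift (γ , γ-order) = decide (power≈1 γ-order)
        where
        decide : γ ^ (1 ℕ.+ N) ≈ 1ℤ mod p → Goal
        decide (congruent T γᴺ≡) = choose (T ≈0?mod p)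
          where
          choose : Dec (T ≈ 0ℤ mod p) → Goal
          choose (no  T≉0) = γ , T , γ-order , T≉0 , ≈-reflexive γᴺ≡
          choose (yes T≈0) = γ + + p , T′ , order-cong γ≈γ+p γ-order , T′≉0 , power
            where
            T′ : ℤ
            T′ = + (1 ℕ.+ N) * γ ^ N
            γ≈γ+p : γ ≈ γ + + p mod p
            γ≈γ+p = ≈-trans (≈-reflexive (sym (+-identityʳ γ))) (+-≈ʳ γ (≈-sym (n≈0 p)))
            T′≉0 : ¬ T′ ≈ 0ℤ mod p
            T′≉0 = *≉0 p-prime (+ (1 ℕ.+ N)) (γ ^ N)
              (λ eq → contradiction (small-≈⇒≡ (ℕ.n<1+n (1 ℕ.+ N)) ℕ.z<s eq) λ ())
              (^≉0 p-prime (order⇒≉0 p-prime γ-order) N)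
            power : (γ + + p) ^ (1 ℕ.+ N) ≈ 1ℤ + T′ * + p mod (p ℕ.* p)
            power = begin
              (γ + + p) ^ (1 ℕ.+ N)           ≈⟨ first-order (p²≈0 p) γ N ⟩
              γ ^ (1 ℕ.+ N) + T′ * + p        ≡⟨ cong (λ y → y + T′ * + p) γᴺ≡ ⟩
              1ℤ + T * + p + T′ * + p         ≈⟨ +-≈ˡ (T′ * + p) (+-≈ʳ 1ℤ (scale-≈ʳ p T≈0)) ⟩
              1ℤ + T′ * + p                   ∎
              where open Mod-Reasoning (p ℕ.* p)

  -- Lifts a logarithm k modulo p. Write u = g^k + w p; multiplying g^k by (1 + T p)^L adds L T g^k
  -- p, so it remains to solve L T g^k ≡ w modulo p, where T g^k is invertible.
  discrete-log-p² : ∀ {N g T} → Prime (2 ℕ.+ N) → IsOrder (2 ℕ.+ N) g (1 ℕ.+ N) → ¬ T ≈ 0ℤ mod 2 ℕ.+ N →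
    g ^ (1 ℕ.+ N) ≈ 1ℤ + T * + (2 ℕ.+ N) mod ((2 ℕ.+ N) ℕ.* (2 ℕ.+ N)) →
    ∀ u → ¬ u ≈ 0ℤ mod 2 ℕ.+ N → ∃ λ k → g ^ k ≈ u mod ((2 ℕ.+ N) ℕ.* (2 ℕ.+ N))
  discrete-log-p² {N} {g} {T} p-prime g-order T≉0 gᴺ≈ u u≉0 =
    let k , gᵏ≈u = discrete-log p-prime g-order u u≉0 in lift k (≈-sym gᵏ≈u)
    where
    p : ℕ
    p = 2 ℕ.+ N
    lift : ∀ k → u ≈ g ^ k mod p → ∃ λ k → g ^ k ≈ u mod (p ℕ.* p)
    lift k (congruent w u≡) =
      let v , unit = prime⇒unit p-prime {g ^ k * T} (*≉0 p-prime (g ^ k) T (^≉0 p-prime (order⇒≉0 p-prime g-order) k) T≉0) in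
      solve v unit
      where
      solve : ∀ v → v * (g ^ k * T) ≈ 1ℤ mod p → ∃ λ k → g ^ k ≈ u mod (p ℕ.* p)
      solve v unit = k ℕ.+ (1 ℕ.+ N) ℕ.* ℕ.suc l , (begin
        g ^ (k ℕ.+ (1 ℕ.+ N) ℕ.* ℕ.suc l)
          ≡⟨ trans (^-distribˡ-+-* g k ((1 ℕ.+ N) ℕ.* ℕ.suc l)) (cong (g ^ k *_) (sym (^-*-assoc g (1 ℕ.+ N) (ℕ.suc l)))) ⟩
        g ^ k * (g ^ (1 ℕ.+ N)) ^ ℕ.suc l
          ≈⟨ *-≈ʳ (g ^ k) (^-≈ (ℕ.suc l) gᴺ≈) ⟩
        g ^ k * (1ℤ + T * + p) ^ ℕ.suc l
          ≈⟨ *-≈ʳ (g ^ k) (first-order Tp²≈0 1ℤ l) ⟩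
        g ^ k * (1ℤ ^ ℕ.suc l + + ℕ.suc l * 1ℤ ^ l * (T * + p))
          ≡⟨ cong₂ (λ x y → g ^ k * (x + + ℕ.suc l * y * (T * + p))) (^-zeroˡ (ℕ.suc l)) (^-zeroˡ l) ⟩
        g ^ k * (1ℤ + + ℕ.suc l * 1ℤ * (T * + p))
          ≡⟨ lemma₁ (g ^ k) (+ ℕ.suc l) T (+ p) ⟩
        g ^ k + + ℕ.suc l * (g ^ k * T) * + p
          ≈⟨ +-≈ʳ (g ^ k) (scale-≈ʳ p l-solves) ⟩
        g ^ k + w * + p
          ≡⟨ u≡ ⟨
        u ∎)
        where
        open Mod-Reasoning (p ℕ.* p)
        -- The exponent L is `suc l`, because `first-order` is stated for positive exponents; this
        -- explains the -1.
        l : ℕ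
        l = toℕ (⟦_⟧ {p} (w * v - 1ℤ))
        lemma₁ : ∀ x l T p → x * (1ℤ + l * 1ℤ * (T * p)) ≡ x + l * (x * T) * p
        lemma₁ = solve-∀
        lemma₂ : ∀ T p → T * p * (T * p) ≡ T * T * (p * p)
        lemma₂ = solve-∀
        lemma₃ : ∀ w v → 1ℤ + (w * v - 1ℤ) ≡ w * v
        lemma₃ = solve-∀
        Tp²≈0 : T * + p * (T * + p) ≈ 0ℤ mod (p ℕ.* p)
        Tp²≈0 = ≈-trans (≈-reflexive (lemma₂ T (+ p))) (≈-trans (*-≈ʳ (T * T) (p²≈0 p)) (≈-reflexive (*-zeroʳ (T * T))))
        l-solves : + ℕ.suc l * (g ^ k * T) ≈ w mod p
        l-solves = ≈-trans (*-≈ˡ (g ^ k * T) (≈-trans (+-≈ʳ 1ℤ (rep-⟦⟧ (w * v - 1ℤ))) (≈-reflexive (lemma₃ w v))))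
          (≈-trans (≈-reflexive (*-assoc w v (g ^ k * T))) (≈-trans (*-≈ʳ w unit) (≈-reflexive (*-identityʳ w))))

  -- Relative to the fixed point, ℤ/p² consists of 0, the non-zero multiples of p and the units, and
  -- the powers of g act transitively on each. Every translate has a fixed point because g ≢ 1
  -- modulo p, so 1 - g is a unit.
  three-cycles-square : ∀ {N} → Prime (2 ℕ.+ N) → 1 ℕ.≤ N →
                        (2 ℕ.+ N) ℕ.* (2 ℕ.+ N) ℕ.∸ 3 ℕ.≤ t ((2 ℕ.+ N) ℕ.* (2 ℕ.+ N))
  three-cycles-square {N} p-prime 1≤N =
    let g , T , g-order , T≉0 , gᴺ≈ = primitive-root-p² p-prime
        g′ , unit = ≉0⇒unit-p² p-prime g (order⇒≉0 p-prime g-order)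
        w , unit-w = ≉0⇒unit-p² p-prime (1ℤ - g) (λ eq → order⇒≉1 (ℕ.s≤s 1≤N) g-order (≈-sym (-≈0⇒≈ 1ℤ g eq)))
    in t-lower-bound (affineₚ g g′ unit 0ℤ) λ b →
      let f = w * (g * rep b + 0ℤ) in
      ⟦ f ⟧ ∷ ⟦ f + + p ⟧ ∷ ⟦ f + 1ℤ ⟧ ∷ [] ,
      covers g T g-order T≉0 gᴺ≈ f (affineₚ-⊕ g g′ unit 0ℤ b) (unit⇒fixed-point g (g * rep b + 0ℤ) w unit-w) ,
      ℕ.≤-reflexive (ℕ.m+[n∸m]≡n (ℕ.≤-trans (ℕ.m≤m+n 3 6) (ℕ.*-mono-≤ (ℕ.s≤s (ℕ.s≤s 1≤N)) (ℕ.s≤s (ℕ.s≤s 1≤N)))))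
    where
    p : ℕ
    p = 2 ℕ.+ N

    covers : ∀ g T → IsOrder p g (1 ℕ.+ N) → ¬ T ≈ 0ℤ mod p → g ^ (1 ℕ.+ N) ≈ 1ℤ + T * + p mod (p ℕ.* p) →
             ∀ f {P : Fin (p ℕ.* p) → Fin (p ℕ.* p)} {c} → Affine P g c → g * f + c ≈ f mod (p ℕ.* p) →
             Covers P (⟦ f ⟧ ∷ ⟦ f + + p ⟧ ∷ ⟦ f + 1ℤ ⟧ ∷ [])
    covers g T g-order T≉0 gᴺ≈ f {P} affine fixed y = decide ((rep y - f) ≈0?mod p)
      where
      Goal : Set
      Goal = Any (λ x → Reaches P x y) (⟦ f ⟧ ∷ ⟦ f + + p ⟧ ∷ ⟦ f + 1ℤ ⟧ ∷ [])
      decide : Dec (rep y - f ≈ 0ℤ mod p) → Goal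
      decide (no u≉0) =
        let k , gᵏ≈u = discrete-log-p² p-prime g-order T≉0 gᴺ≈ (rep y - f) u≉0 in
        there (there (here (affine-reaches {P = P} f 1ℤ affine fixed (rep-⟦⟧ (f + 1ℤ)) k (≈-trans (≈-reflexive (*-identityʳ (g ^ k))) gᵏ≈u))))
      decide (yes (congruent v u≡)) = multiple (v ≈0?mod p)
        where
        u≡vp : rep y - f ≡ v * + p
        u≡vp = trans u≡ (+-identityˡ (v * + p))
        multiple : Dec (v ≈ 0ℤ mod p) → Goal
        multiple (yes v≈0) = here (0 , rep-injective (≈-trans (rep-⟦⟧ f)
          (≈-sym (-≈0⇒≈ (rep y) f (≈-trans (≈-reflexive u≡vp) (scale-≈ʳ p v≈0))))))
        multiple (no v≉0) =
          let k , gᵏ≈v = discrete-log p-prime g-order v v≉0 in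
          there (here (affine-reaches {P = P} f (+ p) affine fixed (rep-⟦⟧ (f + + p)) k
            (≈-trans (scale-≈ʳ p gᵏ≈v) (≈-reflexive (sym u≡vp)))))

-- The theorem

open Shifts using (t-product; five-cycles; three-cycles-square; RootPair; module Character; primitive-root; prime-coprime)
open import Data.Nat.Base using (ℕ; suc; _+_; _*_; _∸_; _≤_; _≥_; s≤s; z≤n; >-nonZero)
open import Data.Nat.Coprimality using (Coprime)
open import Data.Nat.Divisibility using (_∣_)
open import Data.Nat.Primality using (prime⇒irreducible; ¬prime[1])
open import Data.Nat.Properties using (≤-trans; ≤-total; *-comm; _≟_)
open import Data.Product.Base using (_,_; proj₂)
open import Data.Sum.Base using (_⊎_; inj₁; inj₂)
open import Relation.Binary.PropositionalEquality using (_≡_; _≢_; refl; subst)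
open import Relation.Nullary using (Dec; yes; no)

distinct-primes-coprime : ∀ {p q} → Prime p → Prime q → p ≢ q → Coprime q p
distinct-primes-coprime {p} {q} p-prime q-prime p≢q = prime-coprime p-prime p∤q
  where
  p∤q : p ∣ q → _
  p∤q p∣q with prime⇒irreducible q-prime p∣q
  ... | inj₁ refl = ¬prime[1] p-prime
  ... | inj₂ p≡q  = p≢q p≡q

swap-factors : ∀ a b {c} → a * b ∸ c ≤ t (a * b) → b * a ∸ c ≤ t (b * a)
swap-factors a b {c} = subst (λ k → k ∸ c ≤ t k) (*-comm a b)

-- By symmetry the larger prime can be taken as the base, as `five-cycles` requires.
t≥pq-5 : ∀ p q → Prime p → Prime q → p ≥ 3 → q ≥ 3 → t (p * q) ≥ p * q ∸ 5
t≥pq-5 (suc M) (suc N) p-prime q-prime (s≤s 2≤M) (s≤s 2≤N) = decide (≤-total M N)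
  where
  decide : M ≤ N ⊎ N ≤ M → t (suc M * suc N) ≥ suc M * suc N ∸ 5
  decide (inj₁ M≤N) = five-cycles {N} {M} q-prime p-prime 2≤M M≤N
  decide (inj₂ N≤M) = swap-factors (suc N) (suc M) {5} (five-cycles {M} {N} p-prime q-prime 2≤N N≤M)

t≥pq-3 : ∀ p q → Prime p → Prime q → p ≥ 3 → q ≥ 3 → (q ∸ 1) ∣ (p ∸ 1) → t (p * q) ≥ p * q ∸ 3
t≥pq-3 (suc (suc M)) (suc (suc N)) p-prime q-prime (s≤s (s≤s 1≤M)) (s≤s (s≤s 1≤N)) N∣M = decide (M ≟ N)
  where
  roots : RootPair M N
  roots = record
    { p-prime = p-prime ; q-prime = q-prime
    ; γ-order = proj₂ (primitive-root p-prime) ; g-order = proj₂ (primitive-root q-prime)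
    ; 1≤N = 1≤N ; N∣M = N∣M }

  decide : Dec (M ≡ N) → t (suc (suc M) * suc (suc N)) ≥ suc (suc M) * suc (suc N) ∸ 3
  decide (yes refl) = three-cycles-square {M} p-prime 1≤M
  decide (no  M≢N)  = swap-factors (suc (suc N)) (suc (suc M)) {3}
    (Character.three-cycles-coprime roots 1≤M
      (distinct-primes-coprime p-prime q-prime (λ { refl → M≢N refl })))

theorem1p4 : ((n m : ℕ) → n ≥ 2 → m ≥ 2 → t (n * m) ≥ n * t m + t n)
    × ((p q : ℕ) → Prime p → Prime q → p ≥ 3 → q ≥ 3 →
    (t (p * q) ≥ p * q ∸ 5)
    × ((q ∸ 1) ∣ (p ∸ 1) → t (p * q) ≥ p * q ∸ 3))
theorem1p4 =
  (λ n m n≥2 m≥2 → t-product n m {{>-nonZero (≤-trans (s≤s z≤n) n≥2)}} {{>-nonZero (≤-trans (s≤s z≤n) m≥2)}}) ,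
  (λ p q p-prime q-prime p≥3 q≥3 → t≥pq-5 p q p-prime q-prime p≥3 q≥3 , t≥pq-3 p q p-prime q-prime p≥3 q≥3)
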